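{- Let $M_1,M_2$ be matroids on the same ground set with $n$ elements, and let $H_k$ denote the number of pairs $(I_1,I_2)$, where $I_1$ is an independent set of $M_1$, $I_2$ is an independent set of $M_2$, $I_1\cap I_2=\emptyset$, and $I_1\cup I_2$ has exactly $k$ elements. Then for every integer $k$ with $0\leq k\leq n-2$, $$\frac{H_k}{\binom{n}{k}}\cdot \frac{H_{k+2}}{\binom{n}{k+2}}\leq \left(\frac{H_{k+1}}{\binom{n}{k+1}}\right)^2.$$
   Context: Matroids are finite matroids in the usual sense. Pairs $(I_1,I_2)$ are ordered, with $I_1$ independent in $M_1$ and $I_2$ independent in $M_2$. -}

module Defs where

open import Data.Bool.Properties using () renaming (_≟_ to _≟ᵇ_)
open import Data.Fin.Subset
open import Data.List.Base using (List; [_]; _++_; map; filter; length; cartesianProduct)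
open import Data.List.Membership.Propositional using () renaming (_∈_ to _∈ˡ_)
open import Data.List.Membership.Propositional.Properties using (∈-map⁺; ∈-map⁻; ∈-++⁺ˡ; ∈-++⁺ʳ)
open import Data.List.Relation.Binary.Disjoint.Propositional using (Disjoint)
open import Data.List.Relation.Unary.All using ([])
open import Data.List.Relation.Unary.AllPairs using ([]; _∷_)
open import Data.List.Relation.Unary.Any using (here)
open import Data.List.Relation.Unary.Unique.Propositional using (Unique)
open import Data.List.Relation.Unary.Unique.Propositional.Properties using (map⁺; ++⁺)
open import Data.Nat.Base using (ℕ; zero; suc; _+_; _≤_; _<_; s≤s; NonZero)
open import Data.Nat.Combinatorics using (_C_; nCk+nC[k+1]≡[n+1]C[k+1])
open import Data.Nat.Properties using (_≟_)
open import Data.Product.Base using (∃; _×_; _,_)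
open import Data.Rational.Base using (ℚ) renaming (_*_ to _*ℚ_)
open import Data.Vec.Base using ([]; _∷_)
open import Data.Vec.Properties using (∷-injectiveʳ; ≡-dec)
open import Level using (0ℓ)
open import Relation.Binary.PropositionalEquality using (_≡_; refl; subst)
open import Relation.Nullary.Decidable using (_×-dec_)
open import Relation.Unary using (Pred; Decidable)

private
  variable
    n : ℕ

-- The ground set is Fin n.  Decidability of independence is automatic
-- classically; here it is what makes independent sets countable.
record Matroid (n : ℕ) : Set₁ where
  field
    Independent  : Pred (Subset n) 0ℓ
    independent? : Decidable Independent
    empty        : Independent ⊥
    hereditary   : ∀ {I J} → I ⊆ J → Independent J → Independent I
    augmentation : ∀ {I J} → Independent I → Independent J → ∣ I ∣ < ∣ J ∣ →
                   ∃ λ x → x ∈ J × x ∉ I × Independent (I ∪ ⁅ x ⁆)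

open Matroid public

subsets : ∀ n → List (Subset n)
subsets zero    = [ [] ]
subsets (suc n) = map (outside ∷_) (subsets n) ++ map (inside ∷_) (subsets n)

∈-subsets : (p : Subset n) → p ∈ˡ subsets n
∈-subsets []            = here refl
∈-subsets (outside ∷ p) = ∈-++⁺ˡ (∈-map⁺ (outside ∷_) (∈-subsets p))
∈-subsets (inside ∷ p)  =
  ∈-++⁺ʳ (map (outside ∷_) (subsets _)) (∈-map⁺ (inside ∷_) (∈-subsets p))

subsets-unique : ∀ n → Unique (subsets n)
subsets-unique zero    = [] ∷ []
subsets-unique (suc n) =
  ++⁺ (map⁺ ∷-injectiveʳ (subsets-unique n)) (map⁺ ∷-injectiveʳ (subsets-unique n)) disjoint
  where
  disjoint : Disjoint (map (outside ∷_) (subsets n)) (map (inside ∷_) (subsets n))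
  disjoint (p∈out , p∈in) with ∈-map⁻ (outside ∷_) p∈out | ∈-map⁻ (inside ∷_) p∈in
  ... | _ , _ , refl | _ , _ , ()

module _ (M₁ M₂ : Matroid n) where

  DisjointIndependentPair : ℕ → Pred (Subset n × Subset n) 0ℓ
  DisjointIndependentPair k (I₁ , I₂) =
    Independent M₁ I₁ × Independent M₂ I₂ × I₁ ∩ I₂ ≡ ⊥ × ∣ I₁ ∪ I₂ ∣ ≡ k

  disjointIndependentPair? : ∀ k → Decidable (DisjointIndependentPair k)
  disjointIndependentPair? k (I₁ , I₂) =
    independent? M₁ I₁ ×-dec independent? M₂ I₂ ×-dec
    ≡-dec _≟ᵇ_ (I₁ ∩ I₂) ⊥ ×-dec (∣ I₁ ∪ I₂ ∣ ≟ k)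

  H : ℕ → ℕ
  H k = length (filter (disjointIndependentPair? k)
                       (cartesianProduct (subsets n) (subsets n)))

nCk≢0 : ∀ {n k} → k ≤ n → NonZero (n C k)
nCk≢0 {k = zero} _ = _
nCk≢0 {suc n} {suc k} (s≤s k≤n) =
  subst NonZero (nCk+nC[k+1]≡[n+1]C[k+1] n k) (+-nonZeroˡ (nCk≢0 k≤n))
  where
  +-nonZeroˡ : ∀ {a b} → NonZero a → NonZero (a + b)
  +-nonZeroˡ {suc _} _ = _

infix 8 _²

_² : ℚ → ℚ
q ² = q *ℚ q

{-# OPTIONS --safe #-}

-- Let E be two disjoint copies of the ground set, with variables xᵢ and yᵢ, and M = M₁ ⊕ M₂ on E.
-- For 0 < q ≤ 1 the polynomial F = Σ_A q^null(A) w^|A| z^(E∖A), z = (x, y), a homogeneous Potts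
-- partition function of the dual of M, is Lorentzian.  Its derivatives of degree 2 are hyperbolic
-- by Cauchy–Schwarz, because parallelism is an equivalence relation.  Hyperbolicity passes to
-- higher degrees by a Bochner argument: the Hessian, normalised to a Markov kernel P with top
-- eigenvalue 1, satisfies ⟨f, Pf⟩ ≤ ⟨Pf, Pf⟩, so its eigenvalues avoid (0, 1); as w is adjacent to
-- everything, 1 is simple.  Instead of eigenvalues, an iteration starting from the spectral gap
-- shows ⟨f, Pf⟩ ≤ 0 on the complement of the constants.
--
-- Let q → 0.  Differentiating F along ∂xᵢ + ∂yᵢ for every i distributes the ground set over the two
-- copies; n - k further derivatives along Σ ∂yᵢ and k along ∂w leave (n - k)! k! H_k.  The reverse
-- Cauchy–Schwarz inequality for the last two derivatives is the ultra-log-concavity of H_k.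

module Submission where

open import Algebra.Bundles using (CommutativeRing)
open import Data.Bool.Base using (Bool; true; false; if_then_else_)
open import Data.Fin.Base using (Fin; zero; suc)
open import Data.List.Base using (List; []; _∷_; foldr; length; map)
open import Data.List.Relation.Unary.All using (All; []; _∷_)
open import Data.Nat.Base as ℕ using (ℕ; zero; suc; _!)
import Data.Nat.Properties as ℕ
open import Data.Product.Base using (∃; _×_; _,_; proj₁; proj₂)
open import Data.Rational.Properties using (+-*-commutativeRing)
open import Data.Sum.Base using (_⊎_; inj₁; inj₂)
open import Data.Vec.Base using ([]; _∷_; lookup)
open import Relation.Binary.PropositionalEquality
open import Relation.Nullary using (¬_; Dec; yes; no; does; contradiction)
open import Tactic.RingSolver using (solve-∀)
open import Algebra.Properties.Semiring.Exp (CommutativeRing.semiring +-*-commutativeRing) using (_^_; ^-homo-*)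
open import Algebra.Properties.Semiring.Sum (CommutativeRing.semiring +-*-commutativeRing)

-- A rational symmetric matrix need not have rational eigenvalues, so signature is expressed
-- throughout by inequalities between values of the form, and limits carry an explicit rate. The
-- parameter q is there for positivity. At q = 0 the dependent sets have coefficient 0, and the
-- kernels built from derivatives can have zero degrees or fall apart, which leaves no gap to start
-- from. For q > 0 every coefficient is positive; since ∂/∂w deletes nothing, w is then joined to
-- each remaining variable with positive weight. The gap δ depends on q and may tend to 0, but the
-- inequality drawn from it no longer mentions δ, so it survives the limit. The directions that
-- extract H_k are merely nonnegative and are made positive by the same small parameter.
--
-- Evaluating a weight at A has a meaning that makes the induction possible: with F_A the part of
-- the polynomial on the variables of A, of degree |A|, the number `Ds as g A` is the derivative of
-- F_A along `as` and, for the remaining |A| - |as| times, along w. Hence a list of directions can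
-- be shortened one at a time while A varies freely.

module Rationals where
  open import Data.Integer.Base as ℤ using (-[1+_])
  import Data.Integer.Properties as ℤ
  open import Data.Rational.Base
  open import Data.Rational.Properties
  open import Data.Rational.Unnormalised.Base as ℚᵘ using (mkℚᵘ)
  import Data.Rational.Unnormalised.Properties as ℚᵘ
  open import Relation.Nullary.Decidable using (dec⇒maybe)
  open import Tactic.RingSolver.Core.AlmostCommutativeRing using (AlmostCommutativeRing; fromCommutativeRing)

  -- Ordered-field arithmetic over ℚ

  ring : AlmostCommutativeRing _ _
  ring = fromCommutativeRing +-*-commutativeRing λ x → dec⇒maybe (0ℚ ≟ x)

  2ℚ : ℚ
  2ℚ = 1ℚ + 1ℚ

  0≤1 : 0ℚ ≤ 1ℚ
  0≤1 = nonNegative⁻¹ 1ℚ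

  0<1 : 0ℚ < 1ℚ
  0<1 = positive⁻¹ 1ℚ

  -- The usual form of an estimate below: the slack `c` is displayed as a sum of visibly nonnegative
  -- products, and the ring solver settles the identity.
  ≤-by : ∀ {a b c} → 0ℚ ≤ c → a + c ≡ b → a ≤ b
  ≤-by {a} {b} {c} 0≤c a+c≡b =
    subst₂ _≤_ (+-identityʳ a) a+c≡b (+-monoʳ-≤ a 0≤c)

  0≤- : ∀ {a b} → a ≤ b → 0ℚ ≤ b - a
  0≤- {a} {b} a≤b = subst (_≤ b - a) (+-inverseʳ a) (+-monoˡ-≤ (- a) a≤b)

  0≤+ : ∀ {a b} → 0ℚ ≤ a → 0ℚ ≤ b → 0ℚ ≤ a + b
  0≤+ = +-mono-≤

  0≤* : ∀ {a b} → 0ℚ ≤ a → 0ℚ ≤ b → 0ℚ ≤ a * b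
  0≤* {a} {b} 0≤a 0≤b = subst (_≤ a * b) (*-zeroʳ a) (*-monoˡ-≤-nonNeg a 0≤b)
    where instance _ = nonNegative 0≤a

  0<* : ∀ {a b} → 0ℚ < a → 0ℚ < b → 0ℚ < a * b
  0<* {a} {b} 0<a 0<b = positive⁻¹ (a * b)
    where instance
      _ = positive 0<a
      _ = positive 0<b
      _ = pos*pos⇒pos a b

  *-monoˡ : ∀ {a b c} → 0ℚ ≤ c → a ≤ b → c * a ≤ c * b
  *-monoˡ {c = c} 0≤c = *-monoˡ-≤-nonNeg c
    where instance _ = nonNegative 0≤c

  *-cancelˡ : ∀ {a b c} → 0ℚ < c → c * a ≤ c * b → a ≤ b
  *-cancelˡ {c = c} 0<c = *-cancelˡ-≤-pos c
    where instance _ = positive 0<c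

  0≤sq : ∀ a → 0ℚ ≤ a * a
  0≤sq a with ≤-total 0ℚ a
  ... | inj₁ 0≤a = 0≤* 0≤a 0≤a
  ... | inj₂ a≤0 = subst (0ℚ ≤_) (neg² a) (0≤* (0≤neg a≤0) (0≤neg a≤0))
    where
    0≤neg : a ≤ 0ℚ → 0ℚ ≤ - a
    0≤neg = neg-antimono-≤
    neg² : ∀ a → - a * - a ≡ a * a
    neg² = solve-∀ ring

  0≤2ℚ* : ∀ {x} → 0ℚ ≤ 2ℚ * x → 0ℚ ≤ x
  0≤2ℚ* {x} 0≤2x = *-cancelˡ (positive⁻¹ 2ℚ) (subst (_≤ 2ℚ * x) (sym (*-zeroʳ 2ℚ)) 0≤2x)

  recip : ∀ {a} → 0ℚ < a → ∃ λ b → 0ℚ < b × a * b ≡ 1ℚ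
  recip {a} 0<a = 1/ a , positive⁻¹ (1/ a) , *-inverseʳ a
    where instance
      _ = positive 0<a
      _ = pos⇒nonZero a
      _ = 1/pos⇒pos a

  ⟦_⟧ : Bool → ℚ
  ⟦ b ⟧ = if b then 1ℚ else 0ℚ

  0≤⟦⟧ : ∀ b → 0ℚ ≤ ⟦ b ⟧
  0≤⟦⟧ true  = 0≤1
  0≤⟦⟧ false = ≤-refl

  -- Recursive, so that recurrences for cardinalities and factorials hold by computation; `/-*-ι` is
  -- the bridge to the quotients in the theorem.
  ι : ℕ → ℚ
  ι zero    = 0ℚ
  ι (suc k) = 1ℚ + ι k

  0≤ι : ∀ k → 0ℚ ≤ ι k
  0≤ι zero    = ≤-refl
  0≤ι (suc k) = 0≤+ 0≤1 (0≤ι k)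

  ι-pos : ∀ k → 0ℚ < ι (suc k)
  ι-pos k = +-mono-<-≤ 0<1 (0≤ι k)

  ι-+ : ∀ a b → ι (a ℕ.+ b) ≡ ι a + ι b
  ι-+ zero    b = sym (+-identityˡ (ι b))
  ι-+ (suc a) b = trans (cong (λ z → 1ℚ + z) (ι-+ a b)) (sym (+-assoc 1ℚ (ι a) (ι b)))

  ι-* : ∀ a b → ι (a ℕ.* b) ≡ ι a * ι b
  ι-* zero    b = sym (*-zeroˡ (ι b))
  ι-* (suc a) b = begin
    ι (b ℕ.+ a ℕ.* b)     ≡⟨ ι-+ b (a ℕ.* b) ⟩
    ι b + ι (a ℕ.* b)     ≡⟨ cong (ι b +_) (ι-* a b) ⟩
    ι b + ι a * ι b       ≡⟨ lemma (ι a) (ι b) ⟩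
    (1ℚ + ι a) * ι b      ∎
    where
    open ≡-Reasoning
    lemma : ∀ a b → b + a * b ≡ (1ℚ + a) * b
    lemma = solve-∀ ring

  toℚᵘ-ι : ∀ k → toℚᵘ (ι k) ℚᵘ.≃ mkℚᵘ (ℤ.+ k) 0
  toℚᵘ-ι zero    = ℚᵘ.≃-refl
  toℚᵘ-ι (suc k) = begin
    toℚᵘ (1ℚ + ι k)              ≈⟨ toℚᵘ-homo-+ 1ℚ (ι k) ⟩
    toℚᵘ 1ℚ ℚᵘ.+ toℚᵘ (ι k)      ≈⟨ ℚᵘ.+-congʳ (toℚᵘ 1ℚ) (toℚᵘ-ι k) ⟩
    toℚᵘ 1ℚ ℚᵘ.+ mkℚᵘ (ℤ.+ k) 0  ≈⟨ ℚᵘ.*≡* (cong (λ z → (ℤ.+ 1 ℤ.+ z) ℤ.* ℤ.+ 1) (ℤ.*-identityʳ (ℤ.+ k))) ⟩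
    mkℚᵘ (ℤ.+ suc k) 0           ∎
    where open ℚᵘ.≃-Reasoning

  /-*-ι : ∀ k m .{{_ : ℕ.NonZero m}} → (ℤ.+ k / m) * ι m ≡ ι k
  /-*-ι k m@(suc m-1) = toℚᵘ-injective (begin
    toℚᵘ ((ℤ.+ k / m) * ι m)                    ≈⟨ toℚᵘ-homo-* (ℤ.+ k / m) (ι m) ⟩
    toℚᵘ (ℤ.+ k / m) ℚᵘ.* toℚᵘ (ι m)            ≈⟨ ℚᵘ.*-cong (toℚᵘ-fromℚᵘ (mkℚᵘ (ℤ.+ k) m-1)) (toℚᵘ-ι m) ⟩
    mkℚᵘ (ℤ.+ k) m-1 ℚᵘ.* mkℚᵘ (ℤ.+ m) 0        ≈⟨ ℚᵘ.*≡* (lemma (ℤ.+ k) (ℤ.+ m)) ⟩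
    mkℚᵘ (ℤ.+ k) 0                              ≈⟨ toℚᵘ-ι k ⟨
    toℚᵘ (ι k)                                  ∎)
    where
    open ℚᵘ.≃-Reasoning
    lemma : ∀ a b → a ℤ.* b ℤ.* ℤ.+ 1 ≡ a ℤ.* (b ℤ.* ℤ.+ 1)
    lemma a b = ℤ.*-assoc a b (ℤ.+ 1)

  -- The denominator is at least 1, so the numerator serves when it is nonnegative, and 0 otherwise.
  ≤ι : ∀ x → ∃ λ k → x ≤ ι k
  ≤ι x@(mkℚ (ℤ.+ k) d c) = k , toℚᵘ-cancel-≤ (ℚᵘ.≤-respʳ-≃ (ℚᵘ.≃-sym (toℚᵘ-ι k))
    (ℚᵘ.*≤* (ℤ.*-monoˡ-≤-nonNeg (ℤ.+ k) (ℤ.+≤+ (ℕ.s≤s ℕ.z≤n)))))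
  ≤ι x@(mkℚ -[1+ k ] d c) = 0 , <⇒≤ (negative⁻¹ x)

  archimedean : ∀ {a} b → 0ℚ < a → ∃ λ k → b ≤ ι k * a
  archimedean {a} b 0<a =
    let c , 0<c , ac≡1 = recip 0<a
        k , bc≤k = ≤ι (b * c)
    in k , (begin
      b            ≡⟨ *-identityʳ b ⟨
      b * 1ℚ       ≡⟨ cong (b *_) ac≡1 ⟨
      b * (a * c)  ≡⟨ lemma a b c ⟩
      a * (b * c)  ≤⟨ *-monoˡ (<⇒≤ 0<a) bc≤k ⟩
      a * ι k      ≡⟨ *-comm a (ι k) ⟩
      ι k * a      ∎)
    where
    open ≤-Reasoning
    lemma : ∀ a b c → b * (a * c) ≡ a * (b * c)
    lemma = solve-∀ ring

  -- Finite sums and symmetric bilinear forms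

  private
    variable
      n : ℕ

  sum-nonneg : ∀ (f : Fin n → ℚ) → (∀ i → 0ℚ ≤ f i) → 0ℚ ≤ sum f
  sum-nonneg {zero}  f 0≤f = ≤-refl
  sum-nonneg {suc n} f 0≤f = 0≤+ (0≤f zero) (sum-nonneg _ λ i → 0≤f (suc i))

  sum-mono : ∀ (f g : Fin n → ℚ) → (∀ i → f i ≤ g i) → sum f ≤ sum g
  sum-mono {zero}  f g f≤g = ≤-refl
  sum-mono {suc n} f g f≤g = +-mono-≤ (f≤g zero) (sum-mono _ _ λ i → f≤g (suc i))

  sum-linear : ∀ (f g : Fin n → ℚ) t → sum (λ i → f i + t * g i) ≡ sum f + t * sum g
  sum-linear f g t = trans (∑-distrib-+ f (λ i → t * g i)) (cong (sum f +_) (sym (*-distribˡ-sum t g)))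

  sum-quadratic : ∀ (f g h : Fin n → ℚ) t u →
                  sum (λ i → f i + t * g i + u * h i) ≡ sum f + t * sum g + u * sum h
  sum-quadratic f g h t u = trans (sum-linear (λ i → f i + t * g i) h u) (cong (_+ u * sum h) (sum-linear f g t))

  infix 8 _·_ _⊛_

  _·_ : (Fin n → ℚ) → (Fin n → ℚ) → ℚ
  f · g = sum λ i → f i * g i

  _⊛_ : (Fin n → Fin n → ℚ) → (Fin n → ℚ) → Fin n → ℚ
  (W ⊛ f) i = W i · f

  form : (Fin n → Fin n → ℚ) → (Fin n → ℚ) → ℚ
  form W f = f · (W ⊛ f)

  ⊛-symmetric : ∀ (W : Fin n → Fin n → ℚ) → (∀ i j → W i j ≡ W j i) →
                ∀ f g → f · (W ⊛ g) ≡ g · (W ⊛ f)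
  ⊛-symmetric W W-sym f g = begin
    sum (λ i → f i * sum (λ j → W i j * g j))      ≡⟨ sum-cong-≗ (λ i → *-distribˡ-sum (f i) (λ j → W i j * g j)) ⟩
    sum (λ i → sum (λ j → f i * (W i j * g j)))    ≡⟨ ∑-comm (λ i j → f i * (W i j * g j)) ⟩
    sum (λ j → sum (λ i → f i * (W i j * g j)))    ≡⟨ sum-cong-≗ (λ j → sum-cong-≗ (λ i →
                                                         trans (cong (λ w → f i * (w * g j)) (W-sym i j)) (lemma (f i) (W j i) (g j)))) ⟩
    sum (λ j → sum (λ i → g j * (W j i * f i)))    ≡⟨ sum-cong-≗ (λ j → *-distribˡ-sum (g j) (λ i → W j i * f i)) ⟨
    sum (λ j → g j * sum (λ i → W j i * f i))      ∎
    where
    open ≡-Reasoning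
    lemma : ∀ a b c → a * (b * c) ≡ c * (b * a)
    lemma = solve-∀ ring

  ⊛-linear : ∀ (W : Fin n → Fin n → ℚ) f g t i → (W ⊛ (λ j → f j + t * g j)) i ≡ (W ⊛ f) i + t * (W ⊛ g) i
  ⊛-linear W f g t i = trans (sum-cong-≗ λ j → lemma (W i j) (f j) t (g j)) (sum-linear (λ j → W i j * f j) (λ j → W i j * g j) t)
    where
    lemma : ∀ w f t g → w * (f + t * g) ≡ w * f + t * (w * g)
    lemma = solve-∀ ring

  form-linear : ∀ (W : Fin n → Fin n → ℚ) → (∀ i j → W i j ≡ W j i) → ∀ f g t →
                form W (λ j → f j + t * g j) ≡ form W f + (2ℚ * t) * (g · (W ⊛ f)) + (t * t) * form W g
  form-linear W W-sym f g t = begin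
    sum (λ i → (f i + t * g i) * (W ⊛ (λ j → f j + t * g j)) i)
      ≡⟨ sum-cong-≗ (λ i → trans (cong ((f i + t * g i) *_) (⊛-linear W f g t i))
                                  (lemma (f i) t (g i) ((W ⊛ f) i) ((W ⊛ g) i))) ⟩
    sum (λ i → f i * (W ⊛ f) i + t * (f i * (W ⊛ g) i + g i * (W ⊛ f) i) + (t * t) * (g i * (W ⊛ g) i))
      ≡⟨ sum-quadratic (λ i → f i * (W ⊛ f) i) (λ i → f i * (W ⊛ g) i + g i * (W ⊛ f) i) (λ i → g i * (W ⊛ g) i) t (t * t) ⟩
    form W f + t * sum (λ i → f i * (W ⊛ g) i + g i * (W ⊛ f) i) + (t * t) * form W g
      ≡⟨ cong (λ z → form W f + t * z + (t * t) * form W g)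
           (trans (∑-distrib-+ (λ i → f i * (W ⊛ g) i) (λ i → g i * (W ⊛ f) i))
                  (cong (_+ (g · (W ⊛ f))) (⊛-symmetric W W-sym f g))) ⟩
    form W f + t * (g · (W ⊛ f) + g · (W ⊛ f)) + (t * t) * form W g
      ≡⟨ lemma₂ (form W f) t (g · (W ⊛ f)) (form W g) ⟩
    form W f + (2ℚ * t) * (g · (W ⊛ f)) + (t * t) * form W g ∎
    where
    open ≡-Reasoning
    lemma : ∀ f t g wf wg → (f + t * g) * (wf + t * wg) ≡ f * wf + t * (f * wg + g * wf) + (t * t) * (g * wg)
    lemma = solve-∀ ring
    lemma₂ : ∀ a t b c → a + t * (b + b) + (t * t) * c ≡ a + ((1ℚ + 1ℚ) * t) * b + (t * t) * c
    lemma₂ = solve-∀ ring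

-- Spectral gap of a weighted graph and its amplification

module DirichletForms where
  open import Data.Rational.Base
  open import Data.Rational.Properties
  open Rationals

  module Markov {K : ℕ} (W : Fin (suc K) → Fin (suc K) → ℚ)
    (W-sym : ∀ i j → W i j ≡ W j i) (0≤W : ∀ i j → 0ℚ ≤ W i j) where

    d : Fin (suc K) → ℚ
    d i = sum (W i)

    0≤d : ∀ i → 0ℚ ≤ d i
    0≤d i = sum-nonneg (W i) (0≤W i)

    norm : (Fin (suc K) → ℚ) → ℚ
    norm f = sum λ i → d i * (f i * f i)

    norm-linear : ∀ f g t → norm (λ i → f i + t * g i)
                          ≡ norm f + (2ℚ * t) * sum (λ i → d i * (f i * g i)) + (t * t) * norm g
    norm-linear f g t = trans (sum-cong-≗ λ i → lemma (d i) (f i) t (g i))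
      (sum-quadratic (λ i → d i * (f i * f i)) (λ i → d i * (f i * g i)) (λ i → d i * (g i * g i)) (2ℚ * t) (t * t))
      where
      lemma : ∀ d f t g → d * ((f + t * g) * (f + t * g))
                        ≡ d * (f * f) + ((1ℚ + 1ℚ) * t) * (d * (f * g)) + (t * t) * (d * (g * g))
      lemma = solve-∀ ring

    -- One expansion for both signs: σ = -1 is the Dirichlet energy 2(`norm` - `form`), used for the
    -- gap, and σ = 1 gives 2(`norm` + `form`), which keeps the spectrum above -1.
    dirichlet : ∀ f σ → sum (λ i → sum (λ j → W i j * ((f i + σ * f j) * (f i + σ * f j))))
                      ≡ norm f + (2ℚ * σ) * form W f + (σ * σ) * norm f
    dirichlet f σ = begin
      sum (λ i → sum (λ j → W i j * ((f i + σ * f j) * (f i + σ * f j))))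
        ≡⟨ sum-cong-≗ (λ i → trans (sum-cong-≗ (λ j → lemma (W i j) (f i) σ (f j)))
             (sum-quadratic (λ j → (f i * f i) * W i j) (λ j → f i * (W i j * f j)) (λ j → W i j * (f j * f j)) (2ℚ * σ) (σ * σ))) ⟩
      sum (λ i → sum (λ j → (f i * f i) * W i j) + (2ℚ * σ) * sum (λ j → f i * (W i j * f j)) + (σ * σ) * sum (λ j → W i j * (f j * f j)))
        ≡⟨ sum-quadratic (λ i → sum (λ j → (f i * f i) * W i j)) (λ i → sum (λ j → f i * (W i j * f j)))
                         (λ i → sum (λ j → W i j * (f j * f j))) (2ℚ * σ) (σ * σ) ⟩
      sum (λ i → sum (λ j → (f i * f i) * W i j)) + (2ℚ * σ) * sum (λ i → sum (λ j → f i * (W i j * f j)))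
        + (σ * σ) * sum (λ i → sum (λ j → W i j * (f j * f j)))
        ≡⟨ cong₂ _+_ (cong₂ _+_ rows (cong ((2ℚ * σ) *_) middle)) (cong ((σ * σ) *_) columns) ⟩
      norm f + (2ℚ * σ) * form W f + (σ * σ) * norm f ∎
      where
      open ≡-Reasoning
      lemma : ∀ w a σ b → w * ((a + σ * b) * (a + σ * b))
                        ≡ (a * a) * w + ((1ℚ + 1ℚ) * σ) * (a * (w * b)) + (σ * σ) * (w * (b * b))
      lemma = solve-∀ ring
      row : ∀ i → sum (λ j → (f i * f i) * W i j) ≡ d i * (f i * f i)
      row i = trans (sym (*-distribˡ-sum (f i * f i) (W i))) (*-comm (f i * f i) (d i))
      rows : sum (λ i → sum (λ j → (f i * f i) * W i j)) ≡ norm f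
      rows = sum-cong-≗ row
      middle : sum (λ i → sum (λ j → f i * (W i j * f j))) ≡ form W f
      middle = sum-cong-≗ λ i → sym (*-distribˡ-sum (f i) (λ j → W i j * f j))
      columns : sum (λ i → sum (λ j → W i j * (f j * f j))) ≡ norm f
      columns = trans (∑-comm (λ i j → W i j * (f j * f j)))
        (sum-cong-≗ λ j → trans (sum-cong-≗ λ i → trans (cong (_* (f j * f j)) (W-sym i j)) (*-comm (W j i) (f j * f j))) (row j))

    0≤norm : ∀ f → 0ℚ ≤ norm f
    0≤norm f = sum-nonneg _ λ i → 0≤* (0≤d i) (0≤sq (f i))

    0≤norm+form : ∀ f → 0ℚ ≤ norm f + form W f
    0≤norm+form f = 0≤2ℚ* (subst (0ℚ ≤_) (trans (dirichlet f 1ℚ) (lemma (norm f) (form W f)))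
      (sum-nonneg _ λ i → sum-nonneg _ λ j → 0≤* (0≤W i j) (0≤sq (f i + 1ℚ * f j))))
      where
      lemma : ∀ n q → n + ((1ℚ + 1ℚ) * 1ℚ) * q + (1ℚ * 1ℚ) * n ≡ (1ℚ + 1ℚ) * (n + q)
      lemma = solve-∀ ring

    module _ (δ : ℚ) (0<δ : 0ℚ < δ) (star : ∀ i → 2ℚ * δ * d i ≤ W zero i) where

      -- Every vertex is joined to vertex 0, and the mean minimises the second moment.
      gap : ∀ f → sum (λ i → d i * f i) ≡ 0ℚ → δ * norm f ≤ norm f - form W f
      gap f mean≡0 = *-cancelˡ (positive⁻¹ 2ℚ) (begin
        2ℚ * (δ * norm f)
          ≤⟨ ≤-by (0≤* (0≤* (<⇒≤ (0<* (positive⁻¹ 2ℚ) 0<δ)) (0≤sq (f zero))) (sum-nonneg d 0≤d)) refl ⟩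
        2ℚ * (δ * norm f) + (2ℚ * δ) * (f zero * f zero) * sum d
          ≡⟨ lemma₁ (2ℚ) δ (norm f) (f zero) (sum d) ⟩
        (2ℚ * δ) * (norm f + (- 2ℚ * f zero) * 0ℚ + (f zero * f zero) * sum d)
          ≡⟨ cong (λ z → (2ℚ * δ) * (norm f + (- 2ℚ * f zero) * z + (f zero * f zero) * sum d)) mean≡0 ⟨
        (2ℚ * δ) * (norm f + (- 2ℚ * f zero) * sum (λ i → d i * f i) + (f zero * f zero) * sum d)
          ≡⟨ cong ((2ℚ * δ) *_) (sum-quadratic (λ i → d i * (f i * f i)) (λ i → d i * f i) d (- 2ℚ * f zero) (f zero * f zero)) ⟨
        (2ℚ * δ) * sum (λ i → d i * (f i * f i) + (- 2ℚ * f zero) * (d i * f i) + (f zero * f zero) * d i)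
          ≡⟨ *-distribˡ-sum (2ℚ * δ) (λ i → d i * (f i * f i) + (- 2ℚ * f zero) * (d i * f i) + (f zero * f zero) * d i) ⟩
        sum (λ i → (2ℚ * δ) * (d i * (f i * f i) + (- 2ℚ * f zero) * (d i * f i) + (f zero * f zero) * d i))
          ≡⟨ sum-cong-≗ (λ i → lemma₂ (2ℚ * δ) (d i) (f i) (f zero)) ⟩
        sum (λ i → ((f zero + - 1ℚ * f i) * (f zero + - 1ℚ * f i)) * (2ℚ * δ * d i))
          ≤⟨ sum-mono _ _ (λ i → *-monoˡ (0≤sq (f zero + - 1ℚ * f i)) (star i)) ⟩
        sum (λ i → ((f zero + - 1ℚ * f i) * (f zero + - 1ℚ * f i)) * W zero i)
          ≡⟨ sum-cong-≗ (λ i → *-comm ((f zero + - 1ℚ * f i) * (f zero + - 1ℚ * f i)) (W zero i)) ⟩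
        E zero
          ≤⟨ ≤-by (sum-nonneg (λ i → E (suc i)) λ i → 0≤E (suc i)) refl ⟩
        sum E
          ≡⟨ trans (dirichlet f (- 1ℚ)) (lemma₃ (norm f) (form W f)) ⟩
        2ℚ * (norm f - form W f) ∎)
        where
        open ≤-Reasoning
        E : Fin (suc K) → ℚ
        E i = sum (λ j → W i j * ((f i + - 1ℚ * f j) * (f i + - 1ℚ * f j)))
        0≤E : ∀ i → 0ℚ ≤ E i
        0≤E i = sum-nonneg _ λ j → 0≤* (0≤W i j) (0≤sq (f i + - 1ℚ * f j))
        lemma₁ : ∀ t δ n f s → t * (δ * n) + (t * δ) * (f * f) * s ≡ (t * δ) * (n + (- t * f) * 0ℚ + (f * f) * s)
        lemma₁ = solve-∀ ring
        lemma₂ : ∀ c d f g → c * (d * (f * f) + (- (1ℚ + 1ℚ) * g) * (d * f) + (g * g) * d)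
                           ≡ ((g + - 1ℚ * f) * (g + - 1ℚ * f)) * (c * d)
        lemma₂ = solve-∀ ring
        lemma₃ : ∀ n q → n + ((1ℚ + 1ℚ) * - 1ℚ) * q + (- 1ℚ * - 1ℚ) * n ≡ (1ℚ + 1ℚ) * (n - q)
        lemma₃ = solve-∀ ring

      -- `e` is a pseudo-inverse of `d`, because degrees of vertices outside the support are 0. The
      -- two equations say that the kernel `e i * W i j` behaves as if `d` were invertible.
      module _ (e : Fin (suc K) → ℚ)
        (ed-W : ∀ i j → e i * d i * W i j ≡ W i j) (ed-e : ∀ i → e i * d i * e i ≡ e i)
        (bochner : ∀ f → form W f ≤ sum (λ i → e i * ((W ⊛ f) i * (W ⊛ f) i))) where

        P : (Fin (suc K) → ℚ) → Fin (suc K) → ℚ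
        P f i = e i * (W ⊛ f) i

        ed-W⊛ : ∀ f i → e i * d i * (W ⊛ f) i ≡ (W ⊛ f) i
        ed-W⊛ f i = trans (*-distribˡ-sum (e i * d i) (λ j → W i j * f j))
          (sum-cong-≗ λ j → trans (sym (*-assoc (e i * d i) (W i j) (f j))) (cong (_* f j) (ed-W i j)))

        norm-P : ∀ f → norm (P f) ≡ sum (λ i → e i * ((W ⊛ f) i * (W ⊛ f) i))
        norm-P f = sum-cong-≗ λ i → trans (lemma (d i) (e i) ((W ⊛ f) i)) (cong (_* ((W ⊛ f) i * (W ⊛ f) i)) (ed-e i))
          where
          lemma : ∀ d e w → d * ((e * w) * (e * w)) ≡ (e * d * e) * (w * w)
          lemma = solve-∀ ring

        -- By symmetry the column sums of `W` are `d`. This keeps `f + t P f` among the functions of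
        -- mean zero, where a `Bound` can be applied again.
        mean-P : ∀ f → sum (λ i → d i * P f i) ≡ sum (λ i → d i * f i)
        mean-P f = begin
          sum (λ i → d i * (e i * (W ⊛ f) i))
            ≡⟨ sum-cong-≗ (λ i → trans (lemma (d i) (e i) ((W ⊛ f) i)) (ed-W⊛ f i)) ⟩
          sum (λ i → (W ⊛ f) i)
            ≡⟨ ∑-comm (λ i j → W i j * f j) ⟩
          sum (λ j → sum (λ i → W i j * f j))
            ≡⟨ sum-cong-≗ (λ j → trans (sum-cong-≗ λ i → cong (_* f j) (W-sym i j)) (sym (*-distribʳ-sum (f j) (W j)))) ⟩
          sum (λ j → d j * f j) ∎
          where
          open ≡-Reasoning
          lemma : ∀ d e w → d * (e * w) ≡ e * d * w
          lemma = solve-∀ ring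

        f·Pf : ∀ f → sum (λ i → d i * (f i * P f i)) ≡ form W f
        f·Pf f = sum-cong-≗ λ i → trans (lemma (d i) (f i) (e i) ((W ⊛ f) i)) (cong (f i *_) (ed-W⊛ f i))
          where
          lemma : ∀ d f e w → d * (f * (e * w)) ≡ f * (e * d * w)
          lemma = solve-∀ ring

        Pf·Wf : ∀ f → P f · (W ⊛ f) ≡ norm (P f)
        Pf·Wf f = trans (sum-cong-≗ λ i → *-assoc (e i) ((W ⊛ f) i) ((W ⊛ f) i)) (sym (norm-P f))

        -- Spectrally, for c > 0: off the constants the eigenvalues of `P` are at most 1/c. Letting
        -- c grow without limit therefore excludes positive ones.
        Bound : ℚ → Set
        Bound c = ∀ f → sum (λ i → d i * f i) ≡ 0ℚ → c * form W f ≤ norm f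

        -- The gap bounds the eigenvalues by 1 - δ, which is at most 1/(1 + δ).
        bound₀ : Bound (1ℚ + δ)
        bound₀ f mean≡0 = begin
          (1ℚ + δ) * form W f    ≡⟨ lemma δ (form W f) ⟩
          δ * form W f + form W f ≤⟨ +-monoˡ-≤ (form W f) (*-monoˡ (<⇒≤ 0<δ) q≤n) ⟩
          δ * norm f + form W f  ≤⟨ +-monoˡ-≤ (form W f) (gap f mean≡0) ⟩
          norm f - form W f + form W f ≡⟨ lemma₂ (norm f) (form W f) ⟩
          norm f                 ∎
          where
          open ≤-Reasoning
          lemma : ∀ δ q → (1ℚ + δ) * q ≡ δ * q + q
          lemma = solve-∀ ring
          lemma₂ : ∀ n q → n - q + q ≡ n
          lemma₂ = solve-∀ ring
          q≤n : form W f ≤ norm f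
          q≤n = ≤-by (≤-trans (0≤* (<⇒≤ 0<δ) (0≤norm f)) (gap f mean≡0)) (lemma₃ (norm f) (form W f))
            where
            lemma₃ : ∀ n q → q + (n - q) ≡ n
            lemma₃ = solve-∀ ring

        r : ℚ
        r = proj₁ (recip (+-mono-<-≤ 0<1 (0≤+ 0≤1 (<⇒≤ 0<δ))))

        0<r : 0ℚ < r
        0<r = proj₁ (proj₂ (recip (+-mono-<-≤ 0<1 (0≤+ 0≤1 (<⇒≤ 0<δ)))))

        r-inverse : (1ℚ + (1ℚ + δ)) * r ≡ 1ℚ
        r-inverse = proj₂ (proj₂ (recip (+-mono-<-≤ 0<1 (0≤+ 0≤1 (<⇒≤ 0<δ)))))

        -- t = δ/(2 + δ). In `improve` the coefficient of s = `norm (P f)` comes to t(2(δ + c) - t(2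
        -- + δ + c)); with t(2 + δ) = δ this is tδ + ct(2 - t), so at least θ = tδ is gained
        -- whatever c is.
        t : ℚ
        t = δ * r

        θ : ℚ
        θ = t * δ

        -- Apply the bound to f + t P f: by the Bochner inequality the first-order term in t improves it.
        improve : ∀ c → 0ℚ ≤ c → Bound ((1ℚ + δ) + c) → Bound ((1ℚ + δ) + c + θ)
        improve c 0≤c bound f mean≡0 = ≤-by {c = gain} 0≤gain gain≡
          where
          open ≡-Reasoning
          g = P f
          q = form W f
          s = norm g
          q₂ = form W g
          C = (1ℚ + δ) + c
          f+tg : Fin (suc K) → ℚ
          f+tg i = f i + t * g i
          mean : sum (λ i → d i * f+tg i) ≡ 0ℚ
          mean = begin
            sum (λ i → d i * (f i + t * g i))         ≡⟨ sum-cong-≗ (λ i → lemma (d i) (f i) t (g i)) ⟩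
            sum (λ i → d i * f i + t * (d i * g i))   ≡⟨ sum-linear (λ i → d i * f i) (λ i → d i * g i) t ⟩
            sum (λ i → d i * f i) + t * sum (λ i → d i * g i) ≡⟨ cong₂ (λ x y → x + t * y) mean≡0 (trans (mean-P f) mean≡0) ⟩
            0ℚ + t * 0ℚ                               ≡⟨ trans (+-identityˡ (t * 0ℚ)) (*-zeroʳ t) ⟩
            0ℚ                                        ∎
            where
            lemma : ∀ d f t g → d * (f + t * g) ≡ d * f + t * (d * g)
            lemma = solve-∀ ring
          slack : 0ℚ ≤ (norm f + (2ℚ * t) * q + (t * t) * s) - C * (q + (2ℚ * t) * s + (t * t) * q₂)
          slack = subst₂ (λ x y → 0ℚ ≤ x - C * y)
            (trans (norm-linear f g t) (cong (λ z → norm f + (2ℚ * t) * z + (t * t) * s) (f·Pf f)))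
            (trans (form-linear W W-sym f g t) (cong (λ z → q + (2ℚ * t) * z + (t * t) * q₂) (Pf·Wf f)))
            (0≤- (bound f+tg mean))
          0≤t : 0ℚ ≤ t
          0≤t = <⇒≤ (0<* 0<δ 0<r)
          0≤s-q : 0ℚ ≤ s - q
          0≤s-q = 0≤- (subst (q ≤_) (sym (norm-P f)) (bochner f))
          0≤2-t : 0ℚ ≤ 2ℚ - t
          0≤2-t = subst (0ℚ ≤_) (begin
            r * (2ℚ + (2ℚ + δ))                 ≡⟨ lemma₁ δ r ⟩
            2ℚ * ((1ℚ + (1ℚ + δ)) * r) - δ * r   ≡⟨ cong (λ z → 2ℚ * z - δ * r) r-inverse ⟩
            2ℚ * 1ℚ - δ * r                     ≡⟨ cong (_- δ * r) (*-identityʳ 2ℚ) ⟩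
            2ℚ - δ * r                          ∎)
            (0≤* (<⇒≤ 0<r) (0≤+ (0≤+ 0≤1 0≤1) (0≤+ (0≤+ 0≤1 0≤1) (<⇒≤ 0<δ))))
            where
            lemma₁ : ∀ δ r → r * (1ℚ + 1ℚ + (1ℚ + 1ℚ + δ)) ≡ (1ℚ + 1ℚ) * ((1ℚ + (1ℚ + δ)) * r) - δ * r
            lemma₁ = solve-∀ ring
          0≤s : 0ℚ ≤ s
          0≤s = 0≤norm g
          0≤C : 0ℚ ≤ C
          0≤C = 0≤+ (0≤+ 0≤1 (<⇒≤ 0<δ)) 0≤c
          -- First the slack of the hypothesis at f + tg, then the three inequalities that are
          -- spent: s + q₂ ≥ 0 (spectrum above -1), s ≥ q (Bochner), and s ≥ 0 together with t ≤ 2.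
          gain : ℚ
          gain = ((norm f + (2ℚ * t) * q + (t * t) * s) - C * (q + (2ℚ * t) * s + (t * t) * q₂))
               + C * (t * t) * (s + q₂)
               + (2ℚ * t + θ) * (s - q)
               + c * (t * (2ℚ - t)) * s
          0≤gain : 0ℚ ≤ gain
          0≤gain = 0≤+ (0≤+ (0≤+ slack (0≤* (0≤* 0≤C (0≤sq t)) (0≤norm+form g)))
            (0≤* (0≤+ (0≤* (0≤+ 0≤1 0≤1) 0≤t) (0≤* 0≤t (<⇒≤ 0<δ))) 0≤s-q))
            (0≤* (0≤* 0≤c (0≤* 0≤t 0≤2-t)) 0≤s)
          t-choice : t * (1ℚ + (1ℚ + δ)) ≡ δ
          t-choice = trans (lemma δ r) (trans (cong (δ *_) r-inverse) (*-identityʳ δ))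
            where
            lemma : ∀ δ r → δ * r * (1ℚ + (1ℚ + δ)) ≡ δ * ((1ℚ + (1ℚ + δ)) * r)
            lemma = solve-∀ ring
          gain≡ : (C + θ) * q + gain ≡ norm f
          gain≡ = begin
            (C + θ) * q + gain                             ≡⟨ lemma δ c t q s q₂ (norm f) ⟩
            norm f + t * s * (t * (1ℚ + (1ℚ + δ)) - δ)     ≡⟨ cong (λ z → norm f + t * s * (z - δ)) t-choice ⟩
            norm f + t * s * (δ - δ)                       ≡⟨ lemma₂ (norm f) (t * s) δ ⟩
            norm f                                         ∎
            where
            lemma : ∀ δ c t q s q₂ n →
              ((1ℚ + δ) + c + t * δ) * q
                + (((n + ((1ℚ + 1ℚ) * t) * q + (t * t) * s) - ((1ℚ + δ) + c) * (q + ((1ℚ + 1ℚ) * t) * s + (t * t) * q₂))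
                   + ((1ℚ + δ) + c) * (t * t) * (s + q₂)
                   + ((1ℚ + 1ℚ) * t + t * δ) * (s - q)
                   + c * (t * ((1ℚ + 1ℚ) - t)) * s)
              ≡ n + t * s * (t * (1ℚ + (1ℚ + δ)) - δ)
            lemma = solve-∀ ring
            lemma₂ : ∀ n x δ → n + x * (δ - δ) ≡ n
            lemma₂ = solve-∀ ring

        bounds : ∀ k → Bound ((1ℚ + δ) + ι k * θ)
        bounds zero    = subst Bound (lemma δ θ) bound₀
          where
          lemma : ∀ δ θ → 1ℚ + δ ≡ (1ℚ + δ) + 0ℚ * θ
          lemma = solve-∀ ring
        bounds (suc k) = subst Bound (lemma δ θ (ι k))
          (improve (ι k * θ) (0≤* (0≤ι k) (0≤* (0≤* (<⇒≤ 0<δ) (<⇒≤ 0<r)) (<⇒≤ 0<δ))) (bounds k))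
          where
          lemma : ∀ δ θ k → (1ℚ + δ) + k * θ + θ ≡ (1ℚ + δ) + (1ℚ + k) * θ
          lemma = solve-∀ ring

        -- A positive value q would be multiplied by 1 + δ + kθ for every k and still stay below the
        -- fixed number `norm f`, against the Archimedean property.
        form≤0 : ∀ f → sum (λ i → d i * f i) ≡ 0ℚ → form W f ≤ 0ℚ
        form≤0 f mean≡0 with form W f ≤? 0ℚ
        ... | yes q≤0 = q≤0
        ... | no q≰0 = contradiction impossible (λ q≤0 → <-irrefl refl (<-≤-trans 0<q q≤0))
          where
          0<q : 0ℚ < form W f
          0<q = ≰⇒> q≰0
          arch = archimedean (norm f) (0<* (0<* (0<* 0<δ 0<r) 0<δ) 0<q)
          k = proj₁ arch
          impossible : form W f ≤ 0ℚ
          impossible = ≤-by {c = slack} (0≤+ (0≤+ (0≤- (bounds k f mean≡0)) (0≤- (proj₂ arch))) (0≤* (<⇒≤ 0<δ) (<⇒≤ 0<q)))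
            (lemma δ (ι k) θ (form W f) (norm f))
            where
            slack = (norm f - ((1ℚ + δ) + ι k * θ) * form W f) + (ι k * (θ * form W f) - norm f) + δ * form W f
            lemma : ∀ δ k θ q n → q + ((n - ((1ℚ + δ) + k * θ) * q) + (k * (θ * q) - n) + δ * q) ≡ 0ℚ
            lemma = solve-∀ ring

-- Hyperbolic forms and their passage to higher degree

module Hyperbolicity where
  open import Data.Fin.Properties using (_≟_)
  open import Data.Fin.Subset using (Subset; outside; ∣_∣)
  open import Data.Rational.Base hiding (∣_∣)
  open import Data.Rational.Properties hiding (_≟_)
  open import Data.Vec.Base using (_[_]≔_)
  open import Data.Vec.Properties using ([]≔-commutes; lookup∘update′)
  open Rationals
  open DirichletForms

  -- Move x along b into the hyperplane orthogonal to a, where the form is nonpositive; multiply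
  -- that inequality by the value at b and complete the square. As b may differ from a, one good
  -- hyperplane gives the inequality for every admissible b.
  reverse-cauchy-schwarz : ∀ {n} (M : Fin n → Fin n → ℚ) → (∀ i j → M i j ≡ M j i) → ∀ a b x →
    0ℚ ≤ form M b → 0ℚ < b · (M ⊛ a) → (∀ z → z · (M ⊛ a) ≡ 0ℚ → form M z ≤ 0ℚ) →
    form M x * form M b ≤ (b · (M ⊛ x)) * (b · (M ⊛ x))
  reverse-cauchy-schwarz M M-sym a b x 0≤bb 0<ba perp =
    ≤-by {c = slack} (0≤+ (0≤sq (bx + t * bb)) (0≤* 0≤bb (neg-antimono-≤ zz≤0))) (lemma xx bb bx t)
    where
    xx = form M x
    bb = form M b
    bx = b · (M ⊛ x)
    c = proj₁ (recip 0<ba)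
    t = - (x · (M ⊛ a)) * c
    z = λ i → x i + t * b i
    z⊥a : z · (M ⊛ a) ≡ 0ℚ
    z⊥a = begin
      sum (λ i → (x i + t * b i) * (M ⊛ a) i)              ≡⟨ sum-cong-≗ (λ i → lemma₁ (x i) t (b i) ((M ⊛ a) i)) ⟩
      sum (λ i → x i * (M ⊛ a) i + t * (b i * (M ⊛ a) i))  ≡⟨ sum-linear (λ i → x i * (M ⊛ a) i) (λ i → b i * (M ⊛ a) i) t ⟩
      x · (M ⊛ a) + t * (b · (M ⊛ a))                      ≡⟨ lemma₂ (x · (M ⊛ a)) c (b · (M ⊛ a)) ⟩
      x · (M ⊛ a) * (1ℚ - b · (M ⊛ a) * c)                 ≡⟨ cong (λ y → x · (M ⊛ a) * (1ℚ - y)) (proj₂ (proj₂ (recip 0<ba))) ⟩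
      x · (M ⊛ a) * (1ℚ - 1ℚ)                              ≡⟨ *-zeroʳ (x · (M ⊛ a)) ⟩
      0ℚ                                                   ∎
      where
      open ≡-Reasoning
      lemma₁ : ∀ x t b m → (x + t * b) * m ≡ x * m + t * (b * m)
      lemma₁ = solve-∀ ring
      lemma₂ : ∀ s c p → s + (- s * c) * p ≡ s * (1ℚ - p * c)
      lemma₂ = solve-∀ ring
    zz≤0 : xx + (2ℚ * t) * bx + (t * t) * bb ≤ 0ℚ
    zz≤0 = subst (_≤ 0ℚ) (form-linear M M-sym x b t) (perp z z⊥a)
    slack : ℚ
    slack = (bx + t * bb) * (bx + t * bb) + bb * - (xx + (2ℚ * t) * bx + (t * t) * bb)
    lemma : ∀ x b y t → x * b + ((y + t * b) * (y + t * b) + b * - (x + ((1ℚ + 1ℚ) * t) * y + (t * t) * b)) ≡ y * y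
    lemma = solve-∀ ring

  common-scale : ∀ {n} (d w : Fin n → ℚ) → (∀ i → 0ℚ ≤ d i) → (∀ i → ∃ λ δ → 0ℚ < δ × δ * d i ≤ w i) →
                 ∃ λ δ → 0ℚ < δ × (∀ i → δ * d i ≤ w i)
  common-scale {zero}  d w 0≤d local = 1ℚ , 0<1 , λ ()
  common-scale {suc n} d w 0≤d local
    with local zero | common-scale (λ i → d (suc i)) (λ i → w (suc i)) (λ i → 0≤d (suc i)) (λ i → local (suc i))
  ... | δ₀ , 0<δ₀ , δ₀d≤w | δ₁ , 0<δ₁ , δ₁d≤w with ≤-total δ₀ δ₁
  ... | inj₁ δ₀≤δ₁ = δ₀ , 0<δ₀ , λ where
    zero    → δ₀d≤w
    (suc i) → ≤-trans (*-monoʳ-≤-nonNeg (d (suc i)) {{nonNegative (0≤d (suc i))}} δ₀≤δ₁) (δ₁d≤w i)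
  ... | inj₂ δ₁≤δ₀ = δ₁ , 0<δ₁ , λ where
    zero    → ≤-trans (*-monoʳ-≤-nonNeg (d zero) {{nonNegative (0≤d zero)}} δ₁≤δ₀) δ₀d≤w
    (suc i) → δ₁d≤w i

  infixl 6 _∖_

  _∖_ : ∀ {N} → Subset N → Fin N → Subset N
  A ∖ i = A [ i ]≔ outside

  module _ {N : ℕ} where

    Weight : Set
    Weight = Subset N → ℚ

    Direction : Set
    Direction = Fin (suc N) → ℚ

    [_∈_] : Fin (suc N) → Subset N → ℚ
    [ zero  ∈ A ] = 1ℚ
    [ suc i ∈ A ] = ⟦ lookup A i ⟧

    del : Fin (suc N) → Subset N → Subset N
    del zero    A = A
    del (suc i) A = A ∖ i

    -- A weight g encodes the polynomial Σ g(A)/|A|! · w^|A| x^(E∖A) in w = x₀ and x₁, …, x_N.  Since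
    -- ∂/∂w keeps A and ∂/∂xᵢ deletes i from A, its derivative along a₁, …, a_N is Ds (a₁ ∷ … ∷ a_N ∷ []) g ⊤.
    ∂ : Fin (suc N) → Weight → Weight
    ∂ i g A = [ i ∈ A ] * g (del i A)

    D : Direction → Weight → Weight
    D a g A = sum λ i → a i * ∂ i g A

    Ds : List Direction → Weight → Weight
    Ds as g = foldr D g as

    ∈-cases : ∀ i A → ([ i ∈ A ] ≡ 1ℚ) ⊎ ([ i ∈ A ] ≡ 0ℚ)
    ∈-cases zero    A = inj₁ refl
    ∈-cases (suc i) A with lookup A i
    ... | true  = inj₁ refl
    ... | false = inj₂ refl

    0≤∈ : ∀ i A → 0ℚ ≤ [ i ∈ A ]
    0≤∈ zero    A = 0≤1
    0≤∈ (suc i) A = 0≤⟦⟧ (lookup A i)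

    ∂-cong : ∀ i {g h : Weight} → (∀ A → g A ≡ h A) → ∀ A → ∂ i g A ≡ ∂ i h A
    ∂-cong i g≗h A = cong ([ i ∈ A ] *_) (g≗h (del i A))

    D-cong : ∀ a {g h : Weight} → (∀ A → g A ≡ h A) → ∀ A → D a g A ≡ D a h A
    D-cong a g≗h A = sum-cong-≗ λ i → cong (a i *_) (∂-cong i g≗h A)

    ∂-comm : ∀ i j g A → ∂ i (∂ j g) A ≡ ∂ j (∂ i g) A
    ∂-comm zero    j       g A = lemma [ j ∈ A ] (g (del j A))
      where
      lemma : ∀ c x → 1ℚ * (c * x) ≡ c * (1ℚ * x)
      lemma = solve-∀ ring
    ∂-comm (suc i) zero    g A = sym (∂-comm zero (suc i) g A)
    ∂-comm (suc i) (suc j) g A with i ≟ j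
    ... | yes refl = refl
    ... | no i≢j   = begin
      [ suc i ∈ A ] * ([ suc j ∈ A ∖ i ] * g (A ∖ i ∖ j))
        ≡⟨ cong₂ (λ b B → [ suc i ∈ A ] * (⟦ b ⟧ * g B))
                 (lookup∘update′ (λ j≡i → i≢j (sym j≡i)) A outside) ([]≔-commutes A i j i≢j) ⟩
      [ suc i ∈ A ] * ([ suc j ∈ A ] * g (A ∖ j ∖ i))
        ≡⟨ lemma [ suc i ∈ A ] [ suc j ∈ A ] (g (A ∖ j ∖ i)) ⟩
      [ suc j ∈ A ] * ([ suc i ∈ A ] * g (A ∖ j ∖ i))
        ≡⟨ cong (λ b → [ suc j ∈ A ] * (⟦ b ⟧ * g (A ∖ j ∖ i)))
                (lookup∘update′ i≢j A outside) ⟨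
      [ suc j ∈ A ] * ([ suc i ∈ A ∖ j ] * g (A ∖ j ∖ i)) ∎
      where
      open ≡-Reasoning
      lemma : ∀ a b c → a * (b * c) ≡ b * (a * c)
      lemma = solve-∀ ring

    hessian : Weight → Subset N → Fin (suc N) → Fin (suc N) → ℚ
    hessian g A i j = ∂ i (∂ j g) A

    hessian-⊛ : ∀ g A x i → (hessian g A ⊛ x) i ≡ ∂ i (D x g) A
    hessian-⊛ g A x i = begin
      sum (λ j → [ i ∈ A ] * ∂ j g (del i A) * x j)    ≡⟨ sum-cong-≗ (λ j → lemma [ i ∈ A ] (∂ j g (del i A)) (x j)) ⟩
      sum (λ j → [ i ∈ A ] * (x j * ∂ j g (del i A)))  ≡⟨ *-distribˡ-sum [ i ∈ A ] (λ j → x j * ∂ j g (del i A)) ⟨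
      [ i ∈ A ] * D x g (del i A)                      ∎
      where
      open ≡-Reasoning
      lemma : ∀ c d x → c * d * x ≡ c * (x * d)
      lemma = solve-∀ ring

    hessian-form : ∀ g A x y → x · (hessian g A ⊛ y) ≡ D x (D y g) A
    hessian-form g A x y = sum-cong-≗ λ i → cong (x i *_) (hessian-⊛ g A y i)

    D-comm : ∀ x y g A → D x (D y g) A ≡ D y (D x g) A
    D-comm x y g A = trans (sym (hessian-form g A x y))
      (trans (⊛-symmetric (hessian g A) (λ i j → ∂-comm i j g A) x y) (hessian-form g A y x))

    -- The summand of w is positive by itself, even for empty A, because ∂/∂w keeps A.
    D-pos : ∀ a g → (∀ i → 0ℚ < a i) → (∀ A → 0ℚ < g A) → ∀ A → 0ℚ < D a g A
    D-pos a g 0<a 0<g A = +-mono-<-≤ (0<* (0<a zero) (0<* 0<1 (0<g A)))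
      (sum-nonneg _ λ i → 0≤* (<⇒≤ (0<a (suc i))) (0≤* (0≤∈ (suc i) A) (<⇒≤ (0<g (A ∖ i)))))

    Ds-pos : ∀ {as g} → All (λ a → ∀ i → 0ℚ < a i) as → (∀ A → 0ℚ < g A) → ∀ A → 0ℚ < Ds as g A
    Ds-pos []         0<g = 0<g
    Ds-pos (0<a ∷ 0<as) 0<g = D-pos _ _ 0<a (Ds-pos 0<as 0<g)

    -- The Lorentzian signature of `hessian g A`, stated without eigenvalues: b is positive while x
    -- is arbitrary.
    Hyperbolic : Weight → Subset N → Set
    Hyperbolic g A = ∀ x b → (∀ i → 0ℚ < b i) →
      D x (D x g) A * D b (D b g) A ≤ D x (D b g) A * D x (D b g) A

    -- The reference direction a need only pair positively with all positive b. The inductive step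
    -- takes the direction being differentiated, the base case takes ∂/∂w, which is not positive.
    hyperbolic : ∀ g A a → (∀ b → (∀ i → 0ℚ < b i) → 0ℚ ≤ D b (D b g) A) → (∀ b → (∀ i → 0ℚ < b i) → 0ℚ < D b (D a g) A) →
      (∀ z → D z (D a g) A ≡ 0ℚ → D z (D z g) A ≤ 0ℚ) → Hyperbolic g A
    hyperbolic g A a 0≤bb 0<ba perp x b 0<b = subst₂ _≤_
      (cong₂ _*_ (hessian-form g A x x) (hessian-form g A b b))
      (cong₂ _*_ bx bx)
      (reverse-cauchy-schwarz (hessian g A) (λ i j → ∂-comm i j g A) a b x
        (subst (0ℚ ≤_) (sym (hessian-form g A b b)) (0≤bb b 0<b))
        (subst (0ℚ <_) (sym (hessian-form g A b a)) (0<ba b 0<b))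
        (λ z z⊥a → subst (_≤ 0ℚ) (sym (hessian-form g A z z)) (perp z (trans (sym (hessian-form g A z a)) z⊥a))))
      where
      bx : b · (hessian g A ⊛ x) ≡ D x (D b g) A
      bx = trans (hessian-form g A b x) (D-comm b x g A)

    module Step (g : Weight) (0<g : ∀ A → 0ℚ < g A) (a : Direction) (0<a : ∀ i → 0ℚ < a i) (A : Subset N)
      (local : ∀ i → [ i ∈ A ] ≡ 1ℚ → Hyperbolic g (del i A)) where

      M : Fin (suc N) → Fin (suc N) → ℚ
      M = hessian (D a g) A

      -- Rescaling both sides by `a` turns the direction `a` into the constant function 1, so
      -- orthogonality to `a` becomes mean zero with respect to the degrees.
      W : Fin (suc N) → Fin (suc N) → ℚ
      W i j = a i * a j * M i j

      0<Dg : ∀ B → 0ℚ < D a g B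
      0<Dg = D-pos a g 0<a 0<g

      W-sym : ∀ i j → W i j ≡ W j i
      W-sym i j = cong₂ _*_ (*-comm (a i) (a j)) (∂-comm i j (D a g) A)

      0≤W : ∀ i j → 0ℚ ≤ W i j
      0≤W i j = 0≤* (0≤* (<⇒≤ (0<a i)) (<⇒≤ (0<a j)))
        (0≤* (0≤∈ i A) (0≤* (0≤∈ j (del i A)) (<⇒≤ (0<Dg (del j (del i A))))))

      open Markov W W-sym 0≤W

      scale : Direction → Direction
      scale f i = a i * f i

      W⊛ : ∀ f i → (W ⊛ f) i ≡ a i * ∂ i (D (scale f) (D a g)) A
      W⊛ f i = begin
        sum (λ j → a i * a j * M i j * f j)     ≡⟨ sum-cong-≗ (λ j → lemma (a i) (a j) (M i j) (f j)) ⟩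
        sum (λ j → a i * (M i j * (a j * f j))) ≡⟨ *-distribˡ-sum (a i) (λ j → M i j * (a j * f j)) ⟨
        a i * (M ⊛ scale f) i                   ≡⟨ cong (a i *_) (hessian-⊛ (D a g) A (scale f) i) ⟩
        a i * ∂ i (D (scale f) (D a g)) A       ∎
        where
        open ≡-Reasoning
        lemma : ∀ a b m f → a * b * m * f ≡ a * (m * (b * f))
        lemma = solve-∀ ring

      form-W : ∀ f → form W f ≡ D (scale f) (D (scale f) (D a g)) A
      form-W f = sum-cong-≗ λ i → trans (cong (f i *_) (W⊛ f i)) (lemma (f i) (a i) (∂ i (D (scale f) (D a g)) A))
        where
        lemma : ∀ f a x → f * (a * x) ≡ a * f * x
        lemma = solve-∀ ring

      d≡ : ∀ i → d i ≡ a i * ∂ i (D a (D a g)) A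
      d≡ i = begin
        sum (λ j → a i * a j * M i j)     ≡⟨ sum-cong-≗ (λ j → lemma (a i) (a j) (M i j)) ⟩
        sum (λ j → a i * (M i j * a j))   ≡⟨ *-distribˡ-sum (a i) (λ j → M i j * a j) ⟨
        a i * (M ⊛ a) i                   ≡⟨ cong (a i *_) (hessian-⊛ (D a g) A a i) ⟩
        a i * ∂ i (D a (D a g)) A         ∎
        where
        open ≡-Reasoning
        lemma : ∀ a b m → a * b * m ≡ a * (m * b)
        lemma = solve-∀ ring

      0<∂ : ∀ i {h} → [ i ∈ A ] ≡ 1ℚ → (∀ B → 0ℚ < h B) → 0ℚ < ∂ i h A
      0<∂ i i∈A 0<h = 0<* (subst (0ℚ <_) (sym i∈A) 0<1) (0<h (del i A))

      ∂≡0 : ∀ i h → [ i ∈ A ] ≡ 0ℚ → ∂ i h A ≡ 0ℚ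
      ∂≡0 i h i∉A = trans (cong (_* h (del i A)) i∉A) (*-zeroˡ (h (del i A)))

      0<d : ∀ i → [ i ∈ A ] ≡ 1ℚ → 0ℚ < d i
      0<d i i∈A = subst (0ℚ <_) (sym (d≡ i)) (0<* (0<a i) (0<∂ i i∈A (D-pos a (D a g) 0<a 0<Dg)))

      d≡0 : ∀ i → [ i ∈ A ] ≡ 0ℚ → d i ≡ 0ℚ
      d≡0 i i∉A = trans (d≡ i) (trans (cong (a i *_) (∂≡0 i (D a (D a g)) i∉A)) (*-zeroʳ (a i)))

      W≡0 : ∀ i j → [ i ∈ A ] ≡ 0ℚ → W i j ≡ 0ℚ
      W≡0 i j i∉A = trans (cong (a i * a j *_) (∂≡0 i (∂ j (D a g)) i∉A)) (*-zeroʳ (a i * a j))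

      -- The rows of W outside A vanish.  On the others the hyperbolic form Qᵢ = ∂ᵢ g gives the i-th term of
      -- Q(z, z) = Σ aᵢ Qᵢ(z, z) ≤ Σ aᵢ Qᵢ(z, a)² / Qᵢ(a, a), which is the Bochner inequality for W.
      pseudo-inverse : ∀ i → ∃ λ e → (∀ j → e * d i * W i j ≡ W i j) × (e * d i * e ≡ e) ×
        (∀ f → a i * ∂ i (D (scale f) (D (scale f) g)) A ≤ e * ((W ⊛ f) i * (W ⊛ f) i))
      pseudo-inverse i with ∈-cases i A
      ... | inj₂ i∉A = 0ℚ
        , (λ j → trans (cong (0ℚ * d i *_) (W≡0 i j i∉A)) (trans (*-zeroʳ (0ℚ * d i)) (sym (W≡0 i j i∉A))))
        , *-zeroʳ (0ℚ * d i)
        , λ f → ≤-reflexive (trans (cong (a i *_) (∂≡0 i (D (scale f) (D (scale f) g)) i∉A))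
                  (trans (*-zeroʳ (a i)) (sym (*-zeroˡ ((W ⊛ f) i * (W ⊛ f) i)))))
      ... | inj₁ i∈A = e
        , (λ j → trans (cong (_* W i j) ed≡1) (*-identityˡ (W i j)))
        , trans (cong (_* e) ed≡1) (*-identityˡ e)
        , bochner
        where
        e = proj₁ (recip (0<d i i∈A))
        0<e = proj₁ (proj₂ (recip (0<d i i∈A)))
        ed≡1 : e * d i ≡ 1ℚ
        ed≡1 = trans (*-comm e (d i)) (proj₂ (proj₂ (recip (0<d i i∈A))))
        Z = D a (D a g) (del i A)
        eaZ≡1 : e * (a i * Z) ≡ 1ℚ
        eaZ≡1 = trans (cong (λ c → e * (a i * c)) (sym (trans (cong (_* Z) i∈A) (*-identityˡ Z))))
                      (trans (cong (e *_) (sym (d≡ i))) ed≡1)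
        bochner : ∀ f → a i * ∂ i (D (scale f) (D (scale f) g)) A ≤ e * ((W ⊛ f) i * (W ⊛ f) i)
        bochner f = ≤-by {c = e * (a i * a i) * (Y * Y - X * Z)}
          (0≤* (0≤* (<⇒≤ 0<e) (0≤sq (a i))) (0≤- (local i i∈A (scale f) a 0<a)))
          (begin
            a i * ([ i ∈ A ] * X) + e * (a i * a i) * (Y * Y - X * Z)
              ≡⟨ cong (λ c → a i * (c * X) + e * (a i * a i) * (Y * Y - X * Z)) i∈A ⟩
            a i * (1ℚ * X) + e * (a i * a i) * (Y * Y - X * Z)
              ≡⟨ lemma (a i) X Y Z e ⟩
            e * ((a i * (1ℚ * Y)) * (a i * (1ℚ * Y))) + a i * X * (1ℚ - e * (a i * Z))
              ≡⟨ cong₂ (λ c z → e * ((a i * (c * Y)) * (a i * (c * Y))) + a i * X * (1ℚ - z)) (sym i∈A) eaZ≡1 ⟩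
            e * ((a i * ([ i ∈ A ] * Y)) * (a i * ([ i ∈ A ] * Y))) + a i * X * (1ℚ - 1ℚ)
              ≡⟨ trans (cong (e * ((a i * ([ i ∈ A ] * Y)) * (a i * ([ i ∈ A ] * Y))) +_) (*-zeroʳ (a i * X)))
                       (+-identityʳ (e * ((a i * ([ i ∈ A ] * Y)) * (a i * ([ i ∈ A ] * Y))))) ⟩
            e * ((a i * ([ i ∈ A ] * Y)) * (a i * ([ i ∈ A ] * Y)))
              ≡⟨ cong (λ w → e * (w * w)) (W⊛ f i) ⟨
            e * ((W ⊛ f) i * (W ⊛ f) i) ∎)
          where
          open ≡-Reasoning
          X = D (scale f) (D (scale f) g) (del i A)
          Y = D (scale f) (D a g) (del i A)
          lemma : ∀ a X Y Z e → a * (1ℚ * X) + e * (a * a) * (Y * Y - X * Z)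
                              ≡ e * ((a * (1ℚ * Y)) * (a * (1ℚ * Y))) + a * X * (1ℚ - e * (a * Z))
          lemma = solve-∀ ring

      -- Row `zero` belongs to w and is positive at each i in A, so the ratio to the degree serves
      -- there; outside A the degree is 0. The least of these finitely many ratios is the δ from
      -- which the gap comes.
      star-scale : ∃ λ δ → 0ℚ < δ × (∀ i → δ * (2ℚ * d i) ≤ W zero i)
      star-scale = common-scale (λ i → 2ℚ * d i) (W zero) (λ i → 0≤* (0≤+ 0≤1 0≤1) (0≤d i)) local-scale
        where
        local-scale : ∀ i → ∃ λ δ → 0ℚ < δ × δ * (2ℚ * d i) ≤ W zero i
        local-scale i with ∈-cases i A
        ... | inj₂ i∉A = 1ℚ , 0<1 , subst (_≤ W zero i) (sym (cong (λ z → 1ℚ * (2ℚ * z)) (d≡0 i i∉A))) (0≤W zero i)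
        ... | inj₁ i∈A =
          let c , 0<c , xc≡1 = recip (0<* (positive⁻¹ 2ℚ) (0<d i i∈A))
          in c * W zero i
           , 0<* 0<c (0<* (0<* (0<a zero) (0<a i)) (0<* 0<1 (0<∂ i i∈A 0<Dg)))
           , ≤-reflexive (trans (lemma c (W zero i) (2ℚ * d i)) (trans (cong (_* W zero i) xc≡1) (*-identityˡ (W zero i))))
          where
          lemma : ∀ c w x → c * w * x ≡ x * c * w
          lemma = solve-∀ ring

      perp : ∀ z → D z (D a (D a g)) A ≡ 0ℚ → D z (D z (D a g)) A ≤ 0ℚ
      perp z z⊥a = subst (_≤ 0ℚ) (trans (form-W f) scale-f)
        (form≤0 δ 0<δ star e (λ i → proj₁ (proj₂ (pseudo-inverse i))) (λ i → proj₁ (proj₂ (proj₂ (pseudo-inverse i)))) bochner f mean≡0)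
        where
        δ = proj₁ star-scale
        0<δ = proj₁ (proj₂ star-scale)
        star : ∀ i → 2ℚ * δ * d i ≤ W zero i
        star i = subst (_≤ W zero i) (lemma δ 2ℚ (d i)) (proj₂ (proj₂ star-scale) i)
          where
          lemma : ∀ δ t d → δ * (t * d) ≡ t * δ * d
          lemma = solve-∀ ring
        e : Fin (suc N) → ℚ
        e i = proj₁ (pseudo-inverse i)
        bochner : ∀ f → form W f ≤ sum (λ i → e i * ((W ⊛ f) i * (W ⊛ f) i))
        -- Moving `D a` to the outside exhibits the form as Σ aᵢ ∂ᵢ(...), ready for the termwise
        -- bound.
        bochner f = ≤-trans (≤-reflexive (begin
          form W f                                     ≡⟨ form-W f ⟩
          D (scale f) (D (scale f) (D a g)) A          ≡⟨ D-cong (scale f) (D-comm (scale f) a g) A ⟩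
          D (scale f) (D a (D (scale f) g)) A          ≡⟨ D-comm (scale f) a (D (scale f) g) A ⟩
          D a (D (scale f) (D (scale f) g)) A          ∎))
          (sum-mono _ _ λ i → proj₂ (proj₂ (proj₂ (pseudo-inverse i))) f)
          where open ≡-Reasoning
        -- f = z/a, so that `scale f` is z again.
        f : Direction
        f i = z i * proj₁ (recip (0<a i))
        scale-f≗z : ∀ i → scale f i ≡ z i
        scale-f≗z i = trans (lemma (a i) (z i) (proj₁ (recip (0<a i))))
          (trans (cong (z i *_) (proj₂ (proj₂ (recip (0<a i))))) (*-identityʳ (z i)))
          where
          lemma : ∀ a z c → a * (z * c) ≡ z * (a * c)
          lemma = solve-∀ ring
        D-scale-f : ∀ h B → D (scale f) h B ≡ D z h B
        D-scale-f h B = sum-cong-≗ λ i → cong (_* ∂ i h B) (scale-f≗z i)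
        scale-f : D (scale f) (D (scale f) (D a g)) A ≡ D z (D z (D a g)) A
        scale-f = trans (D-scale-f (D (scale f) (D a g)) A) (D-cong z (D-scale-f (D a g)) A)
        mean≡0 : sum (λ i → d i * f i) ≡ 0ℚ
        mean≡0 = begin
          sum (λ i → d i * f i)                            ≡⟨ sum-cong-≗ (λ i → trans (cong (_* f i) (d≡ i)) (lemma (a i) (∂ i (D a (D a g)) A) (f i))) ⟩
          D (scale f) (D a (D a g)) A                      ≡⟨ D-scale-f (D a (D a g)) A ⟩
          D z (D a (D a g)) A                              ≡⟨ z⊥a ⟩
          0ℚ                                               ∎
          where
          open ≡-Reasoning
          lemma : ∀ a x f → a * x * f ≡ a * f * x
          lemma = solve-∀ ring

      step : Hyperbolic (D a g) A
      step = hyperbolic (D a g) A a (λ b 0<b → <⇒≤ (D-pos b (D b (D a g)) 0<b (D-pos b (D a g) 0<b 0<Dg) A))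
        (λ b 0<b → D-pos b (D a (D a g)) 0<b (D-pos a (D a g) 0<a 0<Dg) A) perp

    ∣A∣≤1+∣del∣ : ∀ i (A : Subset N) → ∣ A ∣ ℕ.≤ suc ∣ del i A ∣
    ∣A∣≤1+∣del∣ zero    A = ℕ.n≤1+n ∣ A ∣
    ∣A∣≤1+∣del∣ (suc i) A = go A i
      where
      go : ∀ {n} (A : Subset n) i → ∣ A ∣ ℕ.≤ suc ∣ A ∖ i ∣
      go (true  ∷ A) zero    = ℕ.≤-refl
      go (false ∷ A) zero    = ℕ.n≤1+n ∣ A ∣
      go (true  ∷ A) (suc i) = ℕ.s≤s (go A i)
      go (false ∷ A) (suc i) = go A i

    -- Induction on the list: `step` asks for hyperbolicity of the shorter list at each `del i A`,
    -- and a deletion lowers |A| by at most 1, so the size condition persists. At the empty list the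
    -- remaining |A| - 2 derivatives are all along w.
    Ds-hyperbolic : ∀ g → (∀ A → 0ℚ < g A) → (∀ A → 2 ℕ.≤ ∣ A ∣ → Hyperbolic g A) →
      ∀ as → All (λ a → ∀ i → 0ℚ < a i) as → ∀ A → 2 ℕ.+ length as ℕ.≤ ∣ A ∣ → Hyperbolic (Ds as g) A
    Ds-hyperbolic g 0<g base []       []           A as≤A = base A as≤A
    Ds-hyperbolic g 0<g base (a ∷ as) (0<a ∷ 0<as) A as≤A =
      Step.step (Ds as g) (Ds-pos 0<as 0<g) a 0<a A λ i _ →
        Ds-hyperbolic g 0<g base as 0<as (del i A) (ℕ.≤-pred (ℕ.≤-trans as≤A (∣A∣≤1+∣del∣ i A)))

-- Class sums, nullity functions and parallel elements

module NullityFunctions where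
  import Data.Bool.Properties as Bool
  open import Data.Fin.Properties using (_≟_)
  open import Data.Fin.Subset using (Subset; ∣_∣)
  open import Data.Rational.Base hiding (∣_∣)
  open import Data.Rational.Properties hiding (_≟_)
  open import Data.Vec.Properties using ([]≔-commutes)
  open import Function.Bundles using (_⇔_; mk⇔)
  open import Relation.Nullary.Decidable using (does-⇔; dec-true; _×-dec_; _⊎-dec_)
  open Rationals
  open Hyperbolicity

  sum-zero : ∀ {n} (f : Fin n → ℚ) → (∀ i → f i ≡ 0ℚ) → sum f ≡ 0ℚ
  sum-zero {n} f f≡0 = trans (sum-cong-≗ f≡0) (sum-replicate-zero n)

  sum-pick : ∀ {n} (f : Fin n → ℚ) i → sum (λ r → ⟦ does (i ≟ r) ⟧ * f r) ≡ f i
  sum-pick f zero    = trans (cong₂ _+_ (*-identityˡ (f zero)) (sum-zero _ λ r → *-zeroˡ (f (suc r)))) (+-identityʳ (f zero))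
  sum-pick f (suc i) = trans (cong₂ _+_ (*-zeroˡ (f zero)) (sum-pick (λ r → f (suc r)) i)) (+-identityˡ (f (suc i)))

  -- `c` is the indicator of a set containing the support of `f`, so the constant is the size of
  -- that set and not n. Expand Σ (C f - F c)² ≥ 0 and cancel one factor C.
  cauchy-schwarz : ∀ {n} (c f : Fin n → ℚ) → (∀ i → c i * c i ≡ c i) → (∀ i → c i * f i ≡ f i) → 0ℚ < sum c →
                   sum f * sum f ≤ sum c * (f · f)
  cauchy-schwarz c f c-idem c-supp 0<C = ≤-by {c = C * (f · f) - F * F} (*-cancelˡ 0<C (begin
    C * 0ℚ                                                         ≡⟨ *-zeroʳ C ⟩
    0ℚ                                                             ≤⟨ sum-nonneg _ (λ i → 0≤sq (C * f i - F * c i)) ⟩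
    sum (λ i → (C * f i - F * c i) * (C * f i - F * c i))          ≡⟨ sum-cong-≗ term ⟩
    sum (λ i → (C * C) * (f i * f i) + (- (2ℚ * C * F)) * f i + (F * F) * c i)
      ≡⟨ sum-quadratic (λ i → (C * C) * (f i * f i)) f c (- (2ℚ * C * F)) (F * F) ⟩
    sum (λ i → (C * C) * (f i * f i)) + (- (2ℚ * C * F)) * F + (F * F) * C
      ≡⟨ cong (λ z → z + (- (2ℚ * C * F)) * F + (F * F) * C) (*-distribˡ-sum (C * C) (λ i → f i * f i)) ⟨
    (C * C) * (f · f) + (- (2ℚ * C * F)) * F + (F * F) * C         ≡⟨ lemma₂ C F (f · f) ⟩
    C * (C * (f · f) - F * F)                                      ∎))
    (lemma₃ (F * F) (C * (f · f)))
    where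
    open ≤-Reasoning
    C = sum c
    F = sum f
    lemma₁ : ∀ C F c f → (C * f - F * c) * (C * f - F * c) ≡ (C * C) * (f * f) + (- ((1ℚ + 1ℚ) * C * F)) * (c * f) + (F * F) * (c * c)
    lemma₁ = solve-∀ ring
    term : ∀ i → (C * f i - F * c i) * (C * f i - F * c i) ≡ (C * C) * (f i * f i) + (- (2ℚ * C * F)) * f i + (F * F) * c i
    term i = trans (lemma₁ C F (c i) (f i))
      (cong₂ (λ x y → (C * C) * (f i * f i) + (- (2ℚ * C * F)) * x + (F * F) * y) (c-supp i) (c-idem i))
    lemma₂ : ∀ C F s → (C * C) * s + (- ((1ℚ + 1ℚ) * C * F)) * F + (F * F) * C ≡ C * (C * s - F * F)
    lemma₂ = solve-∀ ring
    lemma₃ : ∀ x y → x + (y - x) ≡ y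
    lemma₃ = solve-∀ ring

  -- The search stops at i, which is returned untested. It is the least index satisfying `p` as soon
  -- as `p i` is known, and by `first-cong` it then does not depend on i.
  first : ∀ {n} → (Fin n → Bool) → Fin n → Fin n
  first p zero    = zero
  first p (suc i) with p zero
  ... | true  = zero
  ... | false = suc (first (λ j → p (suc j)) i)

  first-true : ∀ {n} (p : Fin n → Bool) i → p i ≡ true → p (first p i) ≡ true
  first-true p zero    pi = pi
  first-true p (suc i) pi with p zero in p₀
  ... | true  = p₀
  ... | false = first-true (λ j → p (suc j)) i pi

  first-cong : ∀ {n} (p p′ : Fin n → Bool) → (∀ j → p j ≡ p′ j) → ∀ i k → p i ≡ true → p′ k ≡ true →
               first p i ≡ first p′ k
  first-cong p p′ p≗p′ zero    zero    pi pk = refl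
  first-cong p p′ p≗p′ zero    (suc k) pi pk with p′ zero in p₀
  ... | true  = refl
  ... | false = contradiction (trans (sym pi) (trans (p≗p′ zero) p₀)) λ ()
  first-cong p p′ p≗p′ (suc i) zero    pi pk with p zero in p₀
  ... | true  = refl
  ... | false = contradiction (trans (sym pk) (trans (sym (p≗p′ zero)) p₀)) λ ()
  first-cong p p′ p≗p′ (suc i) (suc k) pi pk with p zero in p₀ | p′ zero in p₀′
  ... | true  | true  = refl
  ... | false | false = cong suc (first-cong _ _ (λ j → p≗p′ (suc j)) i k pi pk)
  ... | true  | false = contradiction (trans (sym p₀) (trans (p≗p′ zero) p₀′)) λ ()
  ... | false | true  = contradiction (trans (sym p₀) (trans (p≗p′ zero) p₀′)) λ ()

  witness : ∀ {P : Set} (P? : Dec P) → does P? ≡ true → P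
  witness (yes p) _ = p

  -- Σ_{i ~ j} yᵢ yⱼ is the sum of the squares of the class sums, indexed by least representatives.
  module Classes {n : ℕ} (_~_ : Fin n → Fin n → Set) (_~?_ : ∀ i j → Dec (i ~ j))
    (~-refl : ∀ i → i ~ i) (~-sym : ∀ {i j} → i ~ j → j ~ i) (~-trans : ∀ {i j k} → i ~ j → j ~ k → i ~ k) where

    rep : Fin n → Fin n
    rep i = first (λ j → does (i ~? j)) i

    ~rep : ∀ i → i ~ rep i
    ~rep i = witness (i ~? rep i) (first-true (λ j → does (i ~? j)) i (dec-true (i ~? i) (~-refl i)))

    rep-cong : ∀ {i j} → i ~ j → rep j ≡ rep i
    rep-cong {i} {j} i~j = first-cong _ _
      (λ k → does-⇔ (mk⇔ (~-trans i~j) (~-trans (~-sym i~j))) (j ~? k) (i ~? k))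
      j i (dec-true (j ~? j) (~-refl j)) (dec-true (i ~? i) (~-refl i))

    ~⇔rep : ∀ i j → i ~ j ⇔ rep j ≡ rep i
    ~⇔rep i j = mk⇔ rep-cong (λ eq → ~-trans (~rep i) (subst (_~ j) eq (~-sym (~rep j))))

    module _ (y : Fin n → ℚ) where

      class : Fin n → ℚ
      class r = sum λ i → ⟦ does (rep i ≟ r) ⟧ * y i

      sum-class : sum class ≡ sum y
      sum-class = trans (∑-comm (λ r i → ⟦ does (rep i ≟ r) ⟧ * y i)) (sum-cong-≗ λ i → sum-pick (λ _ → y i) (rep i))

      sum-class² : sum (λ i → sum (λ j → ⟦ does (i ~? j) ⟧ * (y i * y j))) ≡ class · class
      sum-class² = begin
        sum (λ i → sum (λ j → ⟦ does (i ~? j) ⟧ * (y i * y j)))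
          ≡⟨ sum-cong-≗ (λ i → sum-cong-≗ λ j →
               trans (cong (λ b → ⟦ b ⟧ * (y i * y j)) (does-⇔ (~⇔rep i j) (i ~? j) (rep j ≟ rep i)))
                     (lemma ⟦ does (rep j ≟ rep i) ⟧ (y i) (y j))) ⟩
        sum (λ i → sum (λ j → y i * (⟦ does (rep j ≟ rep i) ⟧ * y j)))
          ≡⟨ sum-cong-≗ (λ i → *-distribˡ-sum (y i) (λ j → ⟦ does (rep j ≟ rep i) ⟧ * y j)) ⟨
        sum (λ i → y i * class (rep i))
          ≡⟨ sum-cong-≗ (λ i → sum-pick (λ r → y i * class r) (rep i)) ⟨
        sum (λ i → sum (λ r → ⟦ does (rep i ≟ r) ⟧ * (y i * class r)))
          ≡⟨ ∑-comm (λ i r → ⟦ does (rep i ≟ r) ⟧ * (y i * class r)) ⟩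
        sum (λ r → sum (λ i → ⟦ does (rep i ≟ r) ⟧ * (y i * class r)))
          ≡⟨ sum-cong-≗ (λ r → trans (sum-cong-≗ λ i → sym (*-assoc ⟦ does (rep i ≟ r) ⟧ (y i) (class r)))
                                      (sym (*-distribʳ-sum (class r) (λ i → ⟦ does (rep i ≟ r) ⟧ * y i)))) ⟩
        class · class ∎
        where
        open ≡-Reasoning
        lemma : ∀ c a b → c * (a * b) ≡ a * (c * b)
        lemma = solve-∀ ring

      -- Cauchy-Schwarz for the class sums. Classes do not leave the set indicated by `c`, so
      -- representatives of its elements lie in it, and at most `sum c` class sums are nonzero.
      class-bound : (c : Fin n → ℚ) → (∀ i → c i ≡ 1ℚ ⊎ c i ≡ 0ℚ) → (∀ {i j} → i ~ j → c i ≡ 1ℚ → c j ≡ 1ℚ) →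
        (∀ i → c i ≡ 0ℚ → y i ≡ 0ℚ) → 0ℚ < sum c →
        sum y * sum y ≤ sum c * sum (λ i → sum (λ j → ⟦ does (i ~? j) ⟧ * (y i * y j)))
      class-bound c c-cases c-closed y-supp 0<C = subst₂ _≤_
        (cong₂ _*_ sum-class sum-class) (cong (sum c *_) (sym sum-class²))
        (cauchy-schwarz c class c-idem c-supp 0<C)
        where
        c-idem : ∀ i → c i * c i ≡ c i
        c-idem i with c-cases i
        ... | inj₁ eq rewrite eq = refl
        ... | inj₂ eq rewrite eq = refl
        c-supp : ∀ r → c r * class r ≡ class r
        c-supp r with c-cases r
        ... | inj₁ eq = trans (cong (_* class r) eq) (*-identityˡ (class r))
        ... | inj₂ eq = trans (cong (_* class r) eq) (trans (*-zeroˡ (class r)) (sym (sum-zero _ vanish)))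
          where
          vanish : ∀ i → ⟦ does (rep i ≟ r) ⟧ * y i ≡ 0ℚ
          vanish i with rep i ≟ r
          ... | no _ = *-zeroˡ (y i)
          ... | yes refl with c-cases i
          ... | inj₂ i∉ = trans (*-identityˡ (y i)) (y-supp i i∉)
          ... | inj₁ i∈ = contradiction (trans (sym eq) (c-closed (~rep i) i∈)) λ ()

  sum-∈ : ∀ {N} (A : Subset N) → sum (λ i → ⟦ lookup A i ⟧) ≡ ι ∣ A ∣
  sum-∈ []          = refl
  sum-∈ (true ∷ A)  = cong (λ z → 1ℚ + z) (sum-∈ A)
  sum-∈ (false ∷ A) = trans (cong (λ z → 0ℚ + z) (sum-∈ A)) (+-identityˡ (ι ∣ A ∣))

  ∣A∖i∣ : ∀ {N} (A : Subset N) i → lookup A i ≡ true → ∣ A ∣ ≡ suc ∣ A ∖ i ∣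
  ∣A∖i∣ (true  ∷ A) zero    i∈A = refl
  ∣A∖i∣ (true  ∷ A) (suc i) i∈A = cong suc (∣A∖i∣ A i i∈A)
  ∣A∖i∣ (false ∷ A) (suc i) i∈A = ∣A∖i∣ A i i∈A

  -- Local properties of A ↦ |A| - r(A). They are stated for all i, since deleting an absent element
  -- changes nothing.
  record IsNullity {N : ℕ} (ν : Subset N → ℕ) : Set where
    field
      mono          : ∀ A i → ν (A ∖ i) ℕ.≤ ν A
      unit          : ∀ A i → ν A ℕ.≤ suc (ν (A ∖ i))
      supermodular  : ∀ A {i j} → i ≢ j → ν (A ∖ i) ℕ.+ ν (A ∖ j) ℕ.≤ ν A ℕ.+ ν (A ∖ i ∖ j)

    increment : ∀ A i → ν A ≡ ν (A ∖ i) ⊎ ν A ≡ suc (ν (A ∖ i))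
    increment A i with ℕ.m≤n⇒m<n∨m≡n (mono A i)
    ... | inj₂ eq = inj₁ (sym eq)
    ... | inj₁ lt = inj₂ (ℕ.≤-antisym (unit A i) lt)

  -- The factorial cancels the 1/|A|! of the encoding, so the polynomial has the coefficients
  -- q^ν(A).
  weight : ∀ {N} → (Subset N → ℕ) → ℚ → Subset N → ℚ
  weight ν q A = ι (∣ A ∣ !) * q ^ ν A

  0<^ : ∀ {q} k → 0ℚ < q → 0ℚ < q ^ k
  0<^ zero    0<q = 0<1
  0<^ (suc k) 0<q = 0<* 0<q (0<^ k 0<q)

  0<! : ∀ k → 0ℚ < ι (k !)
  0<! zero    = 0<1
  0<! (suc k) = subst (0ℚ <_) (sym (ι-* (suc k) (k !))) (0<* (ι-pos k) (0<! k))

  weight-pos : ∀ {N} (ν : Subset N → ℕ) {q} → 0ℚ < q → ∀ A → 0ℚ < weight ν q A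
  weight-pos ν 0<q A = 0<* (0<! ∣ A ∣) (0<^ (ν A) 0<q)

  module _ {N : ℕ} {ν : Subset N → ℕ} (isNullity : IsNullity ν) where
    open IsNullity isNullity

    module Parallel (A : Subset N) where

      -- Distinct i, j ∈ A are parallel when they are so in the dual of M|A.
      _∥_ : Fin N → Fin N → Set
      i ∥ j = (lookup A i ≡ true × lookup A j ≡ true) ×
              (ν A ≡ suc (ν (A ∖ i)) × ν A ≡ suc (ν (A ∖ j)) × ν (A ∖ i ∖ j) ≡ ν (A ∖ i))

      _~_ : Fin N → Fin N → Set
      i ~ j = i ≡ j ⊎ i ∥ j

      _∥?_ : ∀ i j → Dec (i ∥ j)
      i ∥? j = (lookup A i Bool.≟ true ×-dec lookup A j Bool.≟ true) ×-dec
               (ν A ℕ.≟ suc (ν (A ∖ i)) ×-dec ν A ℕ.≟ suc (ν (A ∖ j)) ×-dec ν (A ∖ i ∖ j) ℕ.≟ ν (A ∖ i))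

      _~?_ : ∀ i j → Dec (i ~ j)
      i ~? j = (i ≟ j) ⊎-dec (i ∥? j)

      ~-sym : ∀ {i j} → i ~ j → j ~ i
      ~-sym (inj₁ i≡j) = inj₁ (sym i≡j)
      ~-sym {i} {j} i~j@(inj₂ ((i∈A , j∈A) , νi , νj , νij)) with i ≟ j
      ... | yes i≡j = inj₁ (sym i≡j)
      ... | no i≢j  = inj₂ ((j∈A , i∈A) , νj , νi ,
        trans (cong ν (sym ([]≔-commutes A i j i≢j))) (trans νij (ℕ.suc-injective (trans (sym νi) νj))))

      -- Supermodularity at A∖j for i and k: both single deletions preserve ν(A∖j), hence so does
      -- the double one. Deleting all three elements thus costs only 1, and by monotonicity deleting
      -- i and k costs no more.
      ~-trans : ∀ {i j k} → i ~ j → j ~ k → i ~ k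
      ~-trans (inj₁ refl) j~k = j~k
      ~-trans i~j (inj₁ refl) = i~j
      ~-trans {i} {j} {k} i~j@(inj₂ ((i∈A , j∈A) , νi , νj , νij)) j~k@(inj₂ ((_ , k∈A) , _ , νk , νjk))
        with i ≟ k | i ≟ j
      ... | yes i≡k | _        = inj₁ i≡k
      ... | no _    | yes refl = j~k
      ... | no i≢k  | no i≢j   = inj₂ ((i∈A , k∈A) , νi , νk , ℕ.≤-antisym (mono (A ∖ i) k) νi≤νik)
        where
        open ℕ.≤-Reasoning
        νi≡νj : ν (A ∖ i) ≡ ν (A ∖ j)
        νi≡νj = ℕ.suc-injective (trans (sym νi) νj)
        νji : ν (A ∖ j ∖ i) ≡ ν (A ∖ j)
        νji = trans (cong ν (sym ([]≔-commutes A i j i≢j))) (trans νij νi≡νj)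
        swap : A ∖ j ∖ i ∖ k ≡ A ∖ i ∖ k ∖ j
        swap with k ≟ j
        ... | yes refl = cong (_∖ k) (sym ([]≔-commutes A i k i≢k))
        ... | no k≢j   = trans (cong (_∖ k) (sym ([]≔-commutes A i j i≢j))) (sym ([]≔-commutes (A ∖ i) k j k≢j))
        νi≤νik : ν (A ∖ i) ℕ.≤ ν (A ∖ i ∖ k)
        νi≤νik = begin
          ν (A ∖ i)             ≡⟨ νi≡νj ⟩
          ν (A ∖ j)             ≤⟨ ℕ.+-cancelˡ-≤ (ν (A ∖ j)) _ _ (subst (ℕ._≤ ν (A ∖ j) ℕ.+ ν (A ∖ j ∖ i ∖ k))
                                     (cong₂ ℕ._+_ νji νjk) (supermodular (A ∖ j) i≢k)) ⟩
          ν (A ∖ j ∖ i ∖ k)     ≡⟨ cong ν swap ⟩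
          ν (A ∖ i ∖ k ∖ j)     ≤⟨ mono (A ∖ i ∖ k) j ⟩
          ν (A ∖ i ∖ k)         ∎

      -- The excess in supermodularity is 1 at a parallel pair and 0 otherwise. If i lowers ν from A
      -- but not from A∖j, then j must lower ν too, and the pair is parallel; in all other cases the
      -- increments match.
      defect : ∀ i j → i ≢ j → lookup A i ≡ true → lookup A j ≡ true → ¬ (i ∥ j) →
               ν A ℕ.+ ν (A ∖ i ∖ j) ≡ ν (A ∖ i) ℕ.+ ν (A ∖ j)
      defect i j i≢j i∈A j∈A i∦j with increment A i | increment (A ∖ j) i
      ... | inj₁ νi | _ = ℕ.≤-antisym
        (ℕ.+-mono-≤ (ℕ.≤-reflexive νi) (subst (ℕ._≤ ν (A ∖ j)) (cong ν (sym ([]≔-commutes A i j i≢j))) (mono (A ∖ j) i)))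
        (supermodular A i≢j)
      ... | inj₂ νi | inj₂ νji = begin
        ν A ℕ.+ ν (A ∖ i ∖ j)           ≡⟨ cong (ℕ._+ ν (A ∖ i ∖ j)) νi ⟩
        suc (ν (A ∖ i)) ℕ.+ ν (A ∖ i ∖ j) ≡⟨ ℕ.+-suc (ν (A ∖ i)) (ν (A ∖ i ∖ j)) ⟨
        ν (A ∖ i) ℕ.+ suc (ν (A ∖ i ∖ j)) ≡⟨ cong (λ B → ν (A ∖ i) ℕ.+ suc (ν B)) ([]≔-commutes A i j i≢j) ⟩
        ν (A ∖ i) ℕ.+ suc (ν (A ∖ j ∖ i)) ≡⟨ cong (ν (A ∖ i) ℕ.+_) νji ⟨
        ν (A ∖ i) ℕ.+ ν (A ∖ j)         ∎
        where open ≡-Reasoning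
      ... | inj₂ νi | inj₁ νji with increment A j
      ... | inj₂ νj = contradiction ((i∈A , j∈A) , νi , νj ,
        trans (cong ν ([]≔-commutes A i j i≢j)) (trans (sym νji) (ℕ.suc-injective (trans (sym νj) νi)))) i∦j
      ... | inj₁ νj = contradiction (begin
        suc (ν (A ∖ i))   ≡⟨ νi ⟨
        ν A               ≡⟨ νj ⟩
        ν (A ∖ j)         ≡⟨ νji ⟩
        ν (A ∖ j ∖ i)     ≡⟨ cong ν ([]≔-commutes A i j i≢j) ⟨
        ν (A ∖ i ∖ j)     ≤⟨ mono (A ∖ i) j ⟩
        ν (A ∖ i)         ∎) (ℕ.<-irrefl refl)
        where open ℕ.≤-Reasoning

-- The quadratic derivatives of the Potts polynomial

module Potts where
  open import Data.Fin.Properties using (_≟_)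
  open import Data.Fin.Subset using (Subset; outside; ∣_∣)
  open import Data.Rational.Base hiding (∣_∣)
  open import Data.Rational.Properties hiding (_≟_)
  open import Data.Vec.Properties using (lookup∘update′; lookup∘update)
  open Rationals
  open Hyperbolicity
  open NullityFunctions

  module PottsWeight {N : ℕ} {ν : Subset N → ℕ} (isNullity : IsNullity ν) {q : ℚ} (0<q : 0ℚ < q) (q≤1 : q ≤ 1ℚ) where

    g : Subset N → ℚ
    g = weight ν q

    module Base (A : Subset N) (k : ℕ) (∣A∣≡ : ∣ A ∣ ≡ suc (suc k)) (z₀ : ℚ) (x : Fin N → ℚ) where
      open Parallel isNullity A

      F₀ F₁ F₂ m : ℚ
      F₀ = ι (k !)
      F₁ = ι (suc k !)
      F₂ = ι (suc (suc k) !)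
      m  = ι (suc (suc k))

      c y : Fin N → ℚ
      c i = ⟦ lookup A i ⟧
      y i = c i * (x i * q ^ ν (A ∖ i))

      -- 1 - s is 0 on the diagonal (the polynomial is affine in each xᵢ), q at distinct parallel
      -- elements and 1 elsewhere. As q ≤ 1, s is a convex combination of two equivalence relations,
      -- equality and parallelism.
      s P : Fin N → Fin N → ℚ
      s i j = q * ⟦ does (i ≟ j) ⟧ + (1ℚ - q) * ⟦ does (i ~? j) ⟧
      P i j = x i * (c i * (x j * (⟦ lookup (A ∖ i) j ⟧ * g (A ∖ i ∖ j))))

      first-order : ∀ i → x i * (c i * g (A ∖ i)) ≡ F₁ * y i
      first-order i with lookup A i in i∈A
      ... | false = lemma (x i) (g (A ∖ i)) F₁ (x i * q ^ ν (A ∖ i))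
        where
        lemma : ∀ a b c d → a * (0ℚ * b) ≡ c * (0ℚ * d)
        lemma = solve-∀ ring
      ... | true  = trans (cong (λ n → x i * (1ℚ * (ι (n !) * q ^ ν (A ∖ i)))) (ℕ.suc-injective (trans (sym (∣A∖i∣ A i i∈A)) ∣A∣≡)))
                          (lemma (x i) F₁ (q ^ ν (A ∖ i)))
        where
        lemma : ∀ a b c → a * (1ℚ * (b * c)) ≡ b * (1ℚ * (a * c))
        lemma = solve-∀ ring

      -- Multiplying by q^ν(A) compares the mixed coefficient with the product of the first-order
      -- ones; `defect` makes the exponents agree, up to one factor q at a parallel pair.
      second-order : ∀ i j → q ^ ν A * P i j ≡ F₀ * (y i * y j * (1ℚ - s i j))
      second-order i j with i ≟ j
      second-order i j | yes refl = begin
        q ^ ν A * (x i * (c i * (x i * (⟦ lookup (A ∖ i) i ⟧ * g (A ∖ i ∖ i)))))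
          ≡⟨ cong (λ b → q ^ ν A * (x i * (c i * (x i * (⟦ b ⟧ * g (A ∖ i ∖ i)))))) (lookup∘update i A outside) ⟩
        q ^ ν A * (x i * (c i * (x i * (0ℚ * g (A ∖ i ∖ i)))))
          ≡⟨ lemma (q ^ ν A) (x i) (c i) (g (A ∖ i ∖ i)) F₀ (y i) q ⟩
        F₀ * (y i * y i * (1ℚ - (q * 1ℚ + (1ℚ - q) * 1ℚ))) ∎
        where
        open ≡-Reasoning
        lemma : ∀ Q x c g F y q → Q * (x * (c * (x * (0ℚ * g)))) ≡ F * (y * y * (1ℚ - (q * 1ℚ + (1ℚ - q) * 1ℚ)))
        lemma = solve-∀ ring
      second-order i j | no i≢j = trans
        (cong (λ b → q ^ ν A * (x i * (c i * (x j * (⟦ b ⟧ * g (A ∖ i ∖ j))))))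
              (lookup∘update′ (λ j≡i → i≢j (sym j≡i)) A outside))
        distinct
        where
        open ≡-Reasoning
        e = ⟦ does (i ∥? j) ⟧
        Qi = q ^ ν (A ∖ i)
        Qj = q ^ ν (A ∖ j)
        outside₁ : ∀ Q x y g F a b s → Q * (x * (0ℚ * (y * g))) ≡ F * ((0ℚ * a) * b * s)
        outside₁ = solve-∀ ring
        outside₂ : ∀ Q x c y g F a b s → Q * (x * (c * (y * (0ℚ * g)))) ≡ F * (a * (0ℚ * b) * s)
        outside₂ = solve-∀ ring
        pull : ∀ Q x y F R → Q * (x * (1ℚ * (y * (1ℚ * (F * R))))) ≡ F * (x * y * (Q * R))
        pull = solve-∀ ring
        push : ∀ x y F a b s → F * (x * y * (a * b * s)) ≡ F * (1ℚ * (x * a) * (1ℚ * (y * b)) * s)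
        push = solve-∀ ring
        exponents : (d : Dec (i ∥ j)) → lookup A i ≡ true → lookup A j ≡ true →
                    q ^ ν A * q ^ ν (A ∖ i ∖ j) ≡ Qi * Qj * (1ℚ - (q * 0ℚ + (1ℚ - q) * ⟦ does d ⟧))
        exponents (yes (_ , νi , νj , νij)) _ _ = trans (cong₂ (λ a b → q ^ a * q ^ b) νi (trans νij (ℕ.suc-injective (trans (sym νi) νj))))
              (lemma q Qi Qj)
          where
          lemma : ∀ q a b → (q * a) * b ≡ a * b * (1ℚ - (q * 0ℚ + (1ℚ - q) * 1ℚ))
          lemma = solve-∀ ring
        exponents (no i∦j) i∈A j∈A = begin
          q ^ ν A * q ^ ν (A ∖ i ∖ j)          ≡⟨ ^-homo-* q (ν A) (ν (A ∖ i ∖ j)) ⟨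
          q ^ (ν A ℕ.+ ν (A ∖ i ∖ j))          ≡⟨ cong (q ^_) (defect i j i≢j i∈A j∈A i∦j) ⟩
          q ^ (ν (A ∖ i) ℕ.+ ν (A ∖ j))        ≡⟨ ^-homo-* q (ν (A ∖ i)) (ν (A ∖ j)) ⟩
          Qi * Qj                              ≡⟨ lemma q (Qi * Qj) ⟩
          Qi * Qj * (1ℚ - (q * 0ℚ + (1ℚ - q) * 0ℚ)) ∎
          where
          lemma : ∀ q a → a ≡ a * (1ℚ - (q * 0ℚ + (1ℚ - q) * 0ℚ))
          lemma = solve-∀ ring
        size : lookup A i ≡ true → lookup A j ≡ true → ∣ A ∖ i ∖ j ∣ ≡ k
        size i∈A j∈A = ℕ.suc-injective (trans
          (sym (∣A∖i∣ (A ∖ i) j (trans (lookup∘update′ (λ j≡i → i≢j (sym j≡i)) A outside) j∈A)))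
          (ℕ.suc-injective (trans (sym (∣A∖i∣ A i i∈A)) ∣A∣≡)))
        distinct : q ^ ν A * (x i * (⟦ lookup A i ⟧ * (x j * (⟦ lookup A j ⟧ * g (A ∖ i ∖ j)))))
                 ≡ F₀ * (⟦ lookup A i ⟧ * (x i * Qi) * (⟦ lookup A j ⟧ * (x j * Qj)) * (1ℚ - (q * 0ℚ + (1ℚ - q) * e)))
        distinct = split (lookup A i) (lookup A j) refl refl
          where
          split : ∀ bi bj → lookup A i ≡ bi → lookup A j ≡ bj →
            q ^ ν A * (x i * (⟦ bi ⟧ * (x j * (⟦ bj ⟧ * g (A ∖ i ∖ j)))))
            ≡ F₀ * (⟦ bi ⟧ * (x i * Qi) * (⟦ bj ⟧ * (x j * Qj)) * (1ℚ - (q * 0ℚ + (1ℚ - q) * e)))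
          split false bj    _ _ = outside₁ (q ^ ν A) (x i) (x j) (⟦ bj ⟧ * g (A ∖ i ∖ j)) F₀ (x i * Qi) (⟦ bj ⟧ * (x j * Qj))
                                    (1ℚ - (q * 0ℚ + (1ℚ - q) * e))
          split true  false _ _ = outside₂ (q ^ ν A) (x i) 1ℚ (x j) (g (A ∖ i ∖ j)) F₀ (1ℚ * (x i * Qi)) (x j * Qj)
                                    (1ℚ - (q * 0ℚ + (1ℚ - q) * e))
          split true  true  i∈A j∈A = begin
            q ^ ν A * (x i * (1ℚ * (x j * (1ℚ * (ι (∣ A ∖ i ∖ j ∣ !) * q ^ ν (A ∖ i ∖ j))))))
              ≡⟨ cong (λ n → q ^ ν A * (x i * (1ℚ * (x j * (1ℚ * (ι (n !) * q ^ ν (A ∖ i ∖ j))))))) (size i∈A j∈A) ⟩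
            q ^ ν A * (x i * (1ℚ * (x j * (1ℚ * (F₀ * q ^ ν (A ∖ i ∖ j))))))
              ≡⟨ pull (q ^ ν A) (x i) (x j) F₀ (q ^ ν (A ∖ i ∖ j)) ⟩
            F₀ * (x i * x j * (q ^ ν A * q ^ ν (A ∖ i ∖ j)))
              ≡⟨ cong (λ w → F₀ * (x i * x j * w)) (exponents (i ∥? j) i∈A j∈A) ⟩
            F₀ * (x i * x j * (Qi * Qj * (1ℚ - (q * 0ℚ + (1ℚ - q) * e))))
              ≡⟨ push (x i) (x j) F₀ Qi Qj (1ℚ - (q * 0ℚ + (1ℚ - q) * e)) ⟩
            F₀ * (1ℚ * (x i * Qi) * (1ℚ * (x j * Qj)) * (1ℚ - (q * 0ℚ + (1ℚ - q) * e))) ∎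

      Y S R : ℚ
      Y = sum y
      R = sum λ i → sum λ j → ⟦ does (i ~? j) ⟧ * (y i * y j)
      S = q * (y · y) + (1ℚ - q) * R

      c-cases : ∀ i → c i ≡ 1ℚ ⊎ c i ≡ 0ℚ
      c-cases i = ∈-cases (suc i) A

      sum-c : sum c ≡ m
      sum-c = trans (sum-∈ A) (cong ι ∣A∣≡)

      0<sum-c : 0ℚ < sum c
      0<sum-c = subst (0ℚ <_) (sym sum-c) (ι-pos (suc k))

      -- Each of the two equivalence relations contributes a sum of squares over at most m = |A|
      -- classes meeting A, so Cauchy-Schwarz applies to both with the same constant.
      Y²≤mS : Y * Y ≤ m * S
      Y²≤mS = ≤-by {c = q * (m * (y · y) - Y * Y) + (1ℚ - q) * (m * R - Y * Y)}
        (0≤+ (0≤* (<⇒≤ 0<q) (0≤- Y²≤my²)) (0≤* (0≤- q≤1) (0≤- Y²≤mR)))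
        (lemma q m (y · y) R Y)
        where
        lemma : ∀ q m a r Y → Y * Y + (q * (m * a - Y * Y) + (1ℚ - q) * (m * r - Y * Y)) ≡ m * (q * a + (1ℚ - q) * r)
        lemma = solve-∀ ring
        c-idem : ∀ i → c i * c i ≡ c i
        c-idem i with lookup A i
        ... | true  = refl
        ... | false = refl
        y-supp : ∀ i → c i ≡ 0ℚ → y i ≡ 0ℚ
        y-supp i eq = trans (cong (_* (x i * q ^ ν (A ∖ i))) eq) (*-zeroˡ (x i * q ^ ν (A ∖ i)))
        Y²≤my² : Y * Y ≤ m * (y · y)
        Y²≤my² = subst (λ C → Y * Y ≤ C * (y · y)) sum-c (cauchy-schwarz c y c-idem
          (λ i → trans (sym (*-assoc (c i) (c i) (x i * q ^ ν (A ∖ i)))) (cong (_* (x i * q ^ ν (A ∖ i))) (c-idem i))) 0<sum-c)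
        closed : ∀ {i j} → i ~ j → c i ≡ 1ℚ → c j ≡ 1ℚ
        closed (inj₁ refl)               i∈A = i∈A
        closed (inj₂ ((_ , j∈A) , _))    i∈A = cong ⟦_⟧ j∈A
        Y²≤mR : Y * Y ≤ m * R
        Y²≤mR = subst (λ C → Y * Y ≤ C * R) sum-c
          (Classes.class-bound _~_ _~?_ (λ i → inj₁ refl) ~-sym ~-trans y c c-cases closed y-supp 0<sum-c)

      sum-P : q ^ ν A * sum (λ i → sum (P i)) ≡ F₀ * (Y * Y - S)
      sum-P = begin
        q ^ ν A * sum (λ i → sum (P i))
          ≡⟨ trans (*-distribˡ-sum (q ^ ν A) (λ i → sum (P i))) (sum-cong-≗ λ i → *-distribˡ-sum (q ^ ν A) (P i)) ⟩
        sum (λ i → sum (λ j → q ^ ν A * P i j))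
          ≡⟨ sum-cong-≗ (λ i → sum-cong-≗ λ j → trans (second-order i j)
               (lemma F₀ (y i) (y j) q ⟦ does (i ≟ j) ⟧ ⟦ does (i ~? j) ⟧)) ⟩
        sum (λ i → sum (λ j → T₁ i j + (- (F₀ * q)) * T₂ i j + (- (F₀ * (1ℚ - q))) * T₃ i j))
          ≡⟨ sum-cong-≗ (λ i → sum-quadratic (T₁ i) (T₂ i) (T₃ i) (- (F₀ * q)) (- (F₀ * (1ℚ - q)))) ⟩
        sum (λ i → sum (T₁ i) + (- (F₀ * q)) * sum (T₂ i) + (- (F₀ * (1ℚ - q))) * sum (T₃ i))
          ≡⟨ sum-quadratic (λ i → sum (T₁ i)) (λ i → sum (T₂ i)) (λ i → sum (T₃ i)) (- (F₀ * q)) (- (F₀ * (1ℚ - q))) ⟩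
        sum (λ i → sum (T₁ i)) + (- (F₀ * q)) * sum (λ i → sum (T₂ i)) + (- (F₀ * (1ℚ - q))) * R
          ≡⟨ cong₂ (λ a b → a + (- (F₀ * q)) * b + (- (F₀ * (1ℚ - q))) * R) sum-T₁ sum-T₂ ⟩
        F₀ * Y * Y + (- (F₀ * q)) * (y · y) + (- (F₀ * (1ℚ - q))) * R
          ≡⟨ lemma₂ F₀ Y q (y · y) R ⟩
        F₀ * (Y * Y - S) ∎
        where
        open ≡-Reasoning
        T₁ T₂ T₃ : Fin N → Fin N → ℚ
        T₁ i j = F₀ * y i * y j
        T₂ i j = ⟦ does (i ≟ j) ⟧ * (y i * y j)
        T₃ i j = ⟦ does (i ~? j) ⟧ * (y i * y j)
        lemma : ∀ F a b q d e → F * (a * b * (1ℚ - (q * d + (1ℚ - q) * e)))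
              ≡ F * a * b + (- (F * q)) * (d * (a * b)) + (- (F * (1ℚ - q))) * (e * (a * b))
        lemma = solve-∀ ring
        lemma₂ : ∀ F Y q a r → F * Y * Y + (- (F * q)) * a + (- (F * (1ℚ - q))) * r ≡ F * (Y * Y - (q * a + (1ℚ - q) * r))
        lemma₂ = solve-∀ ring
        sum-T₁ : sum (λ i → sum (T₁ i)) ≡ F₀ * Y * Y
        sum-T₁ = begin
          sum (λ i → sum (λ j → F₀ * y i * y j)) ≡⟨ sum-cong-≗ (λ i → *-distribˡ-sum (F₀ * y i) y) ⟨
          sum (λ i → F₀ * y i * Y)               ≡⟨ *-distribʳ-sum Y (λ i → F₀ * y i) ⟨
          sum (λ i → F₀ * y i) * Y               ≡⟨ cong (_* Y) (*-distribˡ-sum F₀ y) ⟨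
          F₀ * Y * Y                             ∎
        sum-T₂ : sum (λ i → sum (T₂ i)) ≡ y · y
        sum-T₂ = sum-cong-≗ λ i → sum-pick (λ j → y i * y j) i

      z : Fin (suc N) → ℚ
      z zero    = z₀
      z (suc i) = x i

      Dg : D z g A ≡ z₀ * g A + F₁ * Y
      Dg = cong₂ _+_ (cong (z₀ *_) (*-identityˡ (g A)))
        (trans (sum-cong-≗ first-order) (sym (*-distribˡ-sum F₁ y)))

      DDg : D z (D z g) A ≡ z₀ * D z g A + (z₀ * (F₁ * Y) + sum (λ i → sum (P i)))
      DDg = cong₂ _+_ (cong (z₀ *_) (*-identityˡ (D z g A))) (begin
        sum (λ i → x i * (c i * (z₀ * (1ℚ * g (A ∖ i)) + sum (λ j → x j * (⟦ lookup (A ∖ i) j ⟧ * g (A ∖ i ∖ j))))))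
          ≡⟨ sum-cong-≗ (λ i → trans (lemma (x i) (c i) z₀ (g (A ∖ i)) (sum (λ j → x j * (⟦ lookup (A ∖ i) j ⟧ * g (A ∖ i ∖ j)))))
               (cong₂ (λ a b → a + z₀ * b)
                 (trans (*-distribˡ-sum (x i * c i) (λ j → x j * (⟦ lookup (A ∖ i) j ⟧ * g (A ∖ i ∖ j))))
                        (sum-cong-≗ λ j → *-assoc (x i) (c i) (x j * (⟦ lookup (A ∖ i) j ⟧ * g (A ∖ i ∖ j)))))
                 (first-order i))) ⟩
        sum (λ i → sum (P i) + z₀ * (F₁ * y i))
          ≡⟨ sum-linear (λ i → sum (P i)) (λ i → F₁ * y i) z₀ ⟩
        sum (λ i → sum (P i)) + z₀ * sum (λ i → F₁ * y i)
          ≡⟨ trans (cong (λ w → sum (λ i → sum (P i)) + z₀ * w) (sym (*-distribˡ-sum F₁ y))) (+-comm (sum (λ i → sum (P i))) (z₀ * (F₁ * Y))) ⟩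
        z₀ * (F₁ * Y) + sum (λ i → sum (P i)) ∎)
        where
        open ≡-Reasoning
        lemma : ∀ x c z g s → x * (c * (z * (1ℚ * g) + s)) ≡ x * c * s + z * (x * (c * g))
        lemma = solve-∀ ring

      perp : D z g A ≡ 0ℚ → D z (D z g) A ≤ 0ℚ
      perp z⊥ = *-cancelˡ 0<G (subst (G * D z (D z g) A ≤_) (sym (*-zeroʳ G))
        (subst (_≤ 0ℚ) (sym G*DDg) (neg-antimono-≤ (0≤* (0≤* (<⇒≤ (0<! k)) (<⇒≤ (0<! (suc k)))) (0≤- Y²≤mS)))))
        where
        open ≡-Reasoning
        G = F₂ * q ^ ν A
        0<G : 0ℚ < G
        0<G = 0<* (0<! (suc (suc k))) (0<^ (ν A) 0<q)
        B = sum (λ i → sum (P i))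
        M = ι (suc k)
        gA : g A ≡ G
        gA = cong (λ n → ι (n !) * q ^ ν A) ∣A∣≡
        balance : z₀ * G + F₁ * Y ≡ 0ℚ
        balance = trans (cong (λ w → z₀ * w + F₁ * Y) (sym gA)) (trans (sym Dg) z⊥)
        -- The condition on z reads z₀G = -F₁Y. Eliminating z₀ leaves F₂F₀(Y² - S) - F₁²Y², and F₁ =
        -- (k + 1)F₀, F₂ = mF₁ turn this into F₀F₁(Y² - mS): the factorials produce exactly the
        -- Cauchy-Schwarz constant.
        G*DDg : G * D z (D z g) A ≡ - (F₀ * F₁ * (m * S - Y * Y))
        G*DDg = begin
          G * D z (D z g) A
            ≡⟨ cong (G *_) (trans DDg (cong (λ w → z₀ * w + (z₀ * (F₁ * Y) + B)) z⊥)) ⟩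
          G * (z₀ * 0ℚ + (z₀ * (F₁ * Y) + B))
            ≡⟨ lemma₁ F₂ (q ^ ν A) z₀ (F₁ * Y) B (F₁ * F₁ * (Y * Y)) ⟩
          (z₀ * G + F₁ * Y) * (F₁ * Y) - F₁ * F₁ * (Y * Y) + F₂ * (q ^ ν A * B) + (F₁ * F₁ * (Y * Y) - (F₁ * Y) * (F₁ * Y))
            ≡⟨ cong₂ (λ a b → a * (F₁ * Y) - F₁ * F₁ * (Y * Y) + F₂ * b + (F₁ * F₁ * (Y * Y) - (F₁ * Y) * (F₁ * Y))) balance sum-P ⟩
          0ℚ * (F₁ * Y) - F₁ * F₁ * (Y * Y) + F₂ * (F₀ * (Y * Y - S)) + (F₁ * F₁ * (Y * Y) - (F₁ * Y) * (F₁ * Y))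
            ≡⟨ cong₂ (λ a b → 0ℚ * (F₁ * Y) - F₁ * a * (Y * Y) + b * (F₀ * (Y * Y - S)) + (F₁ * F₁ * (Y * Y) - (F₁ * Y) * (F₁ * Y)))
                 (ι-* (suc k) (k !)) (ι-* (suc (suc k)) (suc k !)) ⟩
          0ℚ * (F₁ * Y) - F₁ * (M * F₀) * (Y * Y) + (m * F₁) * (F₀ * (Y * Y - S)) + (F₁ * F₁ * (Y * Y) - (F₁ * Y) * (F₁ * Y))
            ≡⟨ lemma₂ F₀ F₁ Y M S ⟩
          - (F₀ * F₁ * (m * S - Y * Y)) ∎
          where
          lemma₁ : ∀ F Q z U B V → (F * Q) * (z * 0ℚ + (z * U + B)) ≡ (z * (F * Q) + U) * U - V + F * (Q * B) + (V - U * U)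
          lemma₁ = solve-∀ ring
          lemma₂ : ∀ F₀ F₁ Y M S → 0ℚ * (F₁ * Y) - F₁ * (M * F₀) * (Y * Y) + ((1ℚ + M) * F₁) * (F₀ * (Y * Y - S)) + (F₁ * F₁ * (Y * Y) - (F₁ * Y) * (F₁ * Y))
                 ≡ - (F₀ * F₁ * ((1ℚ + M) * S - Y * Y))
          lemma₂ = solve-∀ ring

    -- With ∂/∂w as reference, which fixes every weight, orthogonality is the vanishing of a first
    -- derivative: one linear equation that determines z₀.
    weight-hyperbolic : ∀ A → 2 ℕ.≤ ∣ A ∣ → Hyperbolic g A
    weight-hyperbolic A 2≤∣A∣ = hyperbolic g A e₀
      (λ b 0<b → <⇒≤ (D-pos b (D b g) 0<b (D-pos b g 0<b 0<g) A))
      (λ b 0<b → subst (0ℚ <_) (sym (D-cong b De₀ A)) (D-pos b g 0<b 0<g A))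
      perp
      where
      0<g : ∀ B → 0ℚ < g B
      0<g = weight-pos ν 0<q
      e₀ : Fin (suc N) → ℚ
      e₀ zero    = 1ℚ
      e₀ (suc i) = 0ℚ
      De₀ : ∀ B → D e₀ g B ≡ g B
      De₀ B = trans (cong₂ _+_ (trans (*-identityˡ (1ℚ * g B)) (*-identityˡ (g B)))
        (sum-zero _ λ i → *-zeroˡ (∂ (suc i) g B))) (+-identityʳ (g B))
      k = ∣ A ∣ ℕ.∸ 2
      ∣A∣≡ : ∣ A ∣ ≡ suc (suc k)
      ∣A∣≡ = sym (ℕ.m+[n∸m]≡n 2≤∣A∣)
      perp : ∀ z → D z (D e₀ g) A ≡ 0ℚ → D z (D z g) A ≤ 0ℚ
      perp z z⊥ =
        Base.perp A k ∣A∣≡ (z zero) (λ i → z (suc i)) (trans (sym (D-cong z De₀ A)) z⊥)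

-- Rank and nullity of matroids and of direct sums

module MatroidNullity where
  open import Data.Fin.Base using (_↑ˡ_; _↑ʳ_)
  open import Data.Fin.Properties using (_≟_; any?)
  open import Data.Fin.Subset
  open import Data.Fin.Subset.Properties
  open import Data.Nat.Base using (_+_; _≤_; s≤s; z≤n)
  import Data.Nat.Tactic.RingSolver as ℕSolver
  open import Data.Vec.Base using (_[_]≔_; take; drop)
  open import Data.Vec.Properties using ([]≔-commutes; lookup∘update′; lookup∘update; []=⇒lookup; lookup⇒[]=; []≔-lookup)
  open import Defs using (Matroid; Independent; independent?; empty; hereditary; augmentation)
  open import Relation.Nullary using (¬?)
  open import Relation.Nullary.Decidable using (_×-dec_)
  open Hyperbolicity using (_∖_; ∣A∣≤1+∣del∣)
  open NullityFunctions using (IsNullity; ∣A∖i∣)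

  ∖-absent : ∀ {N} (A : Subset N) i → lookup A i ≡ false → A ∖ i ≡ A
  ∖-absent A i i∉A = trans (cong (A [ i ]≔_) (sym i∉A)) ([]≔-lookup A i)

  ∖-⊆ : ∀ {N} (A : Subset N) i → A ∖ i ⊆ A
  ∖-⊆ A i {x} x∈ with x ≟ i
  ... | yes refl = contradiction (trans (sym ([]=⇒lookup x∈)) (lookup∘update x A outside)) λ ()
  ... | no x≢i   = lookup⇒[]= x A (trans (sym (lookup∘update′ x≢i A outside)) ([]=⇒lookup x∈))

  ∈∖ : ∀ {N} {A : Subset N} {i x} → x ∈ A → x ≢ i → x ∈ A ∖ i
  ∈∖ {A = A} {i} {x} x∈A x≢i = lookup⇒[]= x (A ∖ i) (trans (lookup∘update′ x≢i A outside) ([]=⇒lookup x∈A))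

  ∉∖ : ∀ {N} (A : Subset N) i → i ∉ A ∖ i
  ∉∖ A i i∈ = contradiction (trans (sym ([]=⇒lookup i∈)) (lookup∘update i A outside)) λ ()

  ∖-mono : ∀ {N} {A B : Subset N} i → A ⊆ B → A ∖ i ⊆ B ∖ i
  ∖-mono {A = A} i A⊆B {x} x∈ with x ≟ i
  ... | yes refl = contradiction x∈ (∉∖ A i)
  ... | no x≢i   = ∈∖ (A⊆B (∖-⊆ A i x∈)) x≢i

  𝟏 : Bool → ℕ
  𝟏 true  = 1
  𝟏 false = 0

  ∣∖∣ : ∀ {N} (A : Subset N) i → ∣ A ∣ ≡ 𝟏 (lookup A i) + ∣ A ∖ i ∣
  ∣∖∣ A i with lookup A i in eq
  ... | true  = ∣A∖i∣ A i eq
  ... | false = cong ∣_∣ (sym (∖-absent A i eq))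

  ∣∖∣-modular : ∀ {N} (A : Subset N) {i j} → i ≢ j → ∣ A ∖ i ∣ + ∣ A ∖ j ∣ ≡ ∣ A ∣ + ∣ A ∖ i ∖ j ∣
  ∣∖∣-modular A {i} {j} i≢j = begin
    ∣ A ∖ i ∣ + ∣ A ∖ j ∣                                        ≡⟨ cong (∣ A ∖ i ∣ +_) (∣∖∣ (A ∖ j) i) ⟩
    ∣ A ∖ i ∣ + (𝟏 (lookup (A ∖ j) i) + ∣ A ∖ j ∖ i ∣)           ≡⟨ cong₂ (λ b B → ∣ A ∖ i ∣ + (𝟏 b + ∣ B ∣))
                                                                      (lookup∘update′ i≢j A outside) (sym ([]≔-commutes A i j i≢j)) ⟩
    ∣ A ∖ i ∣ + (𝟏 (lookup A i) + ∣ A ∖ i ∖ j ∣)                 ≡⟨ ℕ.+-assoc (∣ A ∖ i ∣) (𝟏 (lookup A i)) _ ⟨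
    ∣ A ∖ i ∣ + 𝟏 (lookup A i) + ∣ A ∖ i ∖ j ∣                   ≡⟨ cong (_+ ∣ A ∖ i ∖ j ∣) (trans (ℕ.+-comm (∣ A ∖ i ∣) (𝟏 (lookup A i))) (sym (∣∖∣ A i))) ⟩
    ∣ A ∣ + ∣ A ∖ i ∖ j ∣                                        ∎
    where open ≡-Reasoning

  module _ {n : ℕ} (M : Matroid n) where

    record Basis (A J : Subset n) : Set where
      field
        basis       : Subset n
        extends     : J ⊆ basis
        within      : basis ⊆ A
        independent : Independent M basis
        maximal     : ∀ {x} → x ∈ A → x ∉ basis → ¬ Independent M (basis ∪ ⁅ x ⁆)

    open Basis

    -- Greedy extension. When the fuel is spent, J already has n elements, so a further element is
    -- impossible.
    extend : ∀ fuel {A J} → n ≤ ∣ J ∣ + fuel → J ⊆ A → Independent M J → Basis A J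
    extend fuel {A} {J} enough J⊆A J-ind
      with any? (λ x → x ∈? A ×-dec ¬? (x ∈? J) ×-dec independent? M (J ∪ ⁅ x ⁆))
    ... | no stuck = record
      { basis = J ; extends = λ x∈ → x∈ ; within = J⊆A ; independent = J-ind
      ; maximal = λ {x} x∈A x∉J ind → stuck (x , x∈A , x∉J , ind) }
    ... | yes (x , x∈A , x∉J , ind) = grow fuel enough
      where
      J⊂J∪x : J ⊂ J ∪ ⁅ x ⁆
      J⊂J∪x = p⊆p∪q ⁅ x ⁆ , x , q⊆p∪q J ⁅ x ⁆ (x∈⁅x⁆ x) , x∉J
      J∪x⊆A : J ∪ ⁅ x ⁆ ⊆ A
      J∪x⊆A {y} y∈ with x∈p∪q⁻ J ⁅ x ⁆ y∈
      ... | inj₁ y∈J = J⊆A y∈J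
      ... | inj₂ y∈x = subst (_∈ A) (sym (x∈⁅y⁆⇒x≡y x y∈x)) x∈A
      grow : ∀ fuel → n ≤ ∣ J ∣ + fuel → Basis A J
      grow zero       enough = contradiction
        (ℕ.<-≤-trans (p⊂q⇒∣p∣<∣q∣ J⊂J∪x) (ℕ.≤-trans (∣p∣≤n (J ∪ ⁅ x ⁆)) (subst (n ≤_) (ℕ.+-identityʳ ∣ J ∣) enough)))
        (ℕ.<-irrefl refl)
      grow (suc fuel) enough =
        let b = extend fuel (ℕ.≤-trans enough (ℕ.≤-trans (ℕ.≤-reflexive (ℕ.+-suc ∣ J ∣ fuel))
                  (ℕ.+-monoˡ-≤ fuel (p⊂q⇒∣p∣<∣q∣ J⊂J∪x)))) J∪x⊆A ind
        in record
          { basis = basis b ; extends = λ y∈J → extends b (p⊆p∪q ⁅ x ⁆ y∈J) ; within = within b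
          ; independent = independent b ; maximal = maximal b }

    extension : ∀ {A J} → J ⊆ A → Independent M J → Basis A J
    extension {J = J} = extend n (ℕ.m≤n+m n ∣ J ∣)

    some-basis : ∀ A → Basis A ⊥
    some-basis A = extension (λ x∈⊥ → contradiction x∈⊥ ∉⊥) (empty M)

    rank : Subset n → ℕ
    rank A = ∣ basis (some-basis A) ∣

    independent-≤-basis : ∀ {A J K} (b : Basis A J) → K ⊆ A → Independent M K → ∣ K ∣ ≤ ∣ basis b ∣
    independent-≤-basis {K = K} b K⊆A K-ind with ∣ K ∣ ℕ.≤? ∣ basis b ∣
    ... | yes K≤b = K≤b
    ... | no K≰b =
      let x , x∈K , x∉b , ind = augmentation M (independent b) K-ind (ℕ.≰⇒> K≰b)
      in contradiction ind (maximal b (K⊆A x∈K) x∉b)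

    independent-≤-rank : ∀ {A K} → K ⊆ A → Independent M K → ∣ K ∣ ≤ rank A
    independent-≤-rank {A} = independent-≤-basis (some-basis A)

    rank≤∣∣ : ∀ A → rank A ≤ ∣ A ∣
    rank≤∣∣ A = p⊆q⇒∣p∣≤∣q∣ (within (some-basis A))

    rank-mono : ∀ A i → rank (A ∖ i) ≤ rank A
    rank-mono A i = independent-≤-rank (λ x∈ → ∖-⊆ A i (within b x∈)) (independent b)
      where b = some-basis (A ∖ i)

    ∖-independent : ∀ A {J} (b : Basis A J) i → ∣ basis b ∖ i ∣ ≤ rank (A ∖ i)
    ∖-independent A b i = independent-≤-rank (∖-mono i (within b)) (hereditary M (∖-⊆ (basis b) i) (independent b))

    -- Monotonicity of nullity, free of subtraction: a basis of A with i removed is independent in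
    -- A∖i, and it loses an element only if A does.
    rank-unit : ∀ A i → ∣ A ∖ i ∣ + rank A ≤ ∣ A ∣ + rank (A ∖ i)
    rank-unit A i = begin
      ∣ A ∖ i ∣ + ∣ basis b ∣                                   ≡⟨ cong (∣ A ∖ i ∣ +_) (∣∖∣ (basis b) i) ⟩
      ∣ A ∖ i ∣ + (𝟏 (lookup (basis b) i) + ∣ basis b ∖ i ∣)    ≤⟨ ℕ.+-monoʳ-≤ ∣ A ∖ i ∣ (ℕ.+-mono-≤ b≤A (∖-independent A b i)) ⟩
      ∣ A ∖ i ∣ + (𝟏 (lookup A i) + rank (A ∖ i))               ≡⟨ ℕ.+-assoc (∣ A ∖ i ∣) (𝟏 (lookup A i)) (rank (A ∖ i)) ⟨
      ∣ A ∖ i ∣ + 𝟏 (lookup A i) + rank (A ∖ i)                 ≡⟨ cong (_+ rank (A ∖ i)) (trans (ℕ.+-comm (∣ A ∖ i ∣) (𝟏 (lookup A i))) (sym (∣∖∣ A i))) ⟩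
      ∣ A ∣ + rank (A ∖ i)                                      ∎
      where
      open ℕ.≤-Reasoning
      b = some-basis A
      b≤A : 𝟏 (lookup (basis b) i) ≤ 𝟏 (lookup A i)
      b≤A with lookup (basis b) i in eq
      ... | false = z≤n
      ... | true  = ℕ.≤-reflexive (cong 𝟏 (sym ([]=⇒lookup (within b (lookup⇒[]= i (basis b) eq)))))

    -- Extend a basis B of A∖i∖j to a basis C of A; then r(A) + r(A∖i∖j) ≤ |C| + |C∖i∖j| = |C∖i| + |C∖j|.
    rank-submodular : ∀ A {i j} → i ≢ j → rank A + rank (A ∖ i ∖ j) ≤ rank (A ∖ i) + rank (A ∖ j)
    rank-submodular A {i} {j} i≢j = begin
      rank A + ∣ basis b ∣                    ≤⟨ ℕ.+-mono-≤ A≤c (p⊆q⇒∣p∣≤∣q∣ b⊆c∖i∖j) ⟩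
      ∣ basis c ∣ + ∣ basis c ∖ i ∖ j ∣       ≡⟨ ∣∖∣-modular (basis c) i≢j ⟨
      ∣ basis c ∖ i ∣ + ∣ basis c ∖ j ∣       ≤⟨ ℕ.+-mono-≤ (∖-independent A c i) (∖-independent A c j) ⟩
      rank (A ∖ i) + rank (A ∖ j)             ∎
      where
      open ℕ.≤-Reasoning
      b = some-basis (A ∖ i ∖ j)
      c : Basis A (basis b)
      c = extension (λ x∈ → ∖-⊆ A i (∖-⊆ (A ∖ i) j (within b x∈))) (independent b)
      A≤c : rank A ≤ ∣ basis c ∣
      A≤c = independent-≤-basis c (within (some-basis A)) (independent (some-basis A))
      b⊆c∖i∖j : basis b ⊆ basis c ∖ i ∖ j
      b⊆c∖i∖j {x} x∈b = ∈∖ (∈∖ (extends c x∈b) x≢i) x≢j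
        where
        x≢j : x ≢ j
        x≢j refl = ∉∖ (A ∖ i) j (within b x∈b)
        x≢i : x ≢ i
        x≢i refl = ∉∖ A i (∖-⊆ (A ∖ i) j (within b x∈b))

    nullity : Subset n → ℕ
    nullity A = ∣ A ∣ ℕ.∸ rank A

    nullity+rank : ∀ A → nullity A + rank A ≡ ∣ A ∣
    nullity+rank A = ℕ.m∸n+n≡m (rank≤∣∣ A)

    -- Ranks are added to both sides and cancelled at the end, so that truncated subtraction enters
    -- only through `nullity+rank`.
    nullity-isNullity : IsNullity nullity
    nullity-isNullity = record
      { mono = λ A i → ℕ.+-cancelʳ-≤ (rank (A ∖ i) + rank A) _ _ (begin
          nullity (A ∖ i) + (rank (A ∖ i) + rank A)  ≡⟨ ℕ.+-assoc (nullity (A ∖ i)) (rank (A ∖ i)) (rank A) ⟨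
          nullity (A ∖ i) + rank (A ∖ i) + rank A    ≡⟨ cong (_+ rank A) (nullity+rank (A ∖ i)) ⟩
          ∣ A ∖ i ∣ + rank A                         ≤⟨ rank-unit A i ⟩
          ∣ A ∣ + rank (A ∖ i)                       ≡⟨ cong (_+ rank (A ∖ i)) (nullity+rank A) ⟨
          nullity A + rank A + rank (A ∖ i)          ≡⟨ ℕ.+-assoc (nullity A) (rank A) (rank (A ∖ i)) ⟩
          nullity A + (rank A + rank (A ∖ i))        ≡⟨ cong (nullity A +_) (ℕ.+-comm (rank A) (rank (A ∖ i))) ⟩
          nullity A + (rank (A ∖ i) + rank A)        ∎)
      ; unit = λ A i → ℕ.+-cancelʳ-≤ (rank A) _ _ (begin
          nullity A + rank A                         ≡⟨ nullity+rank A ⟩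
          ∣ A ∣                                      ≤⟨ ∣A∣≤1+∣del∣ (suc i) A ⟩
          suc ∣ A ∖ i ∣                              ≡⟨ cong suc (nullity+rank (A ∖ i)) ⟨
          suc (nullity (A ∖ i) + rank (A ∖ i))       ≤⟨ s≤s (ℕ.+-monoʳ-≤ (nullity (A ∖ i)) (rank-mono A i)) ⟩
          suc (nullity (A ∖ i)) + rank A             ∎)
      ; supermodular = λ A {i} {j} i≢j → ℕ.+-cancelʳ-≤ (rank A + rank (A ∖ i ∖ j)) _ _ (begin
          (nullity (A ∖ i) + nullity (A ∖ j)) + (rank A + rank (A ∖ i ∖ j))       ≤⟨ ℕ.+-monoʳ-≤ (nullity (A ∖ i) + nullity (A ∖ j)) (rank-submodular A i≢j) ⟩
          (nullity (A ∖ i) + nullity (A ∖ j)) + (rank (A ∖ i) + rank (A ∖ j))     ≡⟨ interchange (nullity (A ∖ i)) (nullity (A ∖ j)) (rank (A ∖ i)) (rank (A ∖ j)) ⟩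
          (nullity (A ∖ i) + rank (A ∖ i)) + (nullity (A ∖ j) + rank (A ∖ j))     ≡⟨ cong₂ _+_ (nullity+rank (A ∖ i)) (nullity+rank (A ∖ j)) ⟩
          ∣ A ∖ i ∣ + ∣ A ∖ j ∣                                                   ≡⟨ ∣∖∣-modular A i≢j ⟩
          ∣ A ∣ + ∣ A ∖ i ∖ j ∣                                                   ≡⟨ cong₂ _+_ (nullity+rank A) (nullity+rank (A ∖ i ∖ j)) ⟨
          (nullity A + rank A) + (nullity (A ∖ i ∖ j) + rank (A ∖ i ∖ j))         ≡⟨ interchange (nullity A) (rank A) (nullity (A ∖ i ∖ j)) (rank (A ∖ i ∖ j)) ⟩
          (nullity A + nullity (A ∖ i ∖ j)) + (rank A + rank (A ∖ i ∖ j))         ∎)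
      }
      where
      open ℕ.≤-Reasoning
      interchange : ∀ a b c d → (a + b) + (c + d) ≡ (a + c) + (b + d)
      interchange = ℕSolver.solve-∀

    independent⇒nullity≡0 : ∀ {A} → Independent M A → nullity A ≡ 0
    independent⇒nullity≡0 A-ind = ℕ.m≤n⇒m∸n≡0 (independent-≤-rank (λ x∈ → x∈) A-ind)

    nullity≡0⇒independent : ∀ {A} → nullity A ≡ 0 → Independent M A
    nullity≡0⇒independent {A} ν≡0 = hereditary M A⊆b (independent b)
      where
      b = some-basis A
      A⊆b : A ⊆ basis b
      A⊆b {x} x∈A with x ∈? basis b
      ... | yes x∈b = x∈b
      ... | no x∉b  = contradiction (p⊂q⇒∣p∣<∣q∣ (within b , x , x∈A , x∉b)) (ℕ.≤⇒≯ (ℕ.m∸n≡0⇒m≤n ν≡0))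

  take-∖ˡ : ∀ m {n} (A : Subset (m + n)) i → take m (A ∖ (i ↑ˡ n)) ≡ take m A ∖ i
  take-∖ˡ (suc m) (x ∷ A) zero    = refl
  take-∖ˡ (suc m) (x ∷ A) (suc i) = cong (x ∷_) (take-∖ˡ m A i)

  drop-∖ˡ : ∀ m {n} (A : Subset (m + n)) i → drop m (A ∖ (i ↑ˡ n)) ≡ drop m A
  drop-∖ˡ (suc m) (x ∷ A) zero    = refl
  drop-∖ˡ (suc m) (x ∷ A) (suc i) = drop-∖ˡ m A i

  take-∖ʳ : ∀ m {n} (A : Subset (m + n)) i → take m (A ∖ (m ↑ʳ i)) ≡ take m A
  take-∖ʳ zero    A       i = refl
  take-∖ʳ (suc m) (x ∷ A) i = cong (x ∷_) (take-∖ʳ m A i)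

  drop-∖ʳ : ∀ m {n} (A : Subset (m + n)) i → drop m (A ∖ (m ↑ʳ i)) ≡ drop m A ∖ i
  drop-∖ʳ zero    A       i = refl
  drop-∖ʳ (suc m) (x ∷ A) i = drop-∖ʳ m A i

  data Half {m n : ℕ} : Fin (m + n) → Set where
    left  : ∀ i → Half (i ↑ˡ n)
    right : ∀ i → Half (m ↑ʳ i)

  half : ∀ m {n} (i : Fin (m + n)) → Half {m} {n} i
  half zero    i       = right i
  half (suc m) zero    = left zero
  half (suc m) (suc i) with half m i
  ... | left i′  = left (suc i′)
  ... | right i′ = right i′

  module _ {m n : ℕ} {ν₁ : Subset m → ℕ} {ν₂ : Subset n → ℕ} (is₁ : IsNullity ν₁) (is₂ : IsNullity ν₂) where
    private
      module N₁ = IsNullity is₁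
      module N₂ = IsNullity is₂

    _⊕_ : Subset (m + n) → ℕ
    _⊕_ A = ν₁ (take m A) + ν₂ (drop m A)

    private
      ν : Subset (m + n) → ℕ
      ν = _⊕_

      νˡ : ∀ A i → ν (A ∖ (i ↑ˡ n)) ≡ ν₁ (take m A ∖ i) + ν₂ (drop m A)
      νˡ A i = cong₂ (λ a b → ν₁ a + ν₂ b) (take-∖ˡ m A i) (drop-∖ˡ m A i)

      νʳ : ∀ A i → ν (A ∖ (m ↑ʳ i)) ≡ ν₁ (take m A) + ν₂ (drop m A ∖ i)
      νʳ A i = cong₂ (λ a b → ν₁ a + ν₂ b) (take-∖ʳ m A i) (drop-∖ʳ m A i)

    -- A pair within one summand inherits supermodularity from it; a pair meeting both gives
    -- equality, as the deletions act on separate terms.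
    ⊕-isNullity : IsNullity _⊕_
    ⊕-isNullity = record { mono = mono ; unit = unit ; supermodular = supermodular }
      where
      open ℕ.≤-Reasoning
      mono : ∀ A i → ν (A ∖ i) ≤ ν A
      mono A i with half m i
      ... | left i  = ℕ.≤-trans (ℕ.≤-reflexive (νˡ A i)) (ℕ.+-monoˡ-≤ (ν₂ (drop m A)) (N₁.mono (take m A) i))
      ... | right i = ℕ.≤-trans (ℕ.≤-reflexive (νʳ A i)) (ℕ.+-monoʳ-≤ (ν₁ (take m A)) (N₂.mono (drop m A) i))
      unit : ∀ A i → ν A ≤ suc (ν (A ∖ i))
      unit A i with half m i
      ... | left i  = ℕ.≤-trans (ℕ.+-monoˡ-≤ (ν₂ (drop m A)) (N₁.unit (take m A) i)) (ℕ.≤-reflexive (cong suc (sym (νˡ A i))))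
      ... | right i = ℕ.≤-trans (ℕ.+-monoʳ-≤ (ν₁ (take m A)) (N₂.unit (drop m A) i))
                        (ℕ.≤-reflexive (trans (ℕ.+-suc (ν₁ (take m A)) (ν₂ (drop m A ∖ i))) (cong suc (sym (νʳ A i)))))
      swap₁ : ∀ a b c → (a + b) + (c + b) ≡ (a + c) + (b + b)
      swap₁ = ℕSolver.solve-∀
      swap₂ : ∀ a b c d → (a + b) + (c + d) ≡ (c + b) + (a + d)
      swap₂ = ℕSolver.solve-∀
      swap₃ : ∀ a b c → (a + b) + (a + c) ≡ (a + a) + (b + c)
      swap₃ = ℕSolver.solve-∀
      supermodular : ∀ A {i j} → i ≢ j → ν (A ∖ i) + ν (A ∖ j) ≤ ν A + ν (A ∖ i ∖ j)
      supermodular A {i} {j} i≢j with half m i | half m j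
      ... | left i | left j = begin
        ν (A ∖ (i ↑ˡ n)) + ν (A ∖ (j ↑ˡ n))              ≡⟨ cong₂ _+_ (νˡ A i) (νˡ A j) ⟩
        (ν₁ (a ∖ i) + ν₂ b) + (ν₁ (a ∖ j) + ν₂ b)        ≡⟨ swap₁ (ν₁ (a ∖ i)) (ν₂ b) (ν₁ (a ∖ j)) ⟩
        (ν₁ (a ∖ i) + ν₁ (a ∖ j)) + (ν₂ b + ν₂ b)        ≤⟨ ℕ.+-monoˡ-≤ (ν₂ b + ν₂ b) (N₁.supermodular a λ i≡j → i≢j (cong (_↑ˡ n) i≡j)) ⟩
        (ν₁ a + ν₁ (a ∖ i ∖ j)) + (ν₂ b + ν₂ b)          ≡⟨ swap₁ (ν₁ a) (ν₂ b) (ν₁ (a ∖ i ∖ j)) ⟨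
        ν A + (ν₁ (a ∖ i ∖ j) + ν₂ b)                    ≡⟨ cong (ν A +_) (trans (νˡ (A ∖ (i ↑ˡ n)) j)
                                                              (cong₂ (λ a b → ν₁ (a ∖ j) + ν₂ b) (take-∖ˡ m A i) (drop-∖ˡ m A i))) ⟨
        ν A + ν (A ∖ (i ↑ˡ n) ∖ (j ↑ˡ n))                ∎
        where
        a = take m A
        b = drop m A
      ... | right i | right j = begin
        ν (A ∖ (m ↑ʳ i)) + ν (A ∖ (m ↑ʳ j))              ≡⟨ cong₂ _+_ (νʳ A i) (νʳ A j) ⟩
        (ν₁ a + ν₂ (b ∖ i)) + (ν₁ a + ν₂ (b ∖ j))        ≡⟨ swap₃ (ν₁ a) (ν₂ (b ∖ i)) (ν₂ (b ∖ j)) ⟩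
        (ν₁ a + ν₁ a) + (ν₂ (b ∖ i) + ν₂ (b ∖ j))        ≤⟨ ℕ.+-monoʳ-≤ (ν₁ a + ν₁ a) (N₂.supermodular b λ i≡j → i≢j (cong (m ↑ʳ_) i≡j)) ⟩
        (ν₁ a + ν₁ a) + (ν₂ b + ν₂ (b ∖ i ∖ j))          ≡⟨ swap₃ (ν₁ a) (ν₂ b) (ν₂ (b ∖ i ∖ j)) ⟨
        ν A + (ν₁ a + ν₂ (b ∖ i ∖ j))                    ≡⟨ cong (ν A +_) (trans (νʳ (A ∖ (m ↑ʳ i)) j)
                                                              (cong₂ (λ a b → ν₁ a + ν₂ (b ∖ j)) (take-∖ʳ m A i) (drop-∖ʳ m A i))) ⟨
        ν A + ν (A ∖ (m ↑ʳ i) ∖ (m ↑ʳ j))                ∎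
        where
        a = take m A
        b = drop m A
      ... | left i | right j = ℕ.≤-reflexive (begin-equality
        ν (A ∖ (i ↑ˡ n)) + ν (A ∖ (m ↑ʳ j))              ≡⟨ cong₂ _+_ (νˡ A i) (νʳ A j) ⟩
        (ν₁ (a ∖ i) + ν₂ b) + (ν₁ a + ν₂ (b ∖ j))        ≡⟨ swap₂ (ν₁ (a ∖ i)) (ν₂ b) (ν₁ a) (ν₂ (b ∖ j)) ⟩
        ν A + (ν₁ (a ∖ i) + ν₂ (b ∖ j))                  ≡⟨ cong (ν A +_) (trans (νʳ (A ∖ (i ↑ˡ n)) j)
                                                              (cong₂ (λ a b → ν₁ a + ν₂ (b ∖ j)) (take-∖ˡ m A i) (drop-∖ˡ m A i))) ⟨
        ν A + ν (A ∖ (i ↑ˡ n) ∖ (m ↑ʳ j))                ∎)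
        where
        a = take m A
        b = drop m A
      ... | right i | left j = ℕ.≤-reflexive (begin-equality
        ν (A ∖ (m ↑ʳ i)) + ν (A ∖ (j ↑ˡ n))              ≡⟨ cong₂ _+_ (νʳ A i) (νˡ A j) ⟩
        (ν₁ a + ν₂ (b ∖ i)) + (ν₁ (a ∖ j) + ν₂ b)        ≡⟨ swap₄ (ν₁ a) (ν₂ (b ∖ i)) (ν₁ (a ∖ j)) (ν₂ b) ⟩
        ν A + (ν₁ (a ∖ j) + ν₂ (b ∖ i))                  ≡⟨ cong (ν A +_) (trans (νˡ (A ∖ (m ↑ʳ i)) j)
                                                              (cong₂ (λ a b → ν₁ (a ∖ j) + ν₂ b) (take-∖ʳ m A i) (drop-∖ʳ m A i))) ⟨
        ν A + ν (A ∖ (m ↑ʳ i) ∖ (j ↑ˡ n))                ∎)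
        where
        a = take m A
        b = drop m A
        swap₄ : ∀ a b c d → (a + b) + (c + d) ≡ (a + d) + (c + b)
        swap₄ = ℕSolver.solve-∀

-- Limits with linear rate and the inequality at q = 0

module Limits where
  open import Data.Fin.Subset as Subset using (Subset)
  open import Data.List.Properties using (length-map)
  open import Data.Rational.Base
  open import Data.Rational.Properties
  open Rationals
  open Hyperbolicity
  open NullityFunctions
  open Potts

  infix 4 _⟶_

  -- The functions that occur are polynomial in ε, so a linear rate at 0 is available; restricting
  -- to ε ≤ 1 absorbs the ε² that products create.
  record _⟶_ (f : ℚ → ℚ) (c : ℚ) : Set where
    constructor near
    field
      bound   : ℚ
      0≤bound : 0ℚ ≤ bound
      close   : ∀ ε → 0ℚ < ε → ε ≤ 1ℚ → ∣ f ε - c ∣ ≤ bound * ε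

  ⟶-const : ∀ c → (λ _ → c) ⟶ c
  ⟶-const c = near 0ℚ ≤-refl λ ε _ _ → ≤-reflexive (trans (cong ∣_∣ (+-inverseʳ c)) (sym (*-zeroˡ ε)))

  ⟶-id : (λ ε → ε) ⟶ 0ℚ
  ⟶-id = near 1ℚ 0≤1 λ ε 0<ε _ → ≤-reflexive
    (trans (cong ∣_∣ (lemma ε)) (trans (0≤p⇒∣p∣≡p (<⇒≤ 0<ε)) (sym (*-identityˡ ε))))
    where
    lemma : ∀ ε → ε - 0ℚ ≡ ε
    lemma = solve-∀ ring

  ⟶-+ : ∀ {f g c d} → f ⟶ c → g ⟶ d → (λ ε → f ε + g ε) ⟶ c + d
  ⟶-+ {f} {g} {c} {d} (near C 0≤C f→c) (near E 0≤E g→d) = near (C + E) (0≤+ 0≤C 0≤E) λ ε 0<ε ε≤1 → begin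
    ∣ f ε + g ε - (c + d) ∣          ≡⟨ cong ∣_∣ (lemma (f ε) (g ε) c d) ⟩
    ∣ (f ε - c) + (g ε - d) ∣        ≤⟨ ∣p+q∣≤∣p∣+∣q∣ (f ε - c) (g ε - d) ⟩
    ∣ f ε - c ∣ + ∣ g ε - d ∣        ≤⟨ +-mono-≤ (f→c ε 0<ε ε≤1) (g→d ε 0<ε ε≤1) ⟩
    C * ε + E * ε                    ≡⟨ *-distribʳ-+ ε C E ⟨
    (C + E) * ε                      ∎
    where
    open ≤-Reasoning
    lemma : ∀ f g c d → f + g - (c + d) ≡ (f - c) + (g - d)
    lemma = solve-∀ ring

  ⟶-* : ∀ {f g c d} → f ⟶ c → g ⟶ d → (λ ε → f ε * g ε) ⟶ c * d
  ⟶-* {f} {g} {c} {d} (near C 0≤C f→c) (near E 0≤E g→d) =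
    near (C * E + ∣ c ∣ * E + ∣ d ∣ * C)
    (0≤+ (0≤+ (0≤* 0≤C 0≤E) (0≤* (0≤∣p∣ c) 0≤E)) (0≤* (0≤∣p∣ d) 0≤C))
    λ ε 0<ε ε≤1 → begin
      ∣ f ε * g ε - c * d ∣
        ≡⟨ cong ∣_∣ (lemma (f ε) (g ε) c d) ⟩
      ∣ (f ε - c) * (g ε - d) + c * (g ε - d) + d * (f ε - c) ∣
        ≤⟨ ≤-trans (∣p+q∣≤∣p∣+∣q∣ ((f ε - c) * (g ε - d) + c * (g ε - d)) (d * (f ε - c)))
             (+-monoˡ-≤ ∣ d * (f ε - c) ∣ (∣p+q∣≤∣p∣+∣q∣ ((f ε - c) * (g ε - d)) (c * (g ε - d)))) ⟩
      ∣ (f ε - c) * (g ε - d) ∣ + ∣ c * (g ε - d) ∣ + ∣ d * (f ε - c) ∣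
        ≡⟨ cong₂ _+_ (cong₂ _+_ (∣p*q∣≡∣p∣*∣q∣ (f ε - c) (g ε - d)) (∣p*q∣≡∣p∣*∣q∣ c (g ε - d))) (∣p*q∣≡∣p∣*∣q∣ d (f ε - c)) ⟩
      ∣ f ε - c ∣ * ∣ g ε - d ∣ + ∣ c ∣ * ∣ g ε - d ∣ + ∣ d ∣ * ∣ f ε - c ∣
        ≤⟨ +-mono-≤ (+-mono-≤ (product ε 0<ε ε≤1) (*-monoˡ (0≤∣p∣ c) (g→d ε 0<ε ε≤1))) (*-monoˡ (0≤∣p∣ d) (f→c ε 0<ε ε≤1)) ⟩
      C * E * ε + ∣ c ∣ * (E * ε) + ∣ d ∣ * (C * ε)
        ≡⟨ lemma₂ C E ∣ c ∣ ∣ d ∣ ε ⟩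
      (C * E + ∣ c ∣ * E + ∣ d ∣ * C) * ε ∎
    where
    open ≤-Reasoning
    lemma : ∀ f g c d → f * g - c * d ≡ (f - c) * (g - d) + c * (g - d) + d * (f - c)
    lemma = solve-∀ ring
    lemma₂ : ∀ C E c d ε → C * E * ε + c * (E * ε) + d * (C * ε) ≡ (C * E + c * E + d * C) * ε
    lemma₂ = solve-∀ ring
    lemma₃ : ∀ C E ε → C * ε * (E * ε) ≡ (C * E * ε) * ε
    lemma₃ = solve-∀ ring
    product : ∀ ε → 0ℚ < ε → ε ≤ 1ℚ → ∣ f ε - c ∣ * ∣ g ε - d ∣ ≤ C * E * ε
    product ε 0<ε ε≤1 = begin
      ∣ f ε - c ∣ * ∣ g ε - d ∣    ≤⟨ *-monoˡ (0≤∣p∣ (f ε - c)) (g→d ε 0<ε ε≤1) ⟩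
      ∣ f ε - c ∣ * (E * ε)        ≤⟨ *-monoʳ-≤-nonNeg (E * ε) {{nonNegative (0≤* 0≤E (<⇒≤ 0<ε))}} (f→c ε 0<ε ε≤1) ⟩
      C * ε * (E * ε)              ≡⟨ lemma₃ C E ε ⟩
      (C * E * ε) * ε              ≤⟨ *-monoˡ (0≤* (0≤* 0≤C 0≤E) (<⇒≤ 0<ε)) ε≤1 ⟩
      (C * E * ε) * 1ℚ             ≡⟨ *-identityʳ (C * E * ε) ⟩
      C * E * ε                    ∎

  ⟶-sum : ∀ {n} {f : ℚ → Fin n → ℚ} {c : Fin n → ℚ} → (∀ i → (λ ε → f ε i) ⟶ c i) → (λ ε → sum (f ε)) ⟶ sum c
  ⟶-sum {zero}  f→c = ⟶-const 0ℚ
  ⟶-sum {suc n} f→c = ⟶-+ (f→c zero) (⟶-sum λ i → f→c (suc i))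

  ⟶-^ : ∀ k → (λ ε → ε ^ k) ⟶ 0ℚ ^ k
  ⟶-^ zero    = ⟶-const 1ℚ
  ⟶-^ (suc k) = ⟶-* ⟶-id (⟶-^ k)

  ⟶-nonneg : ∀ {f c} → f ⟶ c → (∀ ε → 0ℚ < ε → ε ≤ 1ℚ → 0ℚ ≤ f ε) → 0ℚ ≤ c
  ⟶-nonneg {f} {c} (near C 0≤C f→c) 0≤f with 0ℚ ≤? c
  ... | yes 0≤c = 0≤c
  ... | no 0≰c  = contradiction (≤-<-trans (0≤f ε 0<ε ε≤1) fε<0) (<-irrefl refl)
    where
    e : ℚ
    e = - c
    0<e : 0ℚ < e
    0<e = neg-antimono-< (≰⇒> 0≰c)
    K : ℚ
    K = 1ℚ + (C + e)
    0<K : 0ℚ < K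
    0<K = +-mono-<-≤ 0<1 (0≤+ 0≤C (<⇒≤ 0<e))
    r = proj₁ (recip 0<K)
    0<r = proj₁ (proj₂ (recip 0<K))
    Kr≡1 : K * r ≡ 1ℚ
    Kr≡1 = proj₂ (proj₂ (recip 0<K))
    -- ε = e/(1 + C + e) is at most 1 and has Cε < e = -c, which pushes f ε below 0.
    ε : ℚ
    ε = e * r
    0<ε : 0ℚ < ε
    0<ε = 0<* 0<e 0<r
    ε≤1 : ε ≤ 1ℚ
    ε≤1 = ≤-by {c = (1ℚ + C) * r} (0≤* (0≤+ 0≤1 0≤C) (<⇒≤ 0<r)) (trans (lemma e r C) Kr≡1)
      where
      lemma : ∀ e r C → e * r + (1ℚ + C) * r ≡ (1ℚ + (C + e)) * r
      lemma = solve-∀ ring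
    p≤∣p∣ : ∀ p → p ≤ ∣ p ∣
    p≤∣p∣ p with ≤-total 0ℚ p
    ... | inj₁ 0≤p = ≤-reflexive (sym (0≤p⇒∣p∣≡p 0≤p))
    ... | inj₂ p≤0 = ≤-trans p≤0 (0≤∣p∣ p)
    fε<0 : f ε < 0ℚ
    fε<0 = begin-strict
      f ε                              ≡⟨ lemma (f ε) c ⟩
      (f ε - c) + c                    ≤⟨ +-monoˡ-≤ c (≤-trans (p≤∣p∣ (f ε - c)) (f→c ε 0<ε ε≤1)) ⟩
      C * (e * r) + c                  ≡⟨ +-identityʳ (C * (e * r) + c) ⟨
      C * (e * r) + c + 0ℚ             <⟨ +-monoʳ-< (C * (e * r) + c) (0<* 0<e (0<* 0<r (+-mono-<-≤ 0<1 (<⇒≤ 0<e)))) ⟩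
      C * (e * r) + c + e * (r * (1ℚ + e)) ≡⟨ lemma₂ C e r c ⟩
      e * (K * r) + c                  ≡⟨ cong (λ z → e * z + c) Kr≡1 ⟩
      e * 1ℚ + c                       ≡⟨ lemma₃ c ⟩
      0ℚ                               ∎
      where
      open ≤-Reasoning
      lemma : ∀ f c → f ≡ (f - c) + c
      lemma = solve-∀ ring
      lemma₂ : ∀ C e r c → C * (e * r) + c + e * (r * (1ℚ + e)) ≡ e * ((1ℚ + (C + e)) * r) + c
      lemma₂ = solve-∀ ring
      lemma₃ : ∀ c → - c * 1ℚ + c ≡ 0ℚ
      lemma₃ = solve-∀ ring

  module _ {N : ℕ} where

    shift : ℚ → Direction {N} → Direction {N}
    shift ε a i = a i + ε

    shift⟶ : ∀ (a : Direction {N}) i → (λ ε → shift ε a i) ⟶ a i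
    shift⟶ a i = subst ((λ ε → a i + ε) ⟶_) (+-identityʳ (a i)) (⟶-+ (⟶-const (a i)) ⟶-id)

    D⟶ : ∀ {a : ℚ → Direction} {b : Direction} {g : ℚ → Weight {N}} {h : Weight} →
         (∀ i → (λ ε → a ε i) ⟶ b i) → (∀ A → (λ ε → g ε A) ⟶ h A) → ∀ A → (λ ε → D (a ε) (g ε) A) ⟶ D b h A
    D⟶ a→b g→h A = ⟶-sum λ i → ⟶-* (a→b i) (⟶-* (⟶-const [ i ∈ A ]) (g→h (del i A)))

    Ds⟶ : ∀ as {g : ℚ → Weight {N}} {h : Weight} → (∀ A → (λ ε → g ε A) ⟶ h A) →
          ∀ A → (λ ε → Ds (map (shift ε) as) (g ε) A) ⟶ Ds as h A
    Ds⟶ []       g→h = g→h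
    Ds⟶ (a ∷ as) g→h = D⟶ (shift⟶ a) (Ds⟶ as g→h)

    shift-pos : ∀ {ε} {a : Direction {N}} → 0ℚ < ε → (∀ i → 0ℚ ≤ a i) → ∀ i → 0ℚ < shift ε a i
    shift-pos 0<ε 0≤a i = +-mono-≤-< (0≤a i) 0<ε

    shifts-pos : ∀ {ε} {as : List (Direction {N})} → 0ℚ < ε → All (λ a → ∀ i → 0ℚ ≤ a i) as →
                 All (λ a → ∀ i → 0ℚ < a i) (map (shift ε) as)
    shifts-pos 0<ε []           = []
    shifts-pos 0<ε (0≤a ∷ 0≤as) = shift-pos 0<ε 0≤a ∷ shifts-pos 0<ε 0≤as

    -- A single ε acts as q and as the shift that makes `as` and `b` positive; x may be any
    -- direction and stays fixed. The difference of the two sides is nonnegative for each ε in (0,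
    -- 1] and converges.
    alexandrov-fenchel : ∀ {ν : Subset N → ℕ} → IsNullity ν → ∀ {as} → All (λ a → ∀ i → 0ℚ ≤ a i) as →
      ∀ A → 2 ℕ.+ length as ℕ.≤ Subset.∣ A ∣ → ∀ x {b} → (∀ i → 0ℚ ≤ b i) →
      let g = Ds as (weight ν 0ℚ) in
      D x (D x g) A * D b (D b g) A ≤ D x (D b g) A * D x (D b g) A
    alexandrov-fenchel {ν} isNullity {as} 0≤as A as≤A x {b} 0≤b =
      ≤-by {c = xb * xb - xx * bb} (⟶-nonneg limit λ ε 0<ε ε≤1 → subst (0ℚ ≤_) (lemma′ (Xb ε * Xb ε) (Xx ε * Bb ε))
        (0≤- (Ds-hyperbolic (gε ε) (weight-pos ν 0<ε) (PottsWeight.weight-hyperbolic isNullity 0<ε ε≤1)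
          (map (shift ε) as) (shifts-pos 0<ε 0≤as) A (subst (λ l → 2 ℕ.+ l ℕ.≤ Subset.∣ A ∣) (sym (length-map (shift ε) as)) as≤A)
          x (shift ε b) (shift-pos 0<ε 0≤b)))) (lemma (xx * bb) (xb * xb))
      where
      lemma′ : ∀ u v → u - v ≡ u + - 1ℚ * v
      lemma′ = solve-∀ ring
      lemma : ∀ u v → u + (v - u) ≡ v
      lemma = solve-∀ ring
      gε : ℚ → Weight
      gε ε = weight ν ε
      G : ℚ → Weight
      G ε = Ds (map (shift ε) as) (gε ε)
      g : Weight
      g = Ds as (weight ν 0ℚ)
      Xx Bb Xb : ℚ → ℚ
      Xx ε = D x (D x (G ε)) A
      Bb ε = D (shift ε b) (D (shift ε b) (G ε)) A
      Xb ε = D x (D (shift ε b) (G ε)) A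
      xx = D x (D x g) A
      bb = D b (D b g) A
      xb = D x (D b g) A
      G⟶ : ∀ A → (λ ε → G ε A) ⟶ g A
      G⟶ = Ds⟶ as λ A → ⟶-* (⟶-const (ι (Subset.∣ A ∣ !))) (⟶-^ (ν A))
      x⟶ : ∀ i → (λ _ → x i) ⟶ x i
      x⟶ i = ⟶-const (x i)
      limit : (λ ε → Xb ε * Xb ε + - 1ℚ * (Xx ε * Bb ε)) ⟶ xb * xb - xx * bb
      limit = subst ((λ ε → Xb ε * Xb ε + - 1ℚ * (Xx ε * Bb ε)) ⟶_) (sym (lemma′ (xb * xb) (xx * bb)))
        (⟶-+ (⟶-* Xb⟶ Xb⟶) (⟶-* (⟶-const (- 1ℚ)) (⟶-* (D⟶ x⟶ (D⟶ x⟶ G⟶) A) (D⟶ (shift⟶ b) (D⟶ (shift⟶ b) G⟶) A))))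
        where
        Xb⟶ : Xb ⟶ xb
        Xb⟶ = D⟶ x⟶ (D⟶ (shift⟶ b) G⟶) A

-- Mixed derivatives as counts of disjoint pairs

module PairCounting where
  import Data.Bool.Properties as Bool
  open import Data.Fin.Base as Fin using (_↑ˡ_; _↑ʳ_)
  open import Data.Fin.Properties using (_≟_; splitAt-↑ˡ; splitAt-↑ʳ)
  open import Data.Fin.Subset using (Subset; inside; outside; ∣_∣; ⊤; ⊥; ∁; _∩_; _∪_)
  open import Data.Fin.Subset.Properties using (∣⊤∣≡n; ∣p∣≤n)
  open import Data.List.Base using (replicate; filter; cartesianProduct; allFin; tabulate) renaming (_++_ to _++ˡ_)
  open import Data.List.Properties using (map-tabulate; length-++; foldr-++; length-map; length-tabulate; length-replicate)
  import Data.List.Relation.Unary.All.Properties as All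
  import Data.Nat.Tactic.RingSolver as ℕSolver
  open import Data.Rational.Base hiding (∣_∣)
  open import Data.Rational.Properties hiding (_≟_)
  open import Data.Sum.Base using ([_,_]′)
  open import Data.Vec.Base using (_++_; take; drop)
  open import Data.Vec.Properties using ([]≔-++-↑ˡ; []≔-++-↑ʳ; lookup-++ˡ; lookup-++ʳ; ∷-injectiveʳ; ≡-dec)
  open import Defs using (Matroid; Independent; independent?; subsets; disjointIndependentPair?) renaming (H to pairs)
  open import Function.Base using (_∘_)
  open import Function.Bundles using (mk⇔)
  open import Relation.Nullary.Decidable using (does-⇔; dec-true; dec-false; _×-dec_)
  open import Relation.Unary using (Decidable)
  open Rationals
  open Hyperbolicity
  open NullityFunctions
  open MatroidNullity
  open Limits

  ∑⊆ : ∀ {n} → (Subset n → ℚ) → ℚ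
  ∑⊆ {zero}  f = f []
  ∑⊆ {suc n} f = ∑⊆ (λ A → f (outside ∷ A)) + ∑⊆ (λ A → f (inside ∷ A))

  ∑⊆-cong : ∀ {n} {f g : Subset n → ℚ} → (∀ A → f A ≡ g A) → ∑⊆ f ≡ ∑⊆ g
  ∑⊆-cong {zero}  f≗g = f≗g []
  ∑⊆-cong {suc n} f≗g = cong₂ _+_ (∑⊆-cong λ A → f≗g (outside ∷ A)) (∑⊆-cong λ A → f≗g (inside ∷ A))

  *-distribˡ-∑⊆ : ∀ {n} c (f : Subset n → ℚ) → c * ∑⊆ f ≡ ∑⊆ λ A → c * f A
  *-distribˡ-∑⊆ {zero}  c f = refl
  *-distribˡ-∑⊆ {suc n} c f = trans (*-distribˡ-+ c (∑⊆ f₀) (∑⊆ f₁)) (cong₂ _+_ (*-distribˡ-∑⊆ c f₀) (*-distribˡ-∑⊆ c f₁))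
    where
    f₀ f₁ : Subset n → ℚ
    f₀ A = f (outside ∷ A)
    f₁ A = f (inside ∷ A)

  ∑⊆-zero : ∀ {n} (f : Subset n → ℚ) → (∀ A → f A ≡ 0ℚ) → ∑⊆ f ≡ 0ℚ
  ∑⊆-zero {zero}  f f≡0 = f≡0 []
  ∑⊆-zero {suc n} f f≡0 = cong₂ _+_ (∑⊆-zero _ λ A → f≡0 (outside ∷ A)) (∑⊆-zero _ λ A → f≡0 (inside ∷ A))

  ∑ˡ : ∀ {A : Set} → (A → ℚ) → List A → ℚ
  ∑ˡ f = foldr (λ x s → f x + s) 0ℚ

  ∑ˡ-++ : ∀ {A : Set} (f : A → ℚ) xs ys → ∑ˡ f (xs ++ˡ ys) ≡ ∑ˡ f xs + ∑ˡ f ys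
  ∑ˡ-++ f []       ys = sym (+-identityˡ (∑ˡ f ys))
  ∑ˡ-++ f (x ∷ xs) ys = trans (cong (f x +_) (∑ˡ-++ f xs ys)) (sym (+-assoc (f x) (∑ˡ f xs) (∑ˡ f ys)))

  ∑ˡ-map : ∀ {A B : Set} (f : B → ℚ) (g : A → B) xs → ∑ˡ f (map g xs) ≡ ∑ˡ (f ∘ g) xs
  ∑ˡ-map f g []       = refl
  ∑ˡ-map f g (x ∷ xs) = cong (f (g x) +_) (∑ˡ-map f g xs)

  ∑ˡ-subsets : ∀ n (f : Subset n → ℚ) → ∑ˡ f (subsets n) ≡ ∑⊆ f
  ∑ˡ-subsets zero    f = +-identityʳ (f [])
  ∑ˡ-subsets (suc n) f = trans (∑ˡ-++ f (map (outside ∷_) (subsets n)) (map (inside ∷_) (subsets n)))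
    (cong₂ _+_ (trans (∑ˡ-map f (outside ∷_) (subsets n)) (∑ˡ-subsets n _))
               (trans (∑ˡ-map f (inside ∷_) (subsets n)) (∑ˡ-subsets n _)))

  count-filter : ∀ {A : Set} {P : A → Set} (P? : Decidable P) xs →
                 ι (length (filter P? xs)) ≡ ∑ˡ (λ x → ⟦ does (P? x) ⟧) xs
  count-filter P? []       = refl
  count-filter P? (x ∷ xs) with does (P? x)
  ... | true  = cong (λ z → 1ℚ + z) (count-filter P? xs)
  ... | false = trans (count-filter P? xs) (sym (+-identityˡ _))

  ∑ˡ-product : ∀ {A B : Set} (f : A × B → ℚ) xs ys →
               ∑ˡ f (cartesianProduct xs ys) ≡ ∑ˡ (λ x → ∑ˡ (λ y → f (x , y)) ys) xs
  ∑ˡ-product f []       ys = refl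
  ∑ˡ-product f (x ∷ xs) ys = trans (∑ˡ-++ f (map (x ,_) ys) (cartesianProduct xs ys))
    (cong₂ _+_ (∑ˡ-map f (x ,_) ys) (∑ˡ-product f xs ys))

  pairs-sum : ∀ {n} (M₁ M₂ : Matroid n) k →
              ι (pairs M₁ M₂ k) ≡ ∑⊆ λ S → ∑⊆ λ T → ⟦ does (disjointIndependentPair? M₁ M₂ k (S , T)) ⟧
  pairs-sum {n} M₁ M₂ k = begin
    ι (pairs M₁ M₂ k)                                              ≡⟨ count-filter P? (cartesianProduct (subsets n) (subsets n)) ⟩
    ∑ˡ (λ p → ⟦ does (P? p) ⟧) (cartesianProduct (subsets n) (subsets n)) ≡⟨ ∑ˡ-product (λ p → ⟦ does (P? p) ⟧) (subsets n) (subsets n) ⟩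
    ∑ˡ (λ S → ∑ˡ (λ T → ⟦ does (P? (S , T)) ⟧) (subsets n)) (subsets n) ≡⟨ ∑ˡ-subsets n (λ S → ∑ˡ (λ T → ⟦ does (P? (S , T)) ⟧) (subsets n)) ⟩
    ∑⊆ (λ S → ∑ˡ (λ T → ⟦ does (P? (S , T)) ⟧) (subsets n))        ≡⟨ ∑⊆-cong (λ S → ∑ˡ-subsets n (λ T → ⟦ does (P? (S , T)) ⟧)) ⟩
    ∑⊆ (λ S → ∑⊆ λ T → ⟦ does (P? (S , T)) ⟧)                      ∎
    where
    open ≡-Reasoning
    P? = disjointIndependentPair? M₁ M₂ k

  -- The action of Σ ∂yᵢ on one copy of the ground set, see `D-second`.
  Λ : ∀ {n} → (Subset n → ℚ) → Subset n → ℚ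
  Λ f A = sum λ i → ⟦ lookup A i ⟧ * f (A ∖ i)

  Λ-cong : ∀ {n} {f g : Subset n → ℚ} → (∀ A → f A ≡ g A) → ∀ A → Λ f A ≡ Λ g A
  Λ-cong f≗g A = sum-cong-≗ λ i → cong (⟦ lookup A i ⟧ *_) (f≗g (A ∖ i))

  Λ-linear : ∀ {n} (f g : Subset n → ℚ) t A → Λ (λ B → f B + t * g B) A ≡ Λ f A + t * Λ g A
  Λ-linear f g t A = trans (sum-cong-≗ λ i → lemma ⟦ lookup A i ⟧ (f (A ∖ i)) t (g (A ∖ i)))
    (sum-linear (λ i → ⟦ lookup A i ⟧ * f (A ∖ i)) (λ i → ⟦ lookup A i ⟧ * g (A ∖ i)) t)
    where
    lemma : ∀ c x t y → c * (x + t * y) ≡ c * x + t * (c * y)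
    lemma = solve-∀ ring

  -- The sum of f over the subsets obtained from A by deleting j elements.
  removals : ∀ {n} → ℕ → (Subset n → ℚ) → Subset n → ℚ
  removals j       f (false ∷ A) = removals j (λ B → f (false ∷ B)) A
  removals zero    f []          = f []
  removals (suc j) f []          = 0ℚ
  removals zero    f (true ∷ A)  = removals zero (λ B → f (true ∷ B)) A
  removals (suc j) f (true ∷ A)  = removals (suc j) (λ B → f (true ∷ B)) A + removals j (λ B → f (false ∷ B)) A

  removals-zero : ∀ {n} (f : Subset n → ℚ) A → removals zero f A ≡ f A
  removals-zero f []          = refl
  removals-zero f (false ∷ A) = removals-zero (λ B → f (false ∷ B)) A
  removals-zero f (true ∷ A)  = removals-zero (λ B → f (true ∷ B)) A

  -- A set of j + 1 removed elements arises once for each of its elements as the one that `Λ`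
  -- deletes. Iterating produces j!.
  Λ-removals : ∀ {n} j (f : Subset n → ℚ) A → Λ (removals j f) A ≡ ι (suc j) * removals (suc j) f A
  Λ-removals j f [] = sym (*-zeroʳ (ι (suc j)))
  Λ-removals j f (false ∷ A) = trans (cong₂ _+_ (*-zeroˡ (removals j f (false ∷ A))) (Λ-removals j (λ B → f (false ∷ B)) A))
    (+-identityˡ _)
  Λ-removals zero f (true ∷ A) = trans
    (cong (1ℚ * removals zero (λ B → f (false ∷ B)) A +_) (Λ-removals zero (λ B → f (true ∷ B)) A))
    (lemma (removals zero (λ B → f (false ∷ B)) A) (removals 1 (λ B → f (true ∷ B)) A))
    where
    lemma : ∀ a b → 1ℚ * a + (1ℚ + 0ℚ) * b ≡ (1ℚ + 0ℚ) * (b + a)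
    lemma = solve-∀ ring
  Λ-removals (suc j) f (true ∷ A) = begin
    1ℚ * removals (suc j) f₀ A + Λ (λ B → removals (suc j) f₁ B + removals j f₀ B) A
      ≡⟨ cong (1ℚ * removals (suc j) f₀ A +_) (trans
           (Λ-cong (λ B → cong (removals (suc j) f₁ B +_) (sym (*-identityˡ (removals j f₀ B)))) A)
           (Λ-linear (removals (suc j) f₁) (removals j f₀) 1ℚ A)) ⟩
    1ℚ * removals (suc j) f₀ A + (Λ (removals (suc j) f₁) A + 1ℚ * Λ (removals j f₀) A)
      ≡⟨ cong₂ (λ x y → 1ℚ * removals (suc j) f₀ A + (x + 1ℚ * y)) (Λ-removals (suc j) f₁ A) (Λ-removals j f₀ A) ⟩
    1ℚ * removals (suc j) f₀ A + (ι (suc (suc j)) * removals (suc (suc j)) f₁ A + 1ℚ * (ι (suc j) * removals (suc j) f₀ A))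
      ≡⟨ lemma (removals (suc j) f₀ A) (ι (suc j)) (removals (suc (suc j)) f₁ A) ⟩
    ι (suc (suc j)) * (removals (suc (suc j)) f₁ A + removals (suc j) f₀ A) ∎
    where
    open ≡-Reasoning
    f₀ f₁ : Subset _ → ℚ
    f₀ B = f (false ∷ B)
    f₁ B = f (true ∷ B)
    lemma : ∀ a i b → 1ℚ * a + ((1ℚ + i) * b + 1ℚ * (i * a)) ≡ (1ℚ + i) * (b + a)
    lemma = solve-∀ ring

  -- j counts the elements covered by neither set; the additive form lets the recursion on n avoid
  -- subtraction.
  Split : ∀ {n} → ℕ → Subset n → Subset n → Set
  Split {n} j T I = T ∩ I ≡ ⊥ × ∣ T ∪ I ∣ ℕ.+ j ≡ n

  split? : ∀ {n} j (T I : Subset n) → Dec (Split j T I)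
  split? {n} j T I = ≡-dec Bool._≟_ (T ∩ I) ⊥ ×-dec (∣ T ∪ I ∣ ℕ.+ j ℕ.≟ n)

  -- Whatever is left of ∁ T is disjoint from T, and the deleted elements are exactly those left
  -- uncovered. The recursion decides the fate of the first element: in T, kept, or deleted.
  removals-∁ : ∀ {n} j (f : Subset n → ℚ) T → removals j f (∁ T) ≡ ∑⊆ λ I → ⟦ does (split? j T I) ⟧ * f I
  removals-∁ zero    f []         = sym (*-identityˡ (f []))
  removals-∁ (suc j) f []         = sym (*-zeroˡ (f []))
  removals-∁ {suc n} j f (true ∷ T) = trans (removals-∁ j (λ I → f (false ∷ I)) T) (sym (trans
    (cong₂ _+_ (∑⊆-cong λ I → cong (λ b → ⟦ b ⟧ * f (false ∷ I)) (does-⇔ (mk⇔ down up) (split? j (true ∷ T) (false ∷ I)) (split? j T I)))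
               (∑⊆-zero _ λ I → trans (cong (λ b → ⟦ b ⟧ * f (true ∷ I)) (dec-false (split? j (true ∷ T) (true ∷ I)) λ ()))
                                       (*-zeroˡ (f (true ∷ I)))))
    (+-identityʳ _)))
    where
    down : ∀ {I} → Split j (true ∷ T) (false ∷ I) → Split j T I
    down (disjoint , size) = ∷-injectiveʳ disjoint , ℕ.suc-injective size
    up : ∀ {I} → Split j T I → Split j (true ∷ T) (false ∷ I)
    up (disjoint , size) = cong (false ∷_) disjoint , cong suc size
  removals-∁ {suc n} zero f (false ∷ T) = trans (removals-∁ zero (λ I → f (true ∷ I)) T) (sym (trans
    (cong₂ _+_ (∑⊆-zero _ λ I → trans (cong (λ b → ⟦ b ⟧ * f (false ∷ I)) (dec-false (split? zero (false ∷ T) (false ∷ I)) (full I)))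
                                       (*-zeroˡ (f (false ∷ I))))
               (∑⊆-cong λ I → cong (λ b → ⟦ b ⟧ * f (true ∷ I)) (does-⇔ (mk⇔ down up) (split? zero (false ∷ T) (true ∷ I)) (split? zero T I))))
    (+-identityˡ _)))
    where
    -- With no deletions left the first element has to be covered; otherwise n elements would cover
    -- n + 1.
    full : ∀ I → ¬ Split zero (false ∷ T) (false ∷ I)
    full I (_ , size) = ℕ.<-irrefl refl
      (subst (ℕ._≤ n) (trans (sym (ℕ.+-identityʳ ∣ T ∪ I ∣)) size) (∣p∣≤n (T ∪ I)))
    down : ∀ {I} → Split zero (false ∷ T) (true ∷ I) → Split zero T I
    down (disjoint , size) = ∷-injectiveʳ disjoint , ℕ.suc-injective size
    up : ∀ {I} → Split zero T I → Split zero (false ∷ T) (true ∷ I)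
    up (disjoint , size) = cong (false ∷_) disjoint , cong suc size
  removals-∁ {suc n} (suc j) f (false ∷ T) = trans
    (trans (cong₂ _+_ (removals-∁ (suc j) (λ I → f (true ∷ I)) T) (removals-∁ j (λ I → f (false ∷ I)) T))
      (+-comm (∑⊆ λ I → ⟦ does (split? (suc j) T I) ⟧ * f (true ∷ I)) (∑⊆ λ I → ⟦ does (split? j T I) ⟧ * f (false ∷ I))))
    (sym (cong₂ _+_
      (∑⊆-cong λ I → cong (λ b → ⟦ b ⟧ * f (false ∷ I)) (does-⇔ (mk⇔ down₀ up₀) (split? (suc j) (false ∷ T) (false ∷ I)) (split? j T I)))
      (∑⊆-cong λ I → cong (λ b → ⟦ b ⟧ * f (true ∷ I)) (does-⇔ (mk⇔ down₁ up₁) (split? (suc j) (false ∷ T) (true ∷ I)) (split? (suc j) T I)))))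
    where
    down₀ : ∀ {I} → Split (suc j) (false ∷ T) (false ∷ I) → Split j T I
    down₀ {I} (disjoint , size) = ∷-injectiveʳ disjoint , ℕ.suc-injective (trans (sym (ℕ.+-suc ∣ T ∪ I ∣ j)) size)
    up₀ : ∀ {I} → Split j T I → Split (suc j) (false ∷ T) (false ∷ I)
    up₀ {I} (disjoint , size) = cong (false ∷_) disjoint , trans (ℕ.+-suc ∣ T ∪ I ∣ j) (cong suc size)
    down₁ : ∀ {I} → Split (suc j) (false ∷ T) (true ∷ I) → Split (suc j) T I
    down₁ (disjoint , size) = ∷-injectiveʳ disjoint , ℕ.suc-injective size
    up₁ : ∀ {I} → Split (suc j) T I → Split (suc j) (false ∷ T) (true ∷ I)
    up₁ (disjoint , size) = cong (false ∷_) disjoint , cong suc size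

  -- ∂xᵢ + ∂yᵢ acting on the two copies. Keeping the two subsets apart, not concatenated, allows
  -- `transversals` to recurse on n.
  δ : ∀ {n} → Fin n → (Subset n → Subset n → ℚ) → Subset n → Subset n → ℚ
  δ i Φ A B = ⟦ lookup A i ⟧ * Φ (A ∖ i) B + ⟦ lookup B i ⟧ * Φ A (B ∖ i)

  δs : ∀ {n} → List (Fin n) → (Subset n → Subset n → ℚ) → Subset n → Subset n → ℚ
  δs is Φ = foldr δ Φ is

  δs-suc : ∀ {n} is (Φ : Subset (suc n) → Subset (suc n) → ℚ) a b A B →
           δs (map suc is) Φ (a ∷ A) (b ∷ B) ≡ δs is (λ A B → Φ (a ∷ A) (b ∷ B)) A B
  δs-suc []       Φ a b A B = refl
  δs-suc (i ∷ is) Φ a b A B = cong₂ (λ x y → ⟦ lookup A i ⟧ * x + ⟦ lookup B i ⟧ * y) (δs-suc is Φ a b (A ∖ i) B) (δs-suc is Φ a b A (B ∖ i))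

  -- Every element is deleted from exactly one of the two copies of the ground set.
  transversals : ∀ {n} (Φ : Subset n → Subset n → ℚ) → δs (allFin n) Φ ⊤ ⊤ ≡ ∑⊆ λ T → Φ T (∁ T)
  transversals {zero}  Φ = refl
  transversals {suc n} Φ = begin
    1ℚ * δs (tabulate suc) Φ (false ∷ ⊤) (true ∷ ⊤) + 1ℚ * δs (tabulate suc) Φ (true ∷ ⊤) (false ∷ ⊤)
      ≡⟨ cong₂ _+_ (half-step false true) (half-step true false) ⟩
    ∑⊆ (λ T → Φ (false ∷ T) (true ∷ ∁ T)) + ∑⊆ (λ T → Φ (true ∷ T) (false ∷ ∁ T)) ∎
    where
    open ≡-Reasoning
    half-step : ∀ a b → 1ℚ * δs (tabulate suc) Φ (a ∷ ⊤) (b ∷ ⊤) ≡ ∑⊆ (λ T → Φ (a ∷ T) (b ∷ ∁ T))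
    half-step a b = begin
      1ℚ * δs (tabulate suc) Φ (a ∷ ⊤) (b ∷ ⊤)          ≡⟨ *-identityˡ _ ⟩
      δs (tabulate suc) Φ (a ∷ ⊤) (b ∷ ⊤)               ≡⟨ cong (λ is → δs is Φ (a ∷ ⊤) (b ∷ ⊤)) (map-tabulate (λ i → i) suc) ⟨
      δs (map suc (allFin n)) Φ (a ∷ ⊤) (b ∷ ⊤)         ≡⟨ δs-suc (allFin n) Φ a b ⊤ ⊤ ⟩
      δs (allFin n) (λ A B → Φ (a ∷ A) (b ∷ B)) ⊤ ⊤     ≡⟨ transversals (λ A B → Φ (a ∷ A) (b ∷ B)) ⟩
      ∑⊆ (λ T → Φ (a ∷ T) (b ∷ ∁ T))                    ∎

  sum-↑ : ∀ m {n} (f : Fin (m ℕ.+ n) → ℚ) → sum f ≡ sum (λ i → f (i ↑ˡ n)) + sum (λ i → f (m ↑ʳ i))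
  sum-↑ zero    f = sym (+-identityˡ (sum f))
  sum-↑ (suc m) f = trans (cong (f zero +_) (sum-↑ m (λ i → f (suc i)))) (sym (+-assoc (f zero) _ _))

  module _ {n : ℕ} where

    direction : ℚ → (Fin n → ℚ) → (Fin n → ℚ) → Direction {n ℕ.+ n}
    direction c u v zero    = c
    direction c u v (suc i) = [ u , v ]′ (Fin.splitAt n i)

    direction-nonneg : ∀ {c u v} → 0ℚ ≤ c → (∀ i → 0ℚ ≤ u i) → (∀ i → 0ℚ ≤ v i) → ∀ i → 0ℚ ≤ direction c u v i
    direction-nonneg 0≤c 0≤u 0≤v zero    = 0≤c
    direction-nonneg 0≤c 0≤u 0≤v (suc i) with Fin.splitAt n i
    ... | inj₁ j = 0≤u j
    ... | inj₂ j = 0≤v j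

    D-direction : ∀ c u v (g : Weight) (A B : Subset n) → D (direction c u v) g (A ++ B) ≡
      c * g (A ++ B) + (sum (λ i → u i * (⟦ lookup A i ⟧ * g ((A ∖ i) ++ B))) + sum (λ i → v i * (⟦ lookup B i ⟧ * g (A ++ (B ∖ i)))))
    D-direction c u v g A B = cong₂ _+_ (cong (c *_) (*-identityˡ (g (A ++ B)))) (trans
      (sum-↑ n (λ i → [ u , v ]′ (Fin.splitAt n i) * (⟦ lookup (A ++ B) i ⟧ * g ((A ++ B) ∖ i))))
      (cong₂ _+_ (sum-cong-≗ leftwards) (sum-cong-≗ rightwards)))
      where
      leftwards : ∀ i → [ u , v ]′ (Fin.splitAt n (i ↑ˡ n)) * (⟦ lookup (A ++ B) (i ↑ˡ n) ⟧ * g ((A ++ B) ∖ (i ↑ˡ n)))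
                ≡ u i * (⟦ lookup A i ⟧ * g ((A ∖ i) ++ B))
      leftwards i = cong₂ _*_ (cong [ u , v ]′ (splitAt-↑ˡ n i n))
        (cong₂ (λ b S → ⟦ b ⟧ * g S) (lookup-++ˡ A B i) ([]≔-++-↑ˡ A B i))
      rightwards : ∀ i → [ u , v ]′ (Fin.splitAt n (n ↑ʳ i)) * (⟦ lookup (A ++ B) (n ↑ʳ i) ⟧ * g ((A ++ B) ∖ (n ↑ʳ i)))
                 ≡ v i * (⟦ lookup B i ⟧ * g (A ++ (B ∖ i)))
      rightwards i = cong₂ _*_ (cong [ u , v ]′ (splitAt-↑ʳ n n i))
        (cong₂ (λ b S → ⟦ b ⟧ * g S) (lookup-++ʳ A B i) ([]≔-++-↑ʳ A B i))

    both : Fin n → Direction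
    both i = direction 0ℚ (λ r → ⟦ does (i ≟ r) ⟧) (λ r → ⟦ does (i ≟ r) ⟧)

    -- Σ ∂yᵢ and ∂/∂w. Replacing one `second` by one `weights` leaves one more element covered, that
    -- is, raises k by 1.
    second weights : Direction
    second  = direction 0ℚ (λ _ → 0ℚ) (λ _ → 1ℚ)
    weights = direction 1ℚ (λ _ → 0ℚ) (λ _ → 0ℚ)

    both-nonneg : ∀ i j → 0ℚ ≤ both i j
    both-nonneg i = direction-nonneg ≤-refl (λ r → 0≤⟦⟧ (does (i ≟ r))) (λ r → 0≤⟦⟧ (does (i ≟ r)))

    second-nonneg : ∀ j → 0ℚ ≤ second j
    second-nonneg = direction-nonneg ≤-refl (λ _ → ≤-refl) (λ _ → 0≤1)

    weights-nonneg : ∀ j → 0ℚ ≤ weights j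
    weights-nonneg = direction-nonneg 0≤1 (λ _ → ≤-refl) (λ _ → ≤-refl)

    D-both : ∀ i (g : Weight) (A B : Subset n) → D (both i) g (A ++ B) ≡ δ i (λ A B → g (A ++ B)) A B
    D-both i g A B = trans (D-direction 0ℚ (λ r → ⟦ does (i ≟ r) ⟧) (λ r → ⟦ does (i ≟ r) ⟧) g A B) (trans
      (cong₂ _+_ (*-zeroˡ (g (A ++ B)))
        (cong₂ _+_ (sum-pick (λ r → ⟦ lookup A r ⟧ * g ((A ∖ r) ++ B)) i) (sum-pick (λ r → ⟦ lookup B r ⟧ * g (A ++ (B ∖ r))) i)))
      (+-identityˡ _))

    Ds-both : ∀ is (g : Weight) (A B : Subset n) → Ds (map both is) g (A ++ B) ≡ δs is (λ A B → g (A ++ B)) A B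
    Ds-both []       g A B = refl
    Ds-both (i ∷ is) g A B = trans (D-both i (Ds (map both is) g) A B)
      (cong₂ (λ x y → ⟦ lookup A i ⟧ * x + ⟦ lookup B i ⟧ * y) (Ds-both is g (A ∖ i) B) (Ds-both is g A (B ∖ i)))

    D-second : ∀ (g : Weight) (A B : Subset n) → D second g (A ++ B) ≡ Λ (λ B → g (A ++ B)) B
    D-second g A B = trans (D-direction 0ℚ (λ _ → 0ℚ) (λ _ → 1ℚ) g A B) (trans
      (cong₂ _+_ (*-zeroˡ (g (A ++ B)))
        (cong₂ _+_ (sum-zero _ λ i → *-zeroˡ (⟦ lookup A i ⟧ * g ((A ∖ i) ++ B)))
                   (sum-cong-≗ λ i → *-identityˡ (⟦ lookup B i ⟧ * g (A ++ (B ∖ i))))))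
      (trans (+-identityˡ _) (+-identityˡ _)))

    D-weights : ∀ (g : Weight {n ℕ.+ n}) A → D weights g A ≡ g A
    D-weights g A = trans (cong₂ _+_ (trans (*-identityˡ (1ℚ * g A)) (*-identityˡ (g A)))
        (sum-zero _ λ i → trans (cong (_* ∂ (suc i) g A) (vanish i)) (*-zeroˡ (∂ (suc i) g A))))
      (+-identityʳ (g A))
      where
      vanish : ∀ i → weights (suc i) ≡ 0ℚ
      vanish i with Fin.splitAt n i
      ... | inj₁ _ = refl
      ... | inj₂ _ = refl

    Ds-second : ∀ j (g : Weight) (A B : Subset n) → Ds (replicate j second) g (A ++ B) ≡ ι (j !) * removals j (λ B → g (A ++ B)) B
    Ds-second zero    g A B = sym (trans (*-identityˡ _) (removals-zero (λ B → g (A ++ B)) B))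
    Ds-second (suc j) g A B = begin
      D second (Ds (replicate j second) g) (A ++ B)
        ≡⟨ D-second (Ds (replicate j second) g) A B ⟩
      Λ (λ B → Ds (replicate j second) g (A ++ B)) B
        ≡⟨ Λ-cong (λ B → Ds-second j g A B) B ⟩
      Λ (λ B → ι (j !) * R j B) B
        ≡⟨ trans (sum-cong-≗ λ i → lemma ⟦ lookup B i ⟧ (ι (j !)) (R j (B ∖ i)))
                 (sym (*-distribˡ-sum (ι (j !)) (λ i → ⟦ lookup B i ⟧ * R j (B ∖ i)))) ⟩
      ι (j !) * Λ (R j) B
        ≡⟨ cong (ι (j !) *_) (Λ-removals j (λ B → g (A ++ B)) B) ⟩
      ι (j !) * (ι (suc j) * R (suc j) B)
        ≡⟨ lemma₂ (ι (j !)) (ι (suc j)) (R (suc j) B) ⟩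
      ι (suc j) * ι (j !) * R (suc j) B
        ≡⟨ cong (_* R (suc j) B) (ι-* (suc j) (j !)) ⟨
      ι (suc j !) * R (suc j) B ∎
      where
      open ≡-Reasoning
      R : ℕ → Subset n → ℚ
      R j = removals j (λ B → g (A ++ B))
      lemma : ∀ a b c → a * (b * c) ≡ b * (a * c)
      lemma = solve-∀ ring
      lemma₂ : ∀ a b c → a * (b * c) ≡ b * a * c
      lemma₂ = solve-∀ ring

  Ds-cong : ∀ {N} as {g h : Weight {N}} → (∀ A → g A ≡ h A) → ∀ A → Ds as g A ≡ Ds as h A
  Ds-cong []       g≗h = g≗h
  Ds-cong (a ∷ as) g≗h = D-cong a (Ds-cong as g≗h)

  -- The mixed inequality applies its last two derivatives outermost, whereas the count needs the
  -- ∂xᵢ + ∂yᵢ there.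
  D-Ds-comm : ∀ {N} a as (g : Weight {N}) A → D a (Ds as g) A ≡ Ds as (D a g) A
  D-Ds-comm a []       g A = refl
  D-Ds-comm a (b ∷ bs) g A = trans (D-comm a b (Ds bs g) A) (D-cong b (D-Ds-comm a bs g) A)

  take-++ : ∀ {m n} (A : Subset m) (B : Subset n) → take m (A ++ B) ≡ A
  take-++ []      B = refl
  take-++ (x ∷ A) B = cong (x ∷_) (take-++ A B)

  drop-++ : ∀ {m n} (A : Subset m) (B : Subset n) → drop m (A ++ B) ≡ B
  drop-++ []      B = refl
  drop-++ (x ∷ A) B = drop-++ A B

  ∣++∣ : ∀ {m n} (A : Subset m) (B : Subset n) → ∣ A ++ B ∣ ≡ ∣ A ∣ ℕ.+ ∣ B ∣
  ∣++∣ []          B = refl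
  ∣++∣ (true ∷ A)  B = cong suc (∣++∣ A B)
  ∣++∣ (false ∷ A) B = ∣++∣ A B

  disjoint-∣∣ : ∀ {n} (A B : Subset n) → A ∩ B ≡ ⊥ → ∣ A ∣ ℕ.+ ∣ B ∣ ≡ ∣ A ∪ B ∣
  disjoint-∣∣ []          []          eq = refl
  disjoint-∣∣ (true ∷ A)  (false ∷ B) eq = cong suc (disjoint-∣∣ A B (∷-injectiveʳ eq))
  disjoint-∣∣ (false ∷ A) (true ∷ B)  eq = trans (ℕ.+-suc ∣ A ∣ ∣ B ∣) (cong suc (disjoint-∣∣ A B (∷-injectiveʳ eq)))
  disjoint-∣∣ (false ∷ A) (false ∷ B) eq = disjoint-∣∣ A B (∷-injectiveʳ eq)

  -- Since 0⁰ = 1, the weight at q = 0 keeps precisely the sets of nullity 0.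
  0^nullity : ∀ {n} (M : Matroid n) A → 0ℚ ^ nullity M A ≡ ⟦ does (independent? M A) ⟧
  0^nullity M A with independent? M A
  ... | yes ind = cong (0ℚ ^_) (independent⇒nullity≡0 M ind)
  ... | no ¬ind with nullity M A in eq
  ...   | zero  = contradiction (nullity≡0⇒independent M eq) ¬ind
  ...   | suc k = *-zeroˡ (0ℚ ^ k)

  module _ {n : ℕ} (M₁ M₂ : Matroid n) where

    ν : Subset (n ℕ.+ n) → ℕ
    ν = nullity-isNullity M₁ ⊕ nullity-isNullity M₂

    g₀ : Weight
    g₀ = weight ν 0ℚ

    g₀-++ : ∀ T I → g₀ (T ++ I) ≡ ι ((∣ T ∣ ℕ.+ ∣ I ∣) !) * (⟦ does (independent? M₁ T) ⟧ * ⟦ does (independent? M₂ I) ⟧)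
    g₀-++ T I = cong₂ (λ s x → ι (s !) * x) (∣++∣ T I) (begin
      0ℚ ^ (nullity M₁ (take n (T ++ I)) ℕ.+ nullity M₂ (drop n (T ++ I)))
        ≡⟨ cong₂ (λ A B → 0ℚ ^ (nullity M₁ A ℕ.+ nullity M₂ B)) (take-++ T I) (drop-++ T I) ⟩
      0ℚ ^ (nullity M₁ T ℕ.+ nullity M₂ I)
        ≡⟨ ^-homo-* 0ℚ (nullity M₁ T) (nullity M₂ I) ⟩
      0ℚ ^ nullity M₁ T * 0ℚ ^ nullity M₂ I
        ≡⟨ cong₂ _*_ (0^nullity M₁ T) (0^nullity M₂ I) ⟩
      ⟦ does (independent? M₁ T) ⟧ * ⟦ does (independent? M₂ I) ⟧ ∎)
      where open ≡-Reasoning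

    -- The k! is the factorial in `weight` at T ++ I, since disjointness gives |T| + |I| = |T ∪ I| =
    -- k.
    split-weight : ∀ {j k} → k ℕ.+ j ≡ n → ∀ T I →
      ⟦ does (split? j T I) ⟧ * g₀ (T ++ I) ≡ ι (k !) * ⟦ does (disjointIndependentPair? M₁ M₂ k (T , I)) ⟧
    split-weight {j} {k} k+j≡n T I = by-split (split? j T I)
      where
      open ≡-Reasoning
      P? = disjointIndependentPair? M₁ M₂ k (T , I)
      by-split : (s : Dec (Split j T I)) → ⟦ does s ⟧ * g₀ (T ++ I) ≡ ι (k !) * ⟦ does P? ⟧
      by-split (no ¬split) = trans (*-zeroˡ (g₀ (T ++ I))) (sym (trans
        (cong (λ b → ι (k !) * ⟦ b ⟧) (dec-false P? λ (_ , _ , disjoint , size) →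
          ¬split (disjoint , trans (cong (ℕ._+ j) size) k+j≡n)))
        (*-zeroʳ (ι (k !)))))
      by-split (yes (disjoint , size)) = begin
        1ℚ * g₀ (T ++ I)
          ≡⟨ trans (*-identityˡ (g₀ (T ++ I))) (g₀-++ T I) ⟩
        ι ((∣ T ∣ ℕ.+ ∣ I ∣) !) * (⟦ does (independent? M₁ T) ⟧ * ⟦ does (independent? M₂ I) ⟧)
          ≡⟨ cong₂ (λ s x → ι (s !) * x) (trans (disjoint-∣∣ T I disjoint) ∣T∪I∣≡k) (by-independence (independent? M₁ T) (independent? M₂ I)) ⟩
        ι (k !) * ⟦ does P? ⟧ ∎
        where
        ∣T∪I∣≡k : ∣ T ∪ I ∣ ≡ k
        ∣T∪I∣≡k = ℕ.+-cancelʳ-≡ j ∣ T ∪ I ∣ k (trans size (sym k+j≡n))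
        by-independence : (d₁ : Dec (Independent M₁ T)) (d₂ : Dec (Independent M₂ I)) → ⟦ does d₁ ⟧ * ⟦ does d₂ ⟧ ≡ ⟦ does P? ⟧
        by-independence (yes i₁) (yes i₂) = cong ⟦_⟧ (sym (dec-true P? (i₁ , i₂ , disjoint , ∣T∪I∣≡k)))
        by-independence (no ¬i₁) d₂       = trans (*-zeroˡ ⟦ does d₂ ⟧) (cong ⟦_⟧ (sym (dec-false P? λ (i₁ , _) → ¬i₁ i₁)))
        by-independence (yes i₁) (no ¬i₂) = cong ⟦_⟧ (sym (dec-false P? λ (_ , i₂ , _) → ¬i₂ i₂))

    -- A concatenation, the shape on which `D-direction` computes.
    E² : Subset (n ℕ.+ n)
    E² = ⊤ {n} ++ ⊤ {n}

    -- Derivatives along ∂/∂w act on weights as the identity, so only the others are recorded.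
    mixed : ℕ → ℚ
    mixed j = Ds (map both (allFin n)) (Ds (replicate j (second {n})) g₀) E²

    -- The derivatives ∂xᵢ + ∂yᵢ leave T in the first copy and ∁ T in the second; T plays the part
    -- of I₁, and j removals cut ∁ T down to I₂.
    mixed≡ : ∀ {j k} → k ℕ.+ j ≡ n → mixed j ≡ ι (j !) * (ι (k !) * ι (pairs M₁ M₂ k))
    mixed≡ {j} {k} k+j≡n = begin
      Ds (map both (allFin n)) (Ds (replicate j (second {n})) g₀) E²
        ≡⟨ Ds-both (allFin n) (Ds (replicate j (second {n})) g₀) ⊤ ⊤ ⟩
      δs (allFin n) (λ A B → Ds (replicate j (second {n})) g₀ (A ++ B)) ⊤ ⊤
        ≡⟨ transversals {n} (λ A B → Ds (replicate j (second {n})) g₀ (A ++ B)) ⟩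
      ∑⊆ {n} (λ T → Ds (replicate j (second {n})) g₀ (T ++ ∁ T))
        ≡⟨ ∑⊆-cong (λ T → trans (Ds-second j g₀ T (∁ T)) (cong (ι (j !) *_)
             (trans (removals-∁ j (λ I → g₀ (T ++ I)) T)
               (trans (∑⊆-cong (split-weight k+j≡n T)) (sym (*-distribˡ-∑⊆ (ι (k !)) (χ T))))))) ⟩
      ∑⊆ (λ T → ι (j !) * (ι (k !) * ∑⊆ (χ T)))
        ≡⟨ *-distribˡ-∑⊆ (ι (j !)) (λ T → ι (k !) * ∑⊆ (χ T)) ⟨
      ι (j !) * ∑⊆ (λ T → ι (k !) * ∑⊆ (χ T))
        ≡⟨ cong (ι (j !) *_) (*-distribˡ-∑⊆ (ι (k !)) (λ T → ∑⊆ (χ T))) ⟨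
      ι (j !) * (ι (k !) * ∑⊆ (λ T → ∑⊆ (χ T)))
        ≡⟨ cong (λ x → ι (j !) * (ι (k !) * x)) (pairs-sum M₁ M₂ k) ⟨
      ι (j !) * (ι (k !) * ι (pairs M₁ M₂ k)) ∎
      where
      open ≡-Reasoning
      χ : Subset n → Subset n → ℚ
      χ T I = ⟦ does (disjointIndependentPair? M₁ M₂ k (T , I)) ⟧

    mixed-log-concave : ∀ k l → suc (suc (k ℕ.+ l)) ≡ n → mixed (suc (suc l)) * mixed l ≤ mixed (suc l) * mixed (suc l)
    mixed-log-concave k l k+l+2≡n = subst₂ _≤_
      (cong₂ _*_ xx≡ bb≡) (cong₂ _*_ xb≡ xb≡)
      (alexandrov-fenchel (⊕-isNullity (nullity-isNullity M₁) (nullity-isNullity M₂)) {as} 0≤as E² enough X {Y} (weights-nonneg {n}))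
      where
      open ≡-Reasoning
      X Y : Direction {n ℕ.+ n}
      X = second {n}
      Y = weights {n}
      -- n + l + k directions, which with the last two exhaust the degree 2n. The choices XX, XY and
      -- YY for those two give l + 2, l + 1 and l derivatives along `second`.
      bs cs as : List Direction
      bs = map both (allFin n)
      cs = replicate l X
      as = bs ++ˡ cs ++ˡ replicate k Y
      0≤as : All (λ a → ∀ i → 0ℚ ≤ a i) as
      0≤as = All.++⁺ (All.map⁺ {xs = allFin n} (All.tabulate⁺ both-nonneg))
        (All.++⁺ (All.replicate⁺ l second-nonneg) (All.replicate⁺ k (weights-nonneg {n})))
      length-as : 2 ℕ.+ length as ≡ ∣ E² ∣
      length-as = begin
        2 ℕ.+ length as
          ≡⟨ cong (2 ℕ.+_) (trans (length-++ bs) (cong₂ ℕ._+_ (trans (length-map both (allFin n)) (length-tabulate {n = n} (λ i → i)))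
               (trans (length-++ cs) (cong₂ ℕ._+_ (length-replicate l) (length-replicate k))))) ⟩
        2 ℕ.+ (n ℕ.+ (l ℕ.+ k))     ≡⟨ lemma n k l ⟩
        n ℕ.+ suc (suc (k ℕ.+ l))   ≡⟨ cong (n ℕ.+_) k+l+2≡n ⟩
        n ℕ.+ n                     ≡⟨ cong₂ ℕ._+_ (∣⊤∣≡n n) (∣⊤∣≡n n) ⟨
        ∣ ⊤ {n} ∣ ℕ.+ ∣ ⊤ {n} ∣     ≡⟨ ∣++∣ (⊤ {n}) (⊤ {n}) ⟨
        ∣ E² ∣                      ∎
        where
        lemma : ∀ n k l → 2 ℕ.+ (n ℕ.+ (l ℕ.+ k)) ≡ n ℕ.+ (2 ℕ.+ (k ℕ.+ l))
        lemma = ℕSolver.solve-∀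
      enough : 2 ℕ.+ length as ℕ.≤ ∣ E² ∣
      enough = ℕ.≤-reflexive length-as
      Ds-weights : ∀ k A → Ds (replicate k Y) g₀ A ≡ g₀ A
      Ds-weights zero    A = refl
      Ds-weights (suc k) A = trans (D-weights {n} (Ds (replicate k Y) g₀) A) (Ds-weights k A)
      Ds-as : ∀ A → Ds as g₀ A ≡ Ds bs (Ds cs g₀) A
      Ds-as A = trans (cong (λ h → h A) (foldr-++ D g₀ bs (cs ++ˡ replicate k Y)))
        (Ds-cong bs (λ A → trans (cong (λ h → h A) (foldr-++ D g₀ cs (replicate k Y))) (Ds-cong cs (Ds-weights k) A)) A)
      D-as : ∀ a A → D a (Ds as g₀) A ≡ Ds bs (D a (Ds cs g₀)) A
      D-as a A = trans (D-cong a Ds-as A) (D-Ds-comm a bs (Ds cs g₀) A)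
      DD-as : ∀ a b A → D a (D b (Ds as g₀)) A ≡ Ds bs (D a (D b (Ds cs g₀))) A
      DD-as a b A = trans (D-cong a (D-as b) A) (D-Ds-comm a bs (D b (Ds cs g₀)) A)
      xx≡ : D X (D X (Ds as g₀)) E² ≡ mixed (suc (suc l))
      xx≡ = DD-as X X E²
      xb≡ : D X (D Y (Ds as g₀)) E² ≡ mixed (suc l)
      xb≡ = trans (DD-as X Y E²) (Ds-cong bs (D-cong X {D Y (Ds cs g₀)} {Ds cs g₀} (D-weights {n} (Ds cs g₀))) E²)
      bb≡ : D Y (D Y (Ds as g₀)) E² ≡ mixed l
      bb≡ = trans (DD-as Y Y E²)
        (Ds-cong bs (λ A → trans (D-weights {n} (D Y (Ds cs g₀)) A) (D-weights {n} (Ds cs g₀) A)) E²)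

-- Normalisation by binomial coefficients

open import Defs
open import Data.Integer.Base using (+_)
open import Data.Nat.Base using (ℕ; _+_; z≤n; s≤s) renaming (_≤_ to _≤ℕ_)
open import Data.Nat.Combinatorics using (_C_)
open import Data.Nat.Properties using (≤-trans; m≤m+n; +-monoʳ-≤)
open import Data.Rational.Base using (_/_; _*_; _≤_)
open import Data.Nat.Base using (_∸_)
open import Data.Nat.Combinatorics using (nCk≡n!/k![n-k]!; k![n∸k]!∣n!)
open import Data.Nat.DivMod using (m/n*n≡m)
open Rationals
open NullityFunctions using (0<!)
open PairCounting

nCk*k!*j! : ∀ {n k j} → k + j ≡ n → (n C k) ℕ.* (k ! ℕ.* j !) ≡ n !
nCk*k!*j! {n} {k} {j} k+j≡n = begin
  (n C k) ℕ.* (k ! ℕ.* j !)                        ≡⟨ cong (λ i → (n C k) ℕ.* (k ! ℕ.* i !)) j≡n∸k ⟩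
  (n C k) ℕ.* (k ! ℕ.* (n ∸ k) !)                  ≡⟨ cong (ℕ._* (k ! ℕ.* (n ∸ k) !)) (nCk≡n!/k![n-k]! k≤n) ⟩
  (n ! ℕ./ (k ! ℕ.* (n ∸ k) !)) ℕ.* (k ! ℕ.* (n ∸ k) !) ≡⟨ m/n*n≡m (k![n∸k]!∣n! k≤n) ⟩
  n !                                              ∎
  where
  open ≡-Reasoning
  instance _ = k ℕ.!* (n ∸ k) !≢0
  k≤n : k ≤ℕ n
  k≤n = subst (k ≤ℕ_) k+j≡n (m≤m+n k j)
  j≡n∸k : j ≡ n ∸ k
  j≡n∸k = trans (sym (ℕ.m+n∸m≡n k j)) (cong (_∸ k) k+j≡n)

-- k! j! is n! divided by the binomial coefficient, so the factor separating a mixed derivative from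
-- the normalised count is n!, the same for every k.
normalise : ∀ {n k j} → k + j ≡ n → .{{_ : ℕ.NonZero (n C k)}} → ∀ h →
            ι (j !) * (ι (k !) * ι h) ≡ ι (n !) * (+ h / (n C k))
normalise {n} {k} {j} k+j≡n h = begin
  ι (j !) * (ι (k !) * ι h)                        ≡⟨ cong (λ x → ι (j !) * (ι (k !) * x)) (/-*-ι h (n C k)) ⟨
  ι (j !) * (ι (k !) * (p * ι (n C k)))            ≡⟨ lemma (ι (j !)) (ι (k !)) p (ι (n C k)) ⟩
  ι (n C k) * (ι (k !) * ι (j !)) * p              ≡⟨ cong (_* p) (trans (ι-* (n C k) (k ! ℕ.* j !)) (cong (ι (n C k) *_) (ι-* (k !) (j !)))) ⟨
  ι ((n C k) ℕ.* (k ! ℕ.* j !)) * p                ≡⟨ cong (λ x → ι x * p) (nCk*k!*j! {n} {k} {j} k+j≡n) ⟩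
  ι (n !) * p                                      ∎
  where
  open ≡-Reasoning
  p = + h / (n C k)
  lemma : ∀ j k p c → j * (k * (p * c)) ≡ c * (k * j) * p
  lemma = solve-∀ ring

corollary3 : ∀ (n : ℕ) (M₁ M₂ : Matroid n) (k : ℕ) (k+2≤n : k + 2 ≤ℕ n) →
    let instance
          C₀≢0 = nCk≢0 (≤-trans (m≤m+n k 2) k+2≤n)
          C₁≢0 = nCk≢0 (≤-trans (+-monoʳ-≤ k (s≤s z≤n)) k+2≤n)
          C₂≢0 = nCk≢0 k+2≤n
    in (+ H M₁ M₂ k / (n C k)) * (+ H M₁ M₂ (k + 2) / (n C (k + 2)))
         ≤ (+ H M₁ M₂ (k + 1) / (n C (k + 1))) ²
corollary3 n M₁ M₂ k k+2≤n = *-cancelˡ (0<* (0<! n) (0<! n)) (subst₂ _≤_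
  (trans (cong₂ _*_ (value {suc (suc l)} {k} size₀) (value {l} {k + 2} size₂)) (lemma (ι (n !)) p₀ p₂))
  (trans (cong₂ _*_ (value {suc l} {k + 1} size₁) (value {suc l} {k + 1} size₁)) (lemma (ι (n !)) p₁ p₁))
  (mixed-log-concave M₁ M₂ k l size))
  where
  instance
    C₀≢0 = nCk≢0 (≤-trans (m≤m+n k 2) k+2≤n)
    C₁≢0 = nCk≢0 (≤-trans (+-monoʳ-≤ k (s≤s z≤n)) k+2≤n)
    C₂≢0 = nCk≢0 k+2≤n
  p₀ = + H M₁ M₂ k / (n C k)
  p₁ = + H M₁ M₂ (k + 1) / (n C (k + 1))
  p₂ = + H M₁ M₂ (k + 2) / (n C (k + 2))
  -- The number of derivatives along `second` common to all three terms; with it the indices l + 2,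
  -- l + 1, l match k, k + 1, k + 2.
  l = n ∸ (k + 2)
  size₂ : k + 2 + l ≡ n
  size₂ = ℕ.m+[n∸m]≡n k+2≤n
  size₁ : k + 1 + suc l ≡ n
  size₁ = trans (trans (ℕ.+-assoc k 1 (suc l)) (sym (ℕ.+-assoc k 2 l))) size₂
  size₀ : k + suc (suc l) ≡ n
  size₀ = trans (sym (ℕ.+-assoc k 2 l)) size₂
  size : suc (suc (k + l)) ≡ n
  size = trans (trans (cong suc (sym (ℕ.+-suc k l))) (sym (ℕ.+-suc k (suc l)))) size₀
  value : ∀ {j i} → i + j ≡ n → .{{_ : ℕ.NonZero (n C i)}} → mixed M₁ M₂ j ≡ ι (n !) * (+ H M₁ M₂ i / (n C i))
  value {j} {i} i+j≡n = trans (mixed≡ M₁ M₂ {j} {i} i+j≡n) (normalise {n} {i} {j} i+j≡n (H M₁ M₂ i))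
  lemma : ∀ N a b → (N * a) * (N * b) ≡ (N * N) * (a * b)
  lemma = solve-∀ ring
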